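{- Let $\lambda$ and $\mu$ be partitions. Then $$\Delta\left(\mathrm{TW}^{\lambda\,\varnothing}\cdot \mathrm{TW}^{\varnothing\,\mu}\right)=\mathrm{TW}^{\lambda\,\mu}\qquad\text{and}\qquad \mathbf{\Delta}\left(\mathbf{TW}^{\lambda\,\varnothing}\cdot \mathbf{TW}^{\varnothing\,\mu}\right)=\mathbf{TW}^{\lambda\,\mu}.$$
   Context: A partition is a finite weakly decreasing sequence of non-negative integers (extended by zeros when needed); $l(\lambda)$ is the number of nonzero parts and $\varnothing$ is the trivial partition. Let $\mathbf{\Lambda}(\overline X)$, $\mathbf{\Lambda}(\overline Y)$ be the algebras of symmetric functions over $\mathbb{Q}$ in the countable variable sets $\overline X=\{x_1,x_2,\dots\}$ and $\overline Y=\{y_1,y_2,\dots\}$. Let $\mathbf{p}_k,\mathbf{h}_k$ be the power sum and complete homogeneous symmetric functions in $\overline X$, and $\tilde{\mathbf{p}}_k,\tilde{\mathbf{h}}_k$ those in $\overline Y$, with $\mathbf{h}_0=\tilde{\mathbf{h}}_0=1$ and $\mathbf{h}_k=\tilde{\mathbf{h}}_k=0$ for $k<0$. Let $\mathbf{\Lambda}(\overline X,\overline Y)=\mathbf{\Lambda}(\overline X)\otimes_{\mathbb{Q}}\mathbf{\Lambda}(\overline Y)$, which is the polynomial algebra over $\mathbb{Q}$ in the $\mathbf{p}_k,\tilde{\mathbf{p}}_k$, $k\ge1$. For partitions $\lambda,\mu$ and any integer $d\ge1$ with $\lambda_{d+1}=\mu_{d+1}=0$ (the result does not depend on the choice of $d$),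 set $$\mathbf{TW}^{\lambda\,\mu}=\det\left(\left(\tilde{\mathbf{h}}_{i-j+\mu_{d-i+1}}\right)_{1\le i\le d,\ j\ge1}\cdot\left(\mathbf{h}_{j-i+\lambda_{d-j+1}}\right)_{i\ge1,\ 1\le j\le d}\right)\in\mathbf{\Lambda}(\overline X,\overline Y),$$ the determinant of the $d\times d$ product of a $d\times\infty$ and an $\infty\times d$ matrix ($i$ is the row index and $j$ the column index in each; each entry of the product is a finite sum). Let $p_1,p_2,\dots,\tilde p_1,\tilde p_2,\dots$ be independent commuting variables, $V=\mathbb{Q}[[p_1,p_2,\dots,\tilde p_1,\tilde p_2,\dots]]$, and let $F:\mathbf{\Lambda}(\overline X,\overline Y)\to V$ be the algebra homomorphism with $\mathbf{p}_k\mapsto p_k$, $\tilde{\mathbf{p}}_k\mapsto\tilde p_k$. Set $\mathrm{TW}^{\lambda\,\mu}=F(\mathbf{TW}^{\lambda\,\mu})$, a polynomial in the $p_k,\tilde p_k$. The operator $\Delta$ is $$\Delta=\exp\left(\sum_{k>0}k\,\partial_{p_k}\partial_{\tilde p_k}\right)=\prod_{k>0}\sum_{i\ge0}\frac{k^i}{i!}(\partial_{p_k}\partial_{\tilde p_k})^i,$$ where powers denote composition; on a polynomial in the $p_k,\tilde p_k$ only finitely many terms contribute. The operator $\mathbf{\Delta}$ on $\mathbf{\Lambda}(\overline X,\overline Y)$ is defined by the same formula with $\partial_{p_k},\partial_{\tilde p_k}$ replaced by $\partial_{\mathbf{p}_k},\partial_{\tilde{\mathbf{p}}_k}$. -}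

module Defs where

open import Algebra.Bundles using (CommutativeRing; Semiring)
open import Algebra.Morphism.Structures using (IsRingHomomorphism)
import Algebra.Definitions.RawMonoid as RawMonoidOps
import Algebra.Definitions.RawSemiring as RawSemiringOps
import Algebra.Properties.CommutativeSemigroup as CommSemigroupProperties
import Algebra.Properties.Ring as RingProperties
import Algebra.Properties.Monoid.Mult as MultProperties
open import Data.Bool.Base using (if_then_else_)
open import Data.Empty using (⊥-elim)
open import Data.Fin.Base using (Fin; toℕ; punchIn) renaming (zero to fzero; suc to fsuc)
open import Data.Integer.Base as ℤ using (ℤ; +_; -[1+_])
open import Data.List.Base using (List; []; _∷_; _++_; _∷ʳ_; filter; map)
open import Data.List.Properties using (filter-++; map-++; ++-assoc; ++-identityʳ)
import Data.List.Properties as List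
open import Data.List.Relation.Binary.Permutation.Propositional as Perm using (_↭_)
open import Data.List.Relation.Binary.Permutation.Propositional.Properties using (filter-↭)
import Data.List.Relation.Binary.Permutation.Propositional.Properties as Perm
open import Data.List.Relation.Unary.Linked using (Linked)
import Data.List.Relation.Unary.Linked as Linked
open import Data.Nat.Base as ℕ using (ℕ; zero; suc; _∸_; _≤_; _<_; _≥_)
open import Data.Nat.ListAction using (sum)
open import Data.Nat.ListAction.Properties using (sum-++; sum-↭)
import Data.Nat.Properties as ℕ
open import Data.Nat.Tactic.RingSolver using (solve-∀)
open import Data.Nat.GeneralisedArithmetic using (iterate)
open import Data.Product.Base using (∃-syntax; _×_; _,_; proj₁; proj₂)
open import Data.Rational.Base as ℚ using (ℚ; 0ℚ; 1ℚ)
import Data.Rational.Properties as ℚ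
open import Data.Sum.Base using (_⊎_; inj₁; inj₂; [_,_])
open import Function.Base using (_∘_; id; flip)
open import Level using (0ℓ)
open import Relation.Binary.Bundles using (Setoid)
open import Relation.Binary.PropositionalEquality as ≡ using (_≡_; _≢_)
open import Relation.Nullary using (¬_; Dec; does; yes; no; ¬?)
import Relation.Binary.Reasoning.Setoid as SetoidReasoning

------------------------------------------------------------------------

record ℚ-Algebra : Set₁ where
  field
    commutativeRing : CommutativeRing 0ℓ 0ℓ

  open CommutativeRing commutativeRing public

  field
    ι                 : ℚ → Carrier
    ι-isHomomorphism  : IsRingHomomorphism ℚ.+-*-rawRing rawRing ι

  module ι = IsRingHomomorphism ι-isHomomorphism

record IsAlgebraHomomorphism (A B : ℚ-Algebra)
         (f : ℚ-Algebra.Carrier A → ℚ-Algebra.Carrier B) : Set where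
  private
    module A = ℚ-Algebra A
    module B = ℚ-Algebra B
  field
    isRingHomomorphism : IsRingHomomorphism A.rawRing B.rawRing f
    preserves-ι        : ∀ c → f (A.ι c) B.≈ B.ι c

-- The operators ∂/∂gᵢ of an algebra generated by the gᵢ: the ℚ-linear
-- derivations dual to the generators.

record IsPartialDerivatives (A : ℚ-Algebra) {I : Set}
         (g : I → ℚ-Algebra.Carrier A)
         (∂ : I → ℚ-Algebra.Carrier A → ℚ-Algebra.Carrier A) : Set where
  open ℚ-Algebra A
  field
    ∂-cong    : ∀ i {f f′} → f ≈ f′ → ∂ i f ≈ ∂ i f′
    ∂-+       : ∀ i f f′ → ∂ i (f + f′) ≈ ∂ i f + ∂ i f′
    ∂-ι*      : ∀ i c f → ∂ i (ι c * f) ≈ ι c * ∂ i f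
    ∂-*       : ∀ i f f′ → ∂ i (f * f′) ≈ ∂ i f * f′ + f * ∂ i f′
    ∂-same    : ∀ i → ∂ i (g i) ≈ 1#
    ∂-other   : ∀ {i j} → i ≢ j → ∂ i (g j) ≈ 0#

ℚ-algebra : ℚ-Algebra
ℚ-algebra = record
  { commutativeRing  = ℚ.+-*-commutativeRing
  ; ι                = id
  ; ι-isHomomorphism = record
    { isSemiringHomomorphism = record
      { isNearSemiringHomomorphism = record
        { +-isMonoidHomomorphism = record
          { isMagmaHomomorphism = record
            { isRelHomomorphism = record { cong = id }
            ; homo = λ _ _ → ≡.refl }
          ; ε-homo = ≡.refl }
        ; *-homo = λ _ _ → ≡.refl }
      ; 1#-homo = ≡.refl }
    ; -‿homo = λ _ → ≡.refl }
  }

------------------------------------------------------------------------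
-- Power series A[[z₁,z₂,…]]
--
-- The list a₁ ∷ … ∷ aₙ ∷ [] stands for the monomial z₁^a₁ ⋯ zₙ^aₙ, so
-- trailing zeros must not affect a coefficient.

module PowerSeries (A : ℚ-Algebra) where

  open ℚ-Algebra A
  open CommSemigroupProperties +-commutativeSemigroup using (interchange)
  open RawMonoidOps +-rawMonoid using () renaming (_×_ to _·_)
  open SetoidReasoning setoid
  private module +-Mult = MultProperties +-monoid

  Coefficients : Set
  Coefficients = List ℕ → Carrier

  record Series : Set where
    constructor series
    field
      coeff    : Coefficients
      trailing : ∀ α → coeff (α ∷ʳ 0) ≈ coeff α

  open Series public

  infix 4 _≋_

  _≋_ : Series → Series → Set
  f ≋ g = ∀ α → coeff f α ≈ coeff g α

  -- ∑ₐ φ = the sum of φ i j over all i + j = a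

  ∑ : ℕ → (ℕ → ℕ → Carrier) → Carrier
  ∑ zero    φ = φ 0 0
  ∑ (suc a) φ = φ 0 (suc a) + ∑ a (λ i j → φ (suc i) j)

  infixl 7 _⊛_

  _⊛_ : Coefficients → Coefficients → Coefficients
  (f ⊛ g) []      = f [] * g []
  (f ⊛ g) (a ∷ α) = ∑ a (λ i j → ((f ∘ (i ∷_)) ⊛ (g ∘ (j ∷_))) α)

  constant : Carrier → Coefficients
  constant c []          = c
  constant c (zero ∷ α)  = constant c α
  constant c (suc _ ∷ _) = 0#

  ∑-cong : ∀ a {φ ψ} → (∀ i j → φ i j ≈ ψ i j) → ∑ a φ ≈ ∑ a ψ
  ∑-cong zero    e = e 0 0
  ∑-cong (suc a) e = +-cong (e 0 (suc a)) (∑-cong a (λ i j → e (suc i) j))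

  ∑-+ : ∀ a φ ψ → ∑ a (λ i j → φ i j + ψ i j) ≈ ∑ a φ + ∑ a ψ
  ∑-+ zero    φ ψ = refl
  ∑-+ (suc a) φ ψ =
    trans (+-congˡ (∑-+ a _ _)) (interchange _ _ _ _)

  ∑-0 : ∀ a φ → (∀ i j → i ℕ.+ j ≡ a → φ i j ≈ 0#) → ∑ a φ ≈ 0#
  ∑-0 zero    φ e = e 0 0 ≡.refl
  ∑-0 (suc a) φ e = trans
    (+-cong (e _ _ ≡.refl) (∑-0 a _ (λ i j eq → e (suc i) j (≡.cong suc eq)))) (+-identityˡ 0#)

  ∑-first : ∀ a φ → (∀ i j → φ (suc i) j ≈ 0#) → ∑ a φ ≈ φ 0 a
  ∑-first zero    φ e = refl
  ∑-first (suc a) φ e = trans (+-congˡ (∑-0 a _ (λ i j _ → e i j))) (+-identityʳ _)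

  ∑-last : ∀ a φ → ∑ (suc a) φ ≈ ∑ a (λ i j → φ i (suc j)) + φ (suc a) 0
  ∑-last zero    φ = refl
  ∑-last (suc a) φ = trans (+-congˡ (∑-last a (λ i j → φ (suc i) j))) (sym (+-assoc _ _ _))

  ∑-flip : ∀ a φ → ∑ a φ ≈ ∑ a (flip φ)
  ∑-flip zero    φ = refl
  ∑-flip (suc a) φ = begin
    φ 0 (suc a) + ∑ a (λ i j → φ (suc i) j)  ≈⟨ +-comm _ _ ⟩
    ∑ a (λ i j → φ (suc i) j) + φ 0 (suc a)  ≈⟨ +-congʳ (∑-flip a _) ⟩
    ∑ a (λ i j → φ (suc j) i) + φ 0 (suc a)  ≈⟨ ∑-last a (flip φ) ⟨
    ∑ (suc a) (flip φ)                       ∎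

  ∑-assoc : ∀ a (ψ : ℕ → ℕ → ℕ → Carrier) →
            ∑ a (λ i j → ∑ i (λ k l → ψ k l j)) ≈ ∑ a (λ k m → ∑ m (λ l j → ψ k l j))
  ∑-assoc zero    ψ = refl
  ∑-assoc (suc a) ψ = begin
    ψ 0 0 (suc a) + ∑ a (λ i j → ψ 0 (suc i) j + ∑ i (λ k l → ψ (suc k) l j))
      ≈⟨ +-congˡ (∑-+ a _ _) ⟩
    ψ 0 0 (suc a) + (∑ a (λ i j → ψ 0 (suc i) j) + ∑ a (λ i j → ∑ i (λ k l → ψ (suc k) l j)))
      ≈⟨ +-assoc _ _ _ ⟨
    ∑ (suc a) (ψ 0) + ∑ a (λ i j → ∑ i (λ k l → ψ (suc k) l j))
      ≈⟨ +-congˡ (∑-assoc a (λ k → ψ (suc k))) ⟩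
    ∑ (suc a) (ψ 0) + ∑ a (λ k m → ∑ m (λ l j → ψ (suc k) l j)) ∎

  ∑-swap : ∀ a b (φ : ℕ → ℕ → ℕ → ℕ → Carrier) →
           ∑ a (λ i j → ∑ b (λ k l → φ i j k l)) ≈ ∑ b (λ k l → ∑ a (λ i j → φ i j k l))
  ∑-swap zero    b φ = refl
  ∑-swap (suc a) b φ = trans (+-congˡ (∑-swap a b _)) (sym (∑-+ b _ _))

  ⊛-cong : ∀ {f f′ g g′} → (∀ β → f β ≈ f′ β) → (∀ β → g β ≈ g′ β) →
           ∀ α → (f ⊛ g) α ≈ (f′ ⊛ g′) α
  ⊛-cong ef eg []      = *-cong (ef []) (eg [])
  ⊛-cong ef eg (a ∷ α) = ∑-cong a λ i j → ⊛-cong (λ β → ef (i ∷ β)) (λ β → eg (j ∷ β)) α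

  ⊛-comm : ∀ f g α → (f ⊛ g) α ≈ (g ⊛ f) α
  ⊛-comm f g []      = *-comm _ _
  ⊛-comm f g (a ∷ α) =
    trans (∑-cong a (λ i j → ⊛-comm _ _ α)) (∑-flip a _)

  ⊛-distribʳ : ∀ h f g α → ((λ β → f β + g β) ⊛ h) α ≈ (f ⊛ h) α + (g ⊛ h) α
  ⊛-distribʳ h f g []      = distribʳ _ _ _
  ⊛-distribʳ h f g (a ∷ α) = trans (∑-cong a (λ i j → ⊛-distribʳ _ _ _ α)) (∑-+ a _ _)

  ⊛-distribʳ-∑ : ∀ h a (φ : ℕ → ℕ → Coefficients) α →
                 ((λ β → ∑ a (λ i j → φ i j β)) ⊛ h) α ≈ ∑ a (λ i j → (φ i j ⊛ h) α)
  ⊛-distribʳ-∑ h zero    φ α = refl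
  ⊛-distribʳ-∑ h (suc a) φ α =
    trans (⊛-distribʳ h _ _ α) (+-congˡ (⊛-distribʳ-∑ h a (λ i j → φ (suc i) j) α))

  ⊛-distribˡ-∑ : ∀ h a (φ : ℕ → ℕ → Coefficients) α →
                 (h ⊛ (λ β → ∑ a (λ i j → φ i j β))) α ≈ ∑ a (λ i j → (h ⊛ φ i j) α)
  ⊛-distribˡ-∑ h a φ α =
    trans (⊛-comm h _ α) (trans (⊛-distribʳ-∑ h a φ α) (∑-cong a (λ i j → ⊛-comm _ h α)))

  ⊛-assoc : ∀ f g h α → ((f ⊛ g) ⊛ h) α ≈ (f ⊛ (g ⊛ h)) α
  ⊛-assoc f g h []      = *-assoc _ _ _
  ⊛-assoc f g h (a ∷ α) = begin
    ∑ a (λ i j → ((λ β → ∑ i (λ k l → (f at k ⊛ g at l) β)) ⊛ h at j) α)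
      ≈⟨ ∑-cong a (λ i j → ⊛-distribʳ-∑ (h at j) i _ α) ⟩
    ∑ a (λ i j → ∑ i (λ k l → ((f at k ⊛ g at l) ⊛ h at j) α))
      ≈⟨ ∑-cong a (λ i j → ∑-cong i (λ k l → ⊛-assoc (f at k) (g at l) (h at j) α)) ⟩
    ∑ a (λ i j → ∑ i (λ k l → (f at k ⊛ (g at l ⊛ h at j)) α))
      ≈⟨ ∑-assoc a (λ k l j → (f at k ⊛ (g at l ⊛ h at j)) α) ⟩
    ∑ a (λ k m → ∑ m (λ l j → (f at k ⊛ (g at l ⊛ h at j)) α))
      ≈⟨ ∑-cong a (λ k m → ⊛-distribˡ-∑ (f at k) m _ α) ⟨
    ∑ a (λ k m → (f at k ⊛ (λ β → ∑ m (λ l j → (g at l ⊛ h at j) β))) α) ∎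
    where
    _at_ : Coefficients → ℕ → Coefficients
    (u at i) β = u (i ∷ β)
    infix 8 _at_

  ⊛-zeroˡ : ∀ f g → (∀ β → f β ≈ 0#) → ∀ α → (f ⊛ g) α ≈ 0#
  ⊛-zeroˡ f g e []      = trans (*-congʳ (e [])) (zeroˡ _)
  ⊛-zeroˡ f g e (a ∷ α) = ∑-0 a _ (λ i j _ → ⊛-zeroˡ _ _ (λ β → e (i ∷ β)) α)

  constant-⊛ : ∀ c g α → (constant c ⊛ g) α ≈ c * g α
  constant-⊛ c g []      = refl
  constant-⊛ c g (a ∷ α) = trans
    (∑-first a _ (λ i j → ⊛-zeroˡ _ (g ∘ (j ∷_)) (λ β → refl) α))
    (constant-⊛ c (g ∘ (a ∷_)) α)

  ⊛-symmetric : ∀ f g → (∀ {α β} → α ↭ β → f α ≈ f β) → (∀ {α β} → α ↭ β → g α ≈ g β) →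
                ∀ {α β} → α ↭ β → (f ⊛ g) α ≈ (f ⊛ g) β
  ⊛-symmetric f g sf sg Perm.refl        = refl
  ⊛-symmetric f g sf sg (Perm.prep a p)  =
    ∑-cong a λ i j → ⊛-symmetric _ _ (sf ∘ Perm.prep i) (sg ∘ Perm.prep j) p
  ⊛-symmetric f g sf sg {_ ∷ _ ∷ α} (Perm.swap a b p) = trans (∑-swap a b _)
    (∑-cong b λ k l → ∑-cong a λ i j → trans
      (⊛-cong (λ β → sf (Perm.swap i k Perm.refl)) (λ β → sg (Perm.swap j l Perm.refl)) α)
      (⊛-symmetric _ _ (sf ∘ Perm.prep k ∘ Perm.prep i) (sg ∘ Perm.prep l ∘ Perm.prep j) p))
  ⊛-symmetric f g sf sg (Perm.trans p q) =
    trans (⊛-symmetric f g sf sg p) (⊛-symmetric f g sf sg q)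

  ⊛-bounded : ∀ d e m n f g →
              (∀ α → d < m ℕ.+ sum α → f α ≈ 0#) → (∀ α → e < n ℕ.+ sum α → g α ≈ 0#) →
              ∀ α → d ℕ.+ e < (m ℕ.+ n) ℕ.+ sum α → (f ⊛ g) α ≈ 0#
  ⊛-bounded d e m n f g bf bg []      lt with d ℕ.<? m ℕ.+ 0
  ... | yes d<m = trans (*-congʳ (bf [] d<m)) (zeroˡ _)
  ... | no  d≮m = trans (*-congˡ (bg [] e<n)) (zeroʳ _)
    where
    e<n : e < n ℕ.+ 0
    e<n = ℕ.+-cancelˡ-< d e (n ℕ.+ 0) (ℕ.<-≤-trans
            (≡.subst (d ℕ.+ e <_) (regroup m n) lt) (ℕ.+-monoˡ-≤ (n ℕ.+ 0) (ℕ.≮⇒≥ d≮m)))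
      where
      regroup : ∀ m n → m ℕ.+ n ℕ.+ 0 ≡ m ℕ.+ 0 ℕ.+ (n ℕ.+ 0)
      regroup = solve-∀
  ⊛-bounded d e m n f g bf bg (a ∷ α) lt = ∑-0 a _ λ i j i+j≡a →
    ⊛-bounded d e (m ℕ.+ i) (n ℕ.+ j) _ _
      (λ β → bf (i ∷ β) ∘ ≡.subst (d <_) (ℕ.+-assoc m i (sum β)))
      (λ β → bg (j ∷ β) ∘ ≡.subst (e <_) (ℕ.+-assoc n j (sum β)))
      α (≡.subst (d ℕ.+ e <_)
          (≡.trans (≡.cong (λ a → m ℕ.+ n ℕ.+ (a ℕ.+ sum α)) (≡.sym i+j≡a)) (regroup m n i j (sum α))) lt)
    where
    regroup : ∀ m n i j s → m ℕ.+ n ℕ.+ (i ℕ.+ j ℕ.+ s) ≡ m ℕ.+ i ℕ.+ (n ℕ.+ j) ℕ.+ s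
    regroup = solve-∀

  constant-trailing : ∀ c α → constant c (α ∷ʳ 0) ≈ constant c α
  constant-trailing c []          = refl
  constant-trailing c (zero ∷ α)  = constant-trailing c α
  constant-trailing c (suc _ ∷ α) = refl

  ⊛-trailing : ∀ f g → (∀ α → f (α ∷ʳ 0) ≈ f α) → (∀ α → g (α ∷ʳ 0) ≈ g α) →
               ∀ α → (f ⊛ g) (α ∷ʳ 0) ≈ (f ⊛ g) α
  ⊛-trailing f g tf tg []      = *-cong (tf []) (tg [])
  ⊛-trailing f g tf tg (a ∷ α) =
    ∑-cong a λ i j → ⊛-trailing _ _ (λ β → tf (i ∷ β)) (λ β → tg (j ∷ β)) α

  constant-symmetric : ∀ c {α β} → α ↭ β → constant c α ≈ constant c β
  constant-symmetric c Perm.refl                      = refl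
  constant-symmetric c (Perm.prep zero p)             = constant-symmetric c p
  constant-symmetric c (Perm.prep (suc _) p)          = refl
  constant-symmetric c (Perm.swap zero zero p)        = constant-symmetric c p
  constant-symmetric c (Perm.swap zero (suc _) p)     = refl
  constant-symmetric c (Perm.swap (suc _) zero p)     = refl
  constant-symmetric c (Perm.swap (suc _) (suc _) p)  = refl
  constant-symmetric c (Perm.trans p q)               =
    trans (constant-symmetric c p) (constant-symmetric c q)

  constant-bounded : ∀ c α → 0 < sum α → constant c α ≈ 0#
  constant-bounded c (zero ∷ α)  0<s = constant-bounded c α 0<s
  constant-bounded c (suc _ ∷ α) 0<s = refl

  constant-cong : ∀ {c d} → c ≈ d → ∀ α → constant c α ≈ constant d α
  constant-cong e []          = e
  constant-cong e (zero ∷ α)  = constant-cong e α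
  constant-cong e (suc _ ∷ α) = refl

  constant-+ : ∀ c d α → constant (c + d) α ≈ constant c α + constant d α
  constant-+ c d []          = refl
  constant-+ c d (zero ∷ α)  = constant-+ c d α
  constant-+ c d (suc _ ∷ α) = sym (+-identityˡ 0#)

  constant-0 : ∀ α → constant 0# α ≈ 0#
  constant-0 []          = refl
  constant-0 (zero ∷ α)  = constant-0 α
  constant-0 (suc _ ∷ α) = refl

  constant-neg : ∀ c α → constant (- c) α ≈ - constant c α
  constant-neg c []          = refl
  constant-neg c (zero ∷ α)  = constant-neg c α
  constant-neg c (suc _ ∷ α) = sym (RingProperties.-0#≈0# ring)

  constant-* : ∀ c d α → constant (c * d) α ≈ c * constant d α
  constant-* c d []          = refl
  constant-* c d (zero ∷ α)  = constant-* c d α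
  constant-* c d (suc _ ∷ α) = sym (zeroʳ c)

  const : Carrier → Series
  const c = series (constant c) (constant-trailing c)

  infixl 6 _⊕_
  infixl 7 _⊗_

  _⊕_ : Series → Series → Series
  f ⊕ g = series (λ α → coeff f α + coeff g α) (λ α → +-cong (trailing f α) (trailing g α))

  ⊖_ : Series → Series
  ⊖ f = series (λ α → - coeff f α) (λ α → -‿cong (trailing f α))

  _⊗_ : Series → Series → Series
  f ⊗ g = series (coeff f ⊛ coeff g) (⊛-trailing _ _ (trailing f) (trailing g))

  algebra : ℚ-Algebra
  algebra = record
    { commutativeRing = record
      { Carrier = Series ; _≈_ = _≋_ ; _+_ = _⊕_ ; _*_ = _⊗_ ; -_ = ⊖_
      ; 0# = series (λ _ → 0#) (λ _ → refl)
      ; 1# = const 1#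
      ; isCommutativeRing = record
        { isRing = record
          { +-isAbelianGroup = record
            { isGroup = record
              { isMonoid = record
                { isSemigroup = record
                  { isMagma = record
                    { isEquivalence = record
                      { refl  = λ α → refl
                      ; sym   = λ e α → sym (e α)
                      ; trans = λ e e′ α → trans (e α) (e′ α) }
                    ; ∙-cong = λ e e′ α → +-cong (e α) (e′ α) }
                  ; assoc = λ f g h α → +-assoc _ _ _ }
                ; identity = (λ f α → +-identityˡ _) , (λ f α → +-identityʳ _) }
              ; inverse = (λ f α → -‿inverseˡ _) , (λ f α → -‿inverseʳ _)
              ; ⁻¹-cong = λ e α → -‿cong (e α) }
            ; comm = λ f g α → +-comm _ _ }
          ; *-cong = λ e e′ → ⊛-cong e e′
          ; *-assoc = λ f g h → ⊛-assoc (coeff f) (coeff g) (coeff h)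
          ; *-identity = (λ f α → identityˡ f α)
                       , (λ f α → trans (⊛-comm (coeff f) _ α) (identityˡ f α))
          ; distrib = (λ f g h α → trans (⊛-comm (coeff f) _ α)
                         (trans (⊛-distribʳ _ _ _ α) (+-cong (⊛-comm _ (coeff f) α) (⊛-comm _ (coeff f) α))))
                    , (λ f g h → ⊛-distribʳ (coeff f) (coeff g) (coeff h)) }
        ; *-comm = λ f g → ⊛-comm (coeff f) (coeff g) } }
    ; ι = const ∘ ι
    ; ι-isHomomorphism = record
      { isSemiringHomomorphism = record
        { isNearSemiringHomomorphism = record
          { +-isMonoidHomomorphism = record
            { isMagmaHomomorphism = record
              { isRelHomomorphism = record { cong = λ { ≡.refl α → refl } }
              ; homo = λ c d α → trans (constant-cong (ι.+-homo c d) α) (constant-+ _ _ α) }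
            ; ε-homo = λ α → trans (constant-cong ι.0#-homo α) (constant-0 α) }
          ; *-homo = λ c d α → trans (constant-cong (ι.*-homo c d) α)
                       (trans (constant-* _ _ α) (sym (constant-⊛ _ _ α))) }
        ; 1#-homo = constant-cong ι.1#-homo }
      ; -‿homo = λ c α → trans (constant-cong (ι.-‿homo c) α) (constant-neg _ α) }
    }
    where
    identityˡ : ∀ f α → (constant 1# ⊛ coeff f) α ≈ coeff f α
    identityˡ f α = trans (constant-⊛ 1# _ α) (*-identityˡ _)

  -- var n is the variable zₙ₊₁

  var : ℕ → Series
  var n = series (v n) (v-trailing n)
    where
    v : ℕ → Coefficients
    v _       []                = 0#
    v zero    (1 ∷ α)           = constant 1# α
    v zero    (_ ∷ α)           = 0#
    v (suc n) (zero ∷ α)        = v n α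
    v (suc n) (suc _ ∷ α)       = 0#

    v-trailing : ∀ n α → v n (α ∷ʳ 0) ≈ v n α
    v-trailing zero    []                = refl
    v-trailing (suc n) []                = v-[] n
      where
      v-[] : ∀ n → v n [] ≈ 0#
      v-[] zero    = refl
      v-[] (suc n) = refl
    v-trailing zero    (zero ∷ α)        = refl
    v-trailing zero    (1 ∷ α)           = constant-trailing 1# α
    v-trailing zero    (suc (suc _) ∷ α) = refl
    v-trailing (suc n) (zero ∷ α)        = v-trailing n α
    v-trailing (suc n) (suc _ ∷ α)       = refl

  exponent : ℕ → List ℕ → ℕ
  exponent _       []      = 0
  exponent zero    (a ∷ α) = a
  exponent (suc n) (a ∷ α) = exponent n α

  -- the exponents of zₙ₊₁ · z^α

  raise : ℕ → List ℕ → List ℕ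
  raise zero    []      = 1 ∷ []
  raise zero    (a ∷ α) = suc a ∷ α
  raise (suc n) []      = 0 ∷ raise n []
  raise (suc n) (a ∷ α) = a ∷ raise n α

  -- ∂ n is ∂/∂zₙ₊₁; by ∂(z^β)/∂z = b z^(β-1), its coefficient at z^α is the
  -- one of f at zₙ₊₁ · z^α times the exponent of zₙ₊₁ there.

  ∂ : ℕ → Series → Series
  ∂ n f = series
    (λ α → suc (exponent n α) · coeff f (raise n α))
    (λ α → trans (reflexive (≡.cong (λ e → suc e · coeff f (raise n (α ∷ʳ 0))) (exponent-trailing n α)))
                 (+-Mult.×-congʳ (suc (exponent n α)) (raise-trailing n α (coeff f) (trailing f))))
    where
    exponent-trailing : ∀ n α → exponent n (α ∷ʳ 0) ≡ exponent n α
    exponent-trailing zero    []      = ≡.refl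
    exponent-trailing (suc n) []      = exponent-[] n
      where
      exponent-[] : ∀ n → exponent n [] ≡ 0
      exponent-[] zero    = ≡.refl
      exponent-[] (suc n) = ≡.refl
    exponent-trailing zero    (a ∷ α) = ≡.refl
    exponent-trailing (suc n) (a ∷ α) = exponent-trailing n α

    raise-trailing : ∀ n α (u : Coefficients) → (∀ β → u (β ∷ʳ 0) ≈ u β) →
                     u (raise n (α ∷ʳ 0)) ≈ u (raise n α)
    raise-trailing zero    []      u t = refl
    raise-trailing zero    (a ∷ α) u t = t (suc a ∷ α)
    raise-trailing (suc n) []      u t = refl
    raise-trailing (suc n) (a ∷ α) u t = raise-trailing n α (u ∘ (a ∷_)) (λ β → t (a ∷ β))

  ∂-cong : ∀ n {f g} → f ≋ g → ∂ n f ≋ ∂ n g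
  ∂-cong n e α = +-Mult.×-congʳ (suc (exponent n α)) (e (raise n α))

------------------------------------------------------------------------
-- Symmetric functions over ℚ in x₁, x₂, …: power series of bounded degree
-- that are invariant under permutations of the variables

module SymmetricFunctions where

  open PowerSeries ℚ-algebra
  private module PS = ℚ-Algebra algebra

  record SymmetricFunction : Set where
    constructor symmetricFunction
    field
      toSeries  : Series
      symmetric : ∀ {α β} → α ↭ β → coeff toSeries α ≡ coeff toSeries β
      bounded   : ∃[ d ] ∀ α → d < sum α → coeff toSeries α ≡ 0ℚ

  open SymmetricFunction public

  private

    infixl 6 _⊞_
    infixl 7 _⊠_

    _⊞_ : SymmetricFunction → SymmetricFunction → SymmetricFunction
    symmetricFunction f sf (d , bf) ⊞ symmetricFunction g sg (e , bg) = symmetricFunction (f ⊕ g)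
      (λ p → ≡.cong₂ ℚ._+_ (sf p) (sg p))
      (d ℕ.⊔ e , λ α lt → ≡.cong₂ ℚ._+_ (bf α (ℕ.m⊔n<o⇒m<o d e lt)) (bg α (ℕ.m⊔n<o⇒n<o d e lt)))

    _⊠_ : SymmetricFunction → SymmetricFunction → SymmetricFunction
    symmetricFunction f sf (d , bf) ⊠ symmetricFunction g sg (e , bg) = symmetricFunction (f ⊗ g)
      (⊛-symmetric (coeff f) (coeff g) sf sg)
      (d ℕ.+ e , ⊛-bounded d e 0 0 (coeff f) (coeff g) bf bg)

    ⊟_ : SymmetricFunction → SymmetricFunction
    ⊟ symmetricFunction f sf (d , bf) = symmetricFunction (⊖ f)
      (λ p → ≡.cong ℚ.-_ (sf p)) (d , λ α lt → ≡.cong ℚ.-_ (bf α lt))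

  scalar : ℚ → SymmetricFunction
  scalar c = symmetricFunction (const c) (constant-symmetric c) (0 , constant-bounded c)

  zeroFunction : SymmetricFunction
  zeroFunction = symmetricFunction PS.0# (λ _ → ≡.refl) (0 , λ _ _ → ≡.refl)

  Λ : ℚ-Algebra
  Λ = record
    { commutativeRing = record
      { Carrier = SymmetricFunction ; _≈_ = λ f g → toSeries f ≋ toSeries g
      ; _+_ = _⊞_ ; _*_ = _⊠_ ; -_ = ⊟_ ; 0# = zeroFunction ; 1# = scalar 1ℚ
      ; isCommutativeRing = record
        { isRing = record
          { +-isAbelianGroup = record
            { isGroup = record
              { isMonoid = record
                { isSemigroup = record
                  { isMagma = record
                    { isEquivalence = record
                      { refl  = λ α → ≡.refl
                      ; sym   = λ e α → ≡.sym (e α)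
                      ; trans = λ e e′ α → ≡.trans (e α) (e′ α) }
                    ; ∙-cong = λ e e′ α → ≡.cong₂ ℚ._+_ (e α) (e′ α) }
                  ; assoc = λ f g h → PS.+-assoc (toSeries f) (toSeries g) (toSeries h) }
                ; identity = (λ f → PS.+-identityˡ (toSeries f)) , (λ f → PS.+-identityʳ (toSeries f)) }
              ; inverse = (λ f → PS.-‿inverseˡ (toSeries f)) , (λ f → PS.-‿inverseʳ (toSeries f))
              ; ⁻¹-cong = λ e α → ≡.cong ℚ.-_ (e α) }
            ; comm = λ f g → PS.+-comm (toSeries f) (toSeries g) }
          ; *-cong = λ e e′ → ⊛-cong e e′
          ; *-assoc = λ f g h → PS.*-assoc (toSeries f) (toSeries g) (toSeries h)
          ; *-identity = (λ f → PS.*-identityˡ (toSeries f)) , (λ f → PS.*-identityʳ (toSeries f))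
          ; distrib = (λ f g h → PS.distribˡ (toSeries f) (toSeries g) (toSeries h))
                    , (λ f g h → PS.distribʳ (toSeries f) (toSeries g) (toSeries h)) }
        ; *-comm = λ f g → PS.*-comm (toSeries f) (toSeries g) } }
    ; ι = scalar
    ; ι-isHomomorphism = record
      { isSemiringHomomorphism = record
        { isNearSemiringHomomorphism = record
          { +-isMonoidHomomorphism = record
            { isMagmaHomomorphism = record
              { isRelHomomorphism = record { cong = PS.ι.⟦⟧-cong }
              ; homo = PS.ι.+-homo }
            ; ε-homo = PS.ι.0#-homo }
          ; *-homo = PS.ι.*-homo }
        ; 1#-homo = PS.ι.1#-homo }
      ; -‿homo = PS.ι.-‿homo }
    }

  private

    indicator : ∀ {P : Set} → Dec P → ℚ
    indicator P? = if does P? then 1ℚ else 0ℚ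

    indicator-⇔ : ∀ {P Q : Set} (P? : Dec P) (Q? : Dec Q) → (P → Q) → (Q → P) →
                  indicator P? ≡ indicator Q?
    indicator-⇔ (yes p) (yes q) to from = ≡.refl
    indicator-⇔ (no ¬p) (no ¬q) to from = ≡.refl
    indicator-⇔ (yes p) (no ¬q) to from = ⊥-elim (¬q (to p))
    indicator-⇔ (no ¬p) (yes q) to from = ⊥-elim (¬p (from q))

    indicator-no : ∀ {P : Set} (P? : Dec P) → ¬ P → indicator P? ≡ 0ℚ
    indicator-no (yes p) ¬p = ⊥-elim (¬p p)
    indicator-no (no _)  ¬p = ≡.refl

    nonzero : List ℕ → List ℕ
    nonzero = filter (λ a → ¬? (a ℕ.≟ 0))

    sum-nonzero : ∀ α → sum (nonzero α) ≡ sum α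
    sum-nonzero []          = ≡.refl
    sum-nonzero (zero ∷ α)  = sum-nonzero α
    sum-nonzero (suc a ∷ α) = ≡.cong (suc a ℕ.+_) (sum-nonzero α)

    nonzero-trailing : ∀ α → nonzero (α ∷ʳ 0) ≡ nonzero α
    nonzero-trailing []          = ≡.refl
    nonzero-trailing (zero ∷ α)  = nonzero-trailing α
    nonzero-trailing (suc a ∷ α) = ≡.cong (suc a ∷_) (nonzero-trailing α)

    sum-trailing : ∀ α → sum (α ∷ʳ 0) ≡ sum α
    sum-trailing α = ≡.trans (sum-++ α (0 ∷ [])) (ℕ.+-identityʳ (sum α))

  -- The power sum x₁^k + x₂^k + ⋯, for k ≥ 1: the monomials of coefficient 1
  -- are those having k as their only nonzero exponent.

  powerSum : ℕ → SymmetricFunction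
  powerSum k = symmetricFunction
    (series (λ α → indicator (P? α))
            (λ α → ≡.cong (λ ν → indicator (List.≡-dec ℕ._≟_ ν (k ∷ []))) (nonzero-trailing α)))
    (λ {α} {β} p → indicator-⇔ (P? α) (P? β) (transport p) (transport (Perm.↭-sym p)))
    (k , λ α k<s → indicator-no (P? α) λ eq →
      ℕ.<-irrefl (≡.trans (≡.sym (ℕ.+-identityʳ k)) (≡.trans (≡.cong sum (≡.sym eq)) (sum-nonzero α))) k<s)
    where
    P? : ∀ α → Dec (nonzero α ≡ k ∷ [])
    P? α = List.≡-dec ℕ._≟_ (nonzero α) (k ∷ [])

    transport : ∀ {α β} → α ↭ β → nonzero α ≡ k ∷ [] → nonzero β ≡ k ∷ []
    transport p eq = Perm.↭-singleton-inv
      (Perm.trans (Perm.↭-sym (filter-↭ (λ a → ¬? (a ℕ.≟ 0)) p)) (Perm.↭-reflexive eq))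

  -- The complete homogeneous symmetric function: the sum of all monomials of
  -- degree k.

  complete : ℤ → SymmetricFunction
  complete (+ k) = symmetricFunction
    (series (λ α → indicator (sum α ℕ.≟ k))
            (λ α → ≡.cong (λ s → indicator (s ℕ.≟ k)) (sum-trailing α)))
    (λ p → ≡.cong (λ s → indicator (s ℕ.≟ k)) (sum-↭ p))
    (k , λ α k<s → indicator-no (sum α ℕ.≟ k) (ℕ.>⇒≢ k<s))
  complete -[1+ _ ] = zeroFunction

------------------------------------------------------------------------
-- The tensor product A ⊗ B over ℚ: finite formal sums of pairs (a , b),
-- read as ∑ a ⊗ b, modulo bilinearity

module TensorProduct (A B : ℚ-Algebra) where

  private
    module A = ℚ-Algebra A
    module B = ℚ-Algebra B

  Pure : Set
  Pure = A.Carrier × B.Carrier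

  Tensor : Set
  Tensor = List Pure

  infix 4 _∼_

  data _∼_ : Tensor → Tensor → Set where
    ∼-refl    : ∀ {s} → s ∼ s
    ∼-sym     : ∀ {s t} → s ∼ t → t ∼ s
    ∼-trans   : ∀ {s t u} → s ∼ t → t ∼ u → s ∼ u
    ++-cong   : ∀ {s s′ t t′} → s ∼ s′ → t ∼ t′ → s ++ t ∼ s′ ++ t′
    ++-comm   : ∀ s t → s ++ t ∼ t ++ s
    ⊗-cong    : ∀ {a a′ b b′} → a A.≈ a′ → b B.≈ b′ → (a , b) ∷ [] ∼ (a′ , b′) ∷ []
    ⊗-zero    : ∀ b → (A.0# , b) ∷ [] ∼ []
    ⊗-distribʳ : ∀ a a′ b → (a A.+ a′ , b) ∷ [] ∼ (a , b) ∷ (a′ , b) ∷ []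
    ⊗-distribˡ : ∀ a b b′ → (a , b B.+ b′) ∷ [] ∼ (a , b) ∷ (a , b′) ∷ []
    ⊗-scalar  : ∀ c a b → (A.ι c A.* a , b) ∷ [] ∼ (a , B.ι c B.* b) ∷ []

  infixr 7 _·_
  infixl 7 _*_

  _·_ : Pure → Tensor → Tensor
  (a , b) · t = map (λ (a′ , b′) → a A.* a′ , b B.* b′) t

  _*_ : Tensor → Tensor → Tensor
  []      * t = []
  (x ∷ s) * t = x · t ++ s * t

  -1⊗1 : Pure
  -1⊗1 = A.- A.1# , B.1#

  private
    setoid : Setoid 0ℓ 0ℓ
    setoid = record
      { Carrier = Tensor ; _≈_ = _∼_
      ; isEquivalence = record { refl = ∼-refl ; sym = ∼-sym ; trans = ∼-trans } }

    open SetoidReasoning setoid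

    ≡⇒∼ : ∀ {s t} → s ≡ t → s ∼ t
    ≡⇒∼ ≡.refl = ∼-refl

    pointwise : ∀ (f g : Pure → Pure) →
                (∀ x → proj₁ (f x) A.≈ proj₁ (g x)) → (∀ x → proj₂ (f x) B.≈ proj₂ (g x)) →
                ∀ t → map f t ∼ map g t
    pointwise f g e₁ e₂ []      = ∼-refl
    pointwise f g e₁ e₂ (x ∷ t) =
      ++-cong {s = f x ∷ []} {s′ = g x ∷ []} (⊗-cong (e₁ x) (e₂ x)) (pointwise f g e₁ e₂ t)

    middle : ∀ s t u v → (s ++ t) ++ (u ++ v) ∼ (s ++ u) ++ (t ++ v)
    middle s t u v = begin
      (s ++ t) ++ (u ++ v)   ≡⟨ ++-assoc s t (u ++ v) ⟩
      s ++ (t ++ (u ++ v))   ≡⟨ ≡.cong (s ++_) (++-assoc t u v) ⟨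
      s ++ ((t ++ u) ++ v)   ≈⟨ ++-cong {s = s} ∼-refl (++-cong (++-comm t u) ∼-refl) ⟩
      s ++ ((u ++ t) ++ v)   ≡⟨ ≡.cong (s ++_) (++-assoc u t v) ⟩
      s ++ (u ++ (t ++ v))   ≡⟨ ++-assoc s u (t ++ v) ⟨
      (s ++ u) ++ (t ++ v)   ∎

    ·-cong : ∀ x {s t} → s ∼ t → x · s ∼ x · t
    ·-cong x ∼-refl        = ∼-refl
    ·-cong x (∼-sym e)     = ∼-sym (·-cong x e)
    ·-cong x (∼-trans e e′) = ∼-trans (·-cong x e) (·-cong x e′)
    ·-cong x (++-cong {s} {s′} {t} {t′} e e′) = begin
      x · (s ++ t)      ≡⟨ map-++ _ s t ⟩
      x · s ++ x · t    ≈⟨ ++-cong (·-cong x e) (·-cong x e′) ⟩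
      x · s′ ++ x · t′  ≡⟨ map-++ _ s′ t′ ⟨
      x · (s′ ++ t′)    ∎
    ·-cong x (++-comm s t) = begin
      x · (s ++ t)    ≡⟨ map-++ _ s t ⟩
      x · s ++ x · t  ≈⟨ ++-comm (x · s) (x · t) ⟩
      x · t ++ x · s  ≡⟨ map-++ _ t s ⟨
      x · (t ++ s)    ∎
    ·-cong x (⊗-cong e e′) = ⊗-cong (A.*-congˡ e) (B.*-congˡ e′)
    ·-cong x (⊗-zero b)    = ∼-trans (⊗-cong (A.zeroʳ _) B.refl) (⊗-zero _)
    ·-cong x (⊗-distribʳ a a′ b) = ∼-trans (⊗-cong (A.distribˡ _ _ _) B.refl) (⊗-distribʳ _ _ _)
    ·-cong x (⊗-distribˡ a b b′) = ∼-trans (⊗-cong A.refl (B.distribˡ _ _ _)) (⊗-distribˡ _ _ _)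
    ·-cong (p , q) (⊗-scalar c a b) = begin
      (p A.* (A.ι c A.* a) , q B.* b) ∷ []
        ≈⟨ ⊗-cong (CommSemigroupProperties.x∙yz≈y∙xz A.*-commutativeSemigroup _ _ _) B.refl ⟩
      (A.ι c A.* (p A.* a) , q B.* b) ∷ []
        ≈⟨ ⊗-scalar c _ _ ⟩
      (p A.* a , B.ι c B.* (q B.* b)) ∷ []
        ≈⟨ ⊗-cong A.refl (CommSemigroupProperties.x∙yz≈y∙xz B.*-commutativeSemigroup _ _ _) ⟩
      (p A.* a , q B.* (B.ι c B.* b)) ∷ [] ∎

    *-congˡ : ∀ s {t t′} → t ∼ t′ → s * t ∼ s * t′
    *-congˡ []      e = ∼-refl
    *-congˡ (x ∷ s) e = ++-cong (·-cong x e) (*-congˡ s e)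

    *-[] : ∀ s → s * [] ≡ []
    *-[] []      = ≡.refl
    *-[] (x ∷ s) = *-[] s

    *-∷ : ∀ s x t → s * (x ∷ t) ∼ x · s ++ s * t
    *-∷ []      x t = ∼-refl
    *-∷ (y ∷ s) x t = begin
      ((y · (x ∷ [])) ++ y · t) ++ s * (x ∷ t)
        ≈⟨ ++-cong ∼-refl (*-∷ s x t) ⟩
      ((y · (x ∷ [])) ++ y · t) ++ (x · s ++ s * t)
        ≈⟨ middle (y · (x ∷ [])) (y · t) (x · s) (s * t) ⟩
      ((y · (x ∷ [])) ++ x · s) ++ (y · t ++ s * t)
        ≈⟨ ++-cong {t = y · t ++ s * t} (++-cong {t = x · s} (⊗-cong (A.*-comm _ _) (B.*-comm _ _)) ∼-refl) ∼-refl ⟩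
      ((x · (y ∷ [])) ++ x · s) ++ (y · t ++ s * t) ∎

    *-comm : ∀ s t → s * t ∼ t * s
    *-comm []      t = ≡⇒∼ (≡.sym (*-[] t))
    *-comm (x ∷ s) t = ∼-trans (++-cong ∼-refl (*-comm s t)) (∼-sym (*-∷ t x s))

    *-cong : ∀ {s s′ t t′} → s ∼ s′ → t ∼ t′ → s * t ∼ s′ * t′
    *-cong {s} {s′} {t} {t′} e e′ = begin
      s * t    ≈⟨ *-congˡ s e′ ⟩
      s * t′   ≈⟨ *-comm s t′ ⟩
      t′ * s   ≈⟨ *-congˡ t′ e ⟩
      t′ * s′  ≈⟨ *-comm t′ s′ ⟩
      s′ * t′  ∎

    *-distribʳ : ∀ u s t → (s ++ t) * u ≡ s * u ++ t * u
    *-distribʳ u []      t = ≡.refl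
    *-distribʳ u (x ∷ s) t =
      ≡.trans (≡.cong (x · u ++_) (*-distribʳ u s t)) (≡.sym (++-assoc (x · u) (s * u) (t * u)))

    *-distribˡ : ∀ u s t → u * (s ++ t) ∼ u * s ++ u * t
    *-distribˡ u s t = begin
      u * (s ++ t)    ≈⟨ *-comm u (s ++ t) ⟩
      (s ++ t) * u    ≡⟨ *-distribʳ u s t ⟩
      s * u ++ t * u  ≈⟨ ++-cong (*-comm s u) (*-comm t u) ⟩
      u * s ++ u * t  ∎

    ·-· : ∀ x y t → (proj₁ x A.* proj₁ y , proj₂ x B.* proj₂ y) · t ∼ x · (y · t)
    ·-· x y []      = ∼-refl
    ·-· x y (z ∷ t) = ++-cong {s = _ ∷ []} {s′ = _ ∷ []} (⊗-cong (A.*-assoc _ _ _) (B.*-assoc _ _ _)) (·-· x y t)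

    ·-* : ∀ x s t → (x · s) * t ∼ x · (s * t)
    ·-* x []      t = ∼-refl
    ·-* x (y ∷ s) t = begin
      (proj₁ x A.* proj₁ y , proj₂ x B.* proj₂ y) · t ++ (x · s) * t
        ≈⟨ ++-cong (·-· x y t) (·-* x s t) ⟩
      x · (y · t) ++ x · (s * t)  ≡⟨ map-++ _ (y · t) (s * t) ⟨
      x · (y · t ++ s * t)        ∎

    *-assoc : ∀ s t u → (s * t) * u ∼ s * (t * u)
    *-assoc []      t u = ∼-refl
    *-assoc (x ∷ s) t u = begin
      (x · t ++ s * t) * u          ≡⟨ *-distribʳ u (x · t) (s * t) ⟩
      (x · t) * u ++ (s * t) * u    ≈⟨ ++-cong (·-* x t u) (*-assoc s t u) ⟩
      x · (t * u) ++ s * (t * u)    ∎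

    *-identityˡ : ∀ t → ((A.1# , B.1#) ∷ []) * t ∼ t
    *-identityˡ t = begin
      (A.1# , B.1#) · t ++ []  ≡⟨ ++-identityʳ _ ⟩
      (A.1# , B.1#) · t        ≈⟨ pointwise _ id (λ _ → A.*-identityˡ _) (λ _ → B.*-identityˡ _) t ⟩
      map id t                 ≡⟨ List.map-id t ⟩
      t                        ∎

    inverseˡ : ∀ t → -1⊗1 · t ++ t ∼ []
    inverseˡ []            = ∼-refl
    inverseˡ ((a , b) ∷ t) = begin
      (y ++ -1⊗1 · t) ++ (((a , b) ∷ []) ++ t)  ≈⟨ middle y (-1⊗1 · t) ((a , b) ∷ []) t ⟩
      (y ++ ((a , b) ∷ [])) ++ (-1⊗1 · t ++ t)  ≈⟨ ++-cong cancel (inverseˡ t) ⟩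
      []                                        ∎
      where
      y : Tensor
      y = -1⊗1 · ((a , b) ∷ [])

      cancel : y ++ ((a , b) ∷ []) ∼ []
      cancel = begin
        y ++ ((a , b) ∷ [])
          ≈⟨ ++-cong (⊗-cong (RingProperties.-1*x≈-x A.ring a) (B.*-identityˡ b)) ∼-refl ⟩
        (A.- a , b) ∷ (a , b) ∷ []    ≈⟨ ⊗-distribʳ _ _ _ ⟨
        (A.- a A.+ a , b) ∷ []        ≈⟨ ⊗-cong (A.-‿inverseˡ a) B.refl ⟩
        (A.0# , b) ∷ []               ≈⟨ ⊗-zero b ⟩
        []                            ∎

  algebra : ℚ-Algebra
  algebra = record
    { commutativeRing = record
      { Carrier = Tensor ; _≈_ = _∼_ ; _+_ = _++_ ; _*_ = _*_ ; -_ = -1⊗1 ·_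
      ; 0# = [] ; 1# = (A.1# , B.1#) ∷ []
      ; isCommutativeRing = record
        { isRing = record
          { +-isAbelianGroup = record
            { isGroup = record
              { isMonoid = record
                { isSemigroup = record
                  { isMagma = record
                    { isEquivalence = record { refl = ∼-refl ; sym = ∼-sym ; trans = ∼-trans }
                    ; ∙-cong = ++-cong }
                  ; assoc = λ s t u → ≡⇒∼ (++-assoc s t u) }
                ; identity = (λ t → ∼-refl) , (λ t → ≡⇒∼ (++-identityʳ t)) }
              ; inverse = inverseˡ , (λ t → ∼-trans (++-comm t _) (inverseˡ t))
              ; ⁻¹-cong = ·-cong -1⊗1 }
            ; comm = ++-comm }
          ; *-cong = *-cong
          ; *-assoc = *-assoc
          ; *-identity = *-identityˡ , (λ t → ∼-trans (*-comm t _) (*-identityˡ t))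
          ; distrib = *-distribˡ , (λ u s t → ≡⇒∼ (*-distribʳ u s t)) }
        ; *-comm = *-comm } }
    ; ι = λ c → (A.ι c , B.1#) ∷ []
    ; ι-isHomomorphism = record
      { isSemiringHomomorphism = record
        { isNearSemiringHomomorphism = record
          { +-isMonoidHomomorphism = record
            { isMagmaHomomorphism = record
              { isRelHomomorphism = record { cong = λ { ≡.refl → ∼-refl } }
              ; homo = λ c d → ∼-trans (⊗-cong (A.ι.+-homo c d) B.refl) (⊗-distribʳ _ _ _) }
            ; ε-homo = ∼-trans (⊗-cong A.ι.0#-homo B.refl) (⊗-zero _) }
          ; *-homo = λ c d → ⊗-cong (A.ι.*-homo c d) (B.sym (B.*-identityˡ _)) }
        ; 1#-homo = ⊗-cong A.ι.1#-homo B.refl }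
      ; -‿homo = λ c → ⊗-cong
          (A.trans (A.ι.-‿homo c) (A.sym (RingProperties.-1*x≈-x A.ring _))) (B.sym (B.*-identityˡ _)) }
    }

------------------------------------------------------------------------

module Determinant (R : CommutativeRing 0ℓ 0ℓ) where

  open CommutativeRing R
  open RawMonoidOps +-rawMonoid using () renaming (sum to ∑)
  open RawSemiringOps (Semiring.rawSemiring semiring) using (_^_)

  det : ∀ {n} → (Fin n → Fin n → Carrier) → Carrier
  det {zero}  M = 1#
  det {suc n} M = ∑ λ j → (- 1#) ^ toℕ j * (M fzero j * det λ r c → M (fsuc r) (punchIn j c))

------------------------------------------------------------------------

record Partition : Set where
  constructor partition
  field
    parts      : List ℕ
    decreasing : Linked _≥_ parts

open Partition public

∅ : Partition
∅ = partition [] Linked.[]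

-- part ν i = νᵢ for i ≥ 1

part : Partition → ℕ → ℕ
part ν = nth (parts ν)
  where
  nth : List ℕ → ℕ → ℕ
  nth []      _             = 0
  nth (a ∷ _) 1             = a
  nth (_ ∷ α) (suc (suc i)) = nth α (suc i)
  nth (_ ∷ _) zero          = 0

------------------------------------------------------------------------

open SymmetricFunctions public using (Λ; powerSum; complete)

Λ[X,Y] : ℚ-Algebra
Λ[X,Y] = TensorProduct.algebra Λ Λ

module Λ[X,Y] = ℚ-Algebra Λ[X,Y]

𝐩 𝐩̃ : ℕ → Λ[X,Y].Carrier
𝐩 k = (powerSum k , ℚ-Algebra.1# Λ) ∷ []
𝐩̃ k = (ℚ-Algebra.1# Λ , powerSum k) ∷ []

𝐡 𝐡̃ : ℤ → Λ[X,Y].Carrier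
𝐡 k = (complete k , ℚ-Algebra.1# Λ) ∷ []
𝐡̃ k = (ℚ-Algebra.1# Λ , complete k) ∷ []

Admissible : ℕ → Partition → Partition → Set
Admissible d ν μ = 1 ≤ d × part ν (suc d) ≡ 0 × part μ (suc d) ≡ 0

-- The summation over the inner index j of the matrix product stops at
-- i + μ_{d-i+1}, since the index of 𝐡̃ is negative for all larger j.

𝐓𝐖 : ℕ → Partition → Partition → Λ[X,Y].Carrier
𝐓𝐖 d ν μ = det {d} λ r c → entry (suc (toℕ r)) (suc (toℕ c))
  where
  open Determinant Λ[X,Y].commutativeRing using (det)
  open RawMonoidOps Λ[X,Y].+-rawMonoid using () renaming (sum to ∑)

  left right entry : ℕ → ℕ → Λ[X,Y].Carrier
  left  i j = 𝐡̃ (+ i ℤ.- + j ℤ.+ + part μ (suc d ∸ i))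
  right i j = 𝐡 (+ j ℤ.- + i ℤ.+ + part ν (suc d ∸ j))
  entry i k = ∑ {n = i ℕ.+ part μ (suc d ∸ i)} λ m →
    let j = suc (toℕ m) in left i j Λ[X,Y].* right j k

------------------------------------------------------------------------
-- V = ℚ[[p₁,p₂,…,p̃₁,p̃₂,…]], as ℚ[[p₁,p₂,…]][[p̃₁,p̃₂,…]]

module ℚ[[p]] = PowerSeries ℚ-algebra
module ℚ[[p]][[p̃]] = PowerSeries ℚ[[p]].algebra

V : ℚ-Algebra
V = ℚ[[p]][[p̃]].algebra

module V = ℚ-Algebra V

-- p n = pₙ₊₁ and p̃ n = p̃ₙ₊₁

p p̃ : ℕ → V.Carrier
p n = ℚ[[p]][[p̃]].const (ℚ[[p]].var n)
p̃ n = ℚ[[p]][[p̃]].var n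

∂p ∂p̃ : ℕ → V.Carrier → V.Carrier
∂p n f = ℚ[[p]][[p̃]].series
  (λ α → ℚ[[p]].∂ n (ℚ[[p]][[p̃]].coeff f α))
  (λ α → ℚ[[p]].∂-cong n {ℚ[[p]][[p̃]].coeff f (α ∷ʳ 0)} {ℚ[[p]][[p̃]].coeff f α} (ℚ[[p]][[p̃]].trailing f α))
∂p̃ n f = ℚ[[p]][[p̃]].∂ n f

------------------------------------------------------------------------
-- The operator Δ = ∏_{k>0} ∑_{i≥0} kⁱ/i! (∂_{p_k} ∂_{p̃_k})ⁱ, where the
-- families D, D̃ : ℕ → A → A list the partial derivatives from k = 1 on

module Delta (A : ℚ-Algebra) (D D̃ : ℕ → ℚ-Algebra.Carrier A → ℚ-Algebra.Carrier A) where

  open ℚ-Algebra A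
  open RawMonoidOps +-rawMonoid using () renaming (sum to ∑)

  weight : ℕ → ℕ → ℚ
  weight k i = (+ (k ℕ.^ i)) ℚ./ (i ℕ.!)
    where instance _ = i ℕ.!≢0

  -- The k-th factor of the product for k = n + 1, cut off at i < I.

  factor : ℕ → ℕ → Carrier → Carrier
  factor I n f = ∑ {n = I} λ i → ι (weight (suc n) (toℕ i)) * iterate (D n ∘ D̃ n) f (toℕ i)

  truncated : ℕ → ℕ → Carrier → Carrier
  truncated zero    I = id
  truncated (suc K) I = truncated K I ∘ factor I K

  -- Δ f ↝ g says that the value of the infinite product at f exists and is g:
  -- every cut-off of it at k ≤ K and i < I with K, I large enough takes f to g.

  infix 4 Δ_↝_

  Δ_↝_ : Carrier → Carrier → Set
  Δ f ↝ g = ∃[ N ] ∀ K I → N ≤ K → N ≤ I → truncated K I f ≈ g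

{-# OPTIONS --safe #-}
module Submission where

-- Let H(t) = ∑ hₙ tⁿ and H̃(u) = ∑ h̃ₙ uⁿ.  By Newton's identities
-- k ∂_{p_k} H(t) = tᵏ H(t), so ∏ₖ H(tₖ) ∏ᵢ H̃(uᵢ) is a joint eigenvector of all
-- ∂_{p_k} and ∂_{p̃_k}, and Δ multiplies it by exp ∑ₙ (∑ₖ tₖⁿ)(∑ᵢ uᵢⁿ)/n, which is
-- ∏ 1/(1 - tₖ uᵢ).  The determinants TW^{λ∅} and TW^{∅μ} reduce to the Jacobi–Trudi
-- determinants, that is, to the coefficients at one monomial of det(tₖʲ) ∏ₖ H(tₖ) and
-- det(uᵢʲ) ∏ᵢ H̃(uᵢ).  By Cauchy's determinant
--   det(uᵢʲ) det(tₖʲ) ∏ 1/(1 - tₖ uᵢ) = det(1/(1 - tₖ uᵢ)),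
-- so Δ(TW^{λ∅} TW^{∅μ}) is a coefficient of det(H̃(uᵢ) H(tₖ)/(1 - tₖ uᵢ)), and since
-- 1/(1 - tₖ uᵢ) = ∑ⱼ tₖʲ uᵢʲ this is the determinant that defines TW^{λμ}.

open import Algebra.Bundles using (CommutativeRing; Semiring)
import Algebra.Definitions.RawMonoid as RawMonoidOps
import Algebra.Definitions.RawSemiring as RawSemiringOps
open import Algebra.Morphism.Structures using (IsRingHomomorphism)
import Algebra.Properties.CommutativeMonoid.Sum as CommutativeMonoidSum
import Algebra.Properties.CommutativeSemigroup as CommSemigroupProperties
import Algebra.Properties.CommutativeSemiring.Exp as CommExp
import Algebra.Properties.Ring as RingProperties
import Algebra.Properties.Semiring.Sum as SemiringSum
open import Data.Bool.Base using (Bool; true; false; if_then_else_; _∧_)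
open import Data.Empty using (⊥-elim)
open import Data.Fin.Base using (Fin; toℕ; punchIn; punchOut) renaming (zero to fzero; suc to fsuc)
open import Data.Fin.Properties using (_≟_; any?; punchIn-punchOut; toℕ<n)
open import Data.Integer.Base as ℤ using (ℤ; +_; -[1+_])
import Data.Integer.Properties as ℤ
open import Data.List.Base using (List; []; _∷_; _∷ʳ_; filter; tabulate)
import Data.List.Properties as List
import Data.List.Relation.Unary.Linked as Linked
open import Data.Nat.Base as ℕ using (ℕ; zero; suc; _∸_; z≤n; s≤s; _≡ᵇ_; _<ᵇ_)
open import Data.Nat.GeneralisedArithmetic using (iterate)
open import Data.Nat.ListAction using (sum)
open import Data.Nat.ListAction.Properties using (sum-++)
import Data.Nat.Properties as ℕ
open import Data.Nat.Tactic.RingSolver using (solve-∀)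
open import Data.Product.Base using (_×_; _,_; proj₁; proj₂)
open import Data.Rational.Base as ℚ using (ℚ; 0ℚ; 1ℚ)
import Data.Rational.Properties as ℚ
open import Data.Rational.Unnormalised.Base as ℚᵘ using (mkℚᵘ; *≡*)
import Data.Rational.Unnormalised.Properties as ℚᵘ
open import Data.Sum.Base using (_⊎_; inj₁; inj₂; [_,_])
open import Data.Sum.Properties using (inj₁-injective; inj₂-injective)
open import Data.Unit.Base using (⊤; tt)
open import Data.Vec.Functional using () renaming (_∷_ to _◂_)
open import Function.Base using (_∘_; id)
open import Level using (0ℓ)
open import Relation.Binary.PropositionalEquality as ≡ using (_≡_; _≢_; _≗_)
import Relation.Binary.Reasoning.Setoid as SetoidReasoning
open import Relation.Nullary using (Dec; does; yes; no; ¬?)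
open import Defs

-- Δ is available only through its cut-offs, and in general none of them equals the full
-- exponential, so the passage from exp ∑ ... to ∏ 1/(1 - tₖ uᵢ) cannot be made by an identity
-- between infinite products. The two sides are compared modulo high order in the uᵢ: both have
-- constant term 1 and, to that order, the same logarithmic derivative for the Euler derivation θ in
-- the uᵢ, and over ℚ this determines a series degree by degree. One coefficient in the uᵢ is
-- extracted in the end, and its degree says how large the cut-offs must be. In this comparison the
-- tₖ count as scalars.
--
-- The partial derivatives on Λ(X,Y) are given only as derivations with prescribed values on the
-- power sums. Newton's recurrence links them to the hₙ: division by n makes it determine the
-- derivatives of all hₙ. The recurrence passes along algebra homomorphisms, so the argument runs
-- once, over any ℚ-algebra with two such sequences, and both claims are instances of it.

-- Rearrangements, finite sums and products in a commutative ring

module SemiringIdentities (R : CommutativeRing 0ℓ 0ℓ) where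

  open CommutativeRing R hiding (zero)
  open import Algebra.Solver.Ring.NaturalCoefficients.Default commutativeSemiring
    using (solve; _:+_; _:*_; _:=_)

  exchange-expansions : ∀ m s a t b d → (m * s) * (a * (t * (b * d))) ≈ (m * t) * (b * (s * (a * d)))
  exchange-expansions = solve 6 (λ m s a t b d → (m :* s) :* (a :* (t :* (b :* d))) := (m :* t) :* (b :* (s :* (a :* d)))) refl

  x+yz≈y+xz : ∀ x y z → x + (y + z) ≈ y + (x + z)
  x+yz≈y+xz = solve 3 (λ x y z → x :+ (y :+ z) := y :+ (x :+ z)) refl

  x∙yz≈y∙xz : ∀ x y z → x * (y * z) ≈ y * (x * z)
  x∙yz≈y∙xz = solve 3 (λ x y z → x :* (y :* z) := y :* (x :* z)) refl

  w∙x∙yz≈y∙w∙xz : ∀ w x y z → w * (x * (y * z)) ≈ y * (w * (x * z))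
  w∙x∙yz≈y∙w∙xz = solve 4 (λ w x y z → w :* (x :* (y :* z)) := y :* (w :* (x :* z))) refl

  w∙xy∙z≈x∙wy∙z : ∀ w x y z → w * (x * y * z) ≈ x * (w * y * z)
  w∙xy∙z≈x∙wy∙z = solve 4 (λ w x y z → w :* (x :* y :* z) := x :* (w :* y :* z)) refl

  factor-row : ∀ s x m p d → s * (x * m * (p * d)) ≈ x * p * (s * (m * d))
  factor-row = solve 5 (λ s x m p d → s :* (x :* m :* (p :* d)) := x :* p :* (s :* (m :* d))) refl

  distrib-shift : ∀ a m b s p → (a + m * b) * (s * p) ≈ a * (s * p) + m * s * (b * p)
  distrib-shift = solve 5 (λ a m b s p → (a :+ m :* b) :* (s :* p) := a :* (s :* p) :+ m :* s :* (b :* p)) refl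

  xy+z≈xz+y : ∀ x y z → x + y + z ≈ x + z + y
  xy+z≈xz+y = solve 3 (λ x y z → x :+ y :+ z := x :+ z :+ y) refl

  exchange-factors : ∀ a x b y c → (a + x * b) + y * (b + x * c) ≈ (a + y * b) + x * (b + y * c)
  exchange-factors = solve 5 (λ a x b y c →
    (a :+ x :* b) :+ y :* (b :+ x :* c) := (a :+ y :* b) :+ x :* (b :+ y :* c)) refl

  regroup : ∀ a b c d e f → ((a + b) + (c + d)) + (e + f) ≈ (a + c) + ((b + e) + (d + f))
  regroup = solve 6 (λ a b c d e f →
    ((a :+ b) :+ (c :+ d)) :+ (e :+ f) := (a :+ c) :+ ((b :+ e) :+ (d :+ f))) refl

  collect : ∀ w k y p → w * k * (k * (y * p)) ≈ k * k * y * (w * p)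
  collect = solve 4 (λ w k y p → w :* k :* (k :* (y :* p)) := k :* k :* y :* (w :* p)) refl

  reorder : ∀ u t h k → u * t * (h * k) ≈ h * t * (k * u)
  reorder = solve 4 (λ u t h k → u :* t :* (h :* k) := h :* t :* (k :* u)) refl

module FiniteSums (R : CommutativeRing 0ℓ 0ℓ) where

  open CommutativeRing R hiding (zero)
  private
    module Sum = SemiringSum semiring
    module Product = CommutativeMonoidSum *-commutativeMonoid

  -- Opaque because the unifier would unfold the sums along the recursion on n.
  opaque
    ∑ : ∀ {n} → (Fin n → Carrier) → Carrier
    ∑ = Sum.sum

    ∑≈sum : ∀ {n} (f : Fin n → Carrier) → ∑ f ≈ Sum.sum f
    ∑≈sum f = refl

    ∑-zero : (f : Fin 0 → Carrier) → ∑ f ≈ 0#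
    ∑-zero f = refl

    ∑-suc : ∀ {n} (f : Fin (suc n) → Carrier) → ∑ f ≈ f fzero + ∑ (f ∘ fsuc)
    ∑-suc f = refl

    ∑-cong : ∀ {n} {f g : Fin n → Carrier} → (∀ i → f i ≈ g i) → ∑ f ≈ ∑ g
    ∑-cong = Sum.sum-cong-≋

    ∑-0 : ∀ {n} {f : Fin n → Carrier} → (∀ i → f i ≈ 0#) → ∑ f ≈ 0#
    ∑-0 {n} e = trans (∑-cong e) (Sum.sum-replicate-zero n)

    ∑-+ : ∀ {n} (f g : Fin n → Carrier) → ∑ (λ i → f i + g i) ≈ ∑ f + ∑ g
    ∑-+ = Sum.∑-distrib-+

    ∑-comm : ∀ {m n} (f : Fin m → Fin n → Carrier) →
             ∑ (λ i → ∑ λ j → f i j) ≈ ∑ (λ j → ∑ λ i → f i j)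
    ∑-comm = Sum.∑-comm

    *-distribˡ-∑ : ∀ {n} x (f : Fin n → Carrier) → x * ∑ f ≈ ∑ (λ i → x * f i)
    *-distribˡ-∑ = Sum.*-distribˡ-sum

    *-distribʳ-∑ : ∀ {n} x (f : Fin n → Carrier) → ∑ f * x ≈ ∑ (λ i → f i * x)
    *-distribʳ-∑ = Sum.*-distribʳ-sum

    ∏ : ∀ {n} → (Fin n → Carrier) → Carrier
    ∏ = Product.sum

    ∏-zero : (f : Fin 0 → Carrier) → ∏ f ≈ 1#
    ∏-zero f = refl

    ∏-suc : ∀ {n} (f : Fin (suc n) → Carrier) → ∏ f ≈ f fzero * ∏ (f ∘ fsuc)
    ∏-suc f = refl

    ∏-cong : ∀ {n} {f g : Fin n → Carrier} → (∀ i → f i ≈ g i) → ∏ f ≈ ∏ g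
    ∏-cong = Product.sum-cong-≋

    ∏-* : ∀ {n} (f g : Fin n → Carrier) → ∏ (λ i → f i * g i) ≈ ∏ f * ∏ g
    ∏-* = Product.∑-distrib-+

    ∏-1 : ∀ n → ∏ {n} (λ _ → 1#) ≈ 1#
    ∏-1 n = Product.sum-replicate-zero n

    ∏-remove : ∀ {n} (i : Fin (suc n)) (f : Fin (suc n) → Carrier) → ∏ f ≈ f i * ∏ (f ∘ punchIn i)
    ∏-remove i f = Product.sum-remove {i = i} f

  ∑-last : ∀ n (f : ℕ → Carrier) → ∑ {suc n} (f ∘ toℕ) ≈ ∑ {n} (f ∘ toℕ) + f n
  ∑-last zero    f = trans (∑-suc _) (trans (+-comm _ _) (+-congʳ (trans (∑-zero _) (sym (∑-zero _)))))
  ∑-last (suc n) f = trans (∑-suc _) (trans (+-congˡ (∑-last n (f ∘ suc)))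
    (trans (sym (+-assoc _ _ _)) (+-congʳ (sym (∑-suc _)))))

-- Determinants: expansions, alternation, multiplicativity

module DeterminantProperties (R : CommutativeRing 0ℓ 0ℓ) where

  open CommutativeRing R hiding (zero)
  open SemiringIdentities R
  open Determinant R using (det)
  open RawSemiringOps (Semiring.rawSemiring semiring) using (_^_)
  open FiniteSums R
  open RingProperties ring using (-1*x≈-x; -0#≈0#; -‿involutive; -‿+-comm)
  open SetoidReasoning setoid

  Matrix : ℕ → Set
  Matrix n = Fin n → Fin n → Carrier

  sgn : ∀ {n} → Fin n → Carrier
  sgn j = (- 1#) ^ toℕ j

  -- Opaque for the same reason as ∑.
  opaque
    Det : ∀ {n} → Matrix n → Carrier
    Det = det

    Det≈det : ∀ {n} (M : Matrix n) → Det M ≈ det M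
    Det≈det M = refl

    Det-zero : (M : Matrix 0) → Det M ≈ 1#
    Det-zero M = refl

    Det-suc : ∀ {n} (M : Matrix (suc n)) →
              Det M ≈ ∑ λ j → sgn j * (M fzero j * Det λ r c → M (fsuc r) (punchIn j c))
    Det-suc M = sym (∑≈sum _)

    Det-cong : ∀ {n} {M N : Matrix n} → (∀ r c → M r c ≈ N r c) → Det M ≈ Det N
    Det-cong {zero}  e = refl
    Det-cong {suc n} {M} {N} e = trans (Det-suc M) (trans
      (∑-cong λ j → *-congˡ (*-cong (e fzero j) (Det-cong λ r c → e (fsuc r) (punchIn j c))))
      (sym (Det-suc N)))

  -- Induction on the size. Apart from the corner term, which both expansions share, expanding along
  -- the first row and then the minors along their first column gives the same double sum as the
  -- opposite order.
  Det-column-expansion : ∀ {n} (M : Matrix (suc n)) →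
    Det M ≈ ∑ λ i → sgn i * (M i fzero * Det λ r c → M (punchIn i r) (fsuc c))
  Det-column-expansion {zero}  M = trans (Det-suc M) (∑-cong λ { fzero → *-congˡ (*-congˡ (Det-cong λ ())) })
  Det-column-expansion {suc n} M = trans (Det-suc M) (trans (∑-suc _) (trans (+-congˡ (begin
    (∑ λ j → (- 1# * sgn j) * (a j * Det λ r c → M (fsuc r) (punchIn (fsuc j) c)))
      ≈⟨ ∑-cong (λ j → begin
           (- 1# * sgn j) * (a j * Det λ r c → M (fsuc r) (punchIn (fsuc j) c))
             ≈⟨ *-congˡ (*-congˡ (Det-column-expansion λ r c → M (fsuc r) (punchIn (fsuc j) c))) ⟩
           (- 1# * sgn j) * (a j * ∑ λ i → sgn i * (b i * D i j))
             ≈⟨ *-congˡ (*-distribˡ-∑ (a j) _) ⟩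
           (- 1# * sgn j) * (∑ λ i → a j * (sgn i * (b i * D i j)))
             ≈⟨ *-distribˡ-∑ (- 1# * sgn j) _ ⟩
           (∑ λ i → (- 1# * sgn j) * (a j * (sgn i * (b i * D i j)))) ∎) ⟩
    (∑ λ j → ∑ λ i → (- 1# * sgn j) * (a j * (sgn i * (b i * D i j))))
      ≈⟨ ∑-comm _ ⟩
    (∑ λ i → ∑ λ j → (- 1# * sgn j) * (a j * (sgn i * (b i * D i j))))
      ≈⟨ ∑-cong (λ i → ∑-cong λ j → exchange-expansions (- 1#) (sgn j) (a j) (sgn i) (b i) (D i j)) ⟩
    (∑ λ i → ∑ λ j → (- 1# * sgn i) * (b i * (sgn j * (a j * D i j))))
      ≈⟨ ∑-cong (λ i → begin
           (- 1# * sgn i) * (b i * Det λ r c → M (punchIn (fsuc i) r) (fsuc c))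
             ≈⟨ *-congˡ (*-congˡ (Det-suc _)) ⟩
           (- 1# * sgn i) * (b i * ∑ λ j → sgn j * (a j * D i j))
             ≈⟨ *-congˡ (*-distribˡ-∑ (b i) _) ⟩
           (- 1# * sgn i) * (∑ λ j → b i * (sgn j * (a j * D i j)))
             ≈⟨ *-distribˡ-∑ (- 1# * sgn i) _ ⟩
           (∑ λ j → (- 1# * sgn i) * (b i * (sgn j * (a j * D i j)))) ∎) ⟨
    (∑ λ i → (- 1# * sgn i) * (b i * Det λ r c → M (punchIn (fsuc i) r) (fsuc c))) ∎)) (sym (∑-suc _))))
    where
    a : Fin (suc n) → Carrier
    a j = M fzero (fsuc j)

    b : Fin (suc n) → Carrier
    b i = M (fsuc i) fzero

    D : Fin (suc n) → Fin (suc n) → Carrier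
    D i j = Det λ r c → M (fsuc (punchIn i r)) (fsuc (punchIn j c))

  Det-transpose : ∀ {n} (M : Matrix n) → Det (λ r c → M c r) ≈ Det M
  Det-transpose {zero}  M = trans (Det-zero _) (sym (Det-zero _))
  Det-transpose {suc n} M = begin
    Det (λ r c → M c r)
      ≈⟨ Det-suc _ ⟩
    (∑ λ j → sgn j * (M j fzero * Det λ r c → M (punchIn j c) (fsuc r)))
      ≈⟨ ∑-cong (λ j → *-congˡ (*-congˡ (Det-transpose λ r c → M (punchIn j r) (fsuc c)))) ⟩
    (∑ λ j → sgn j * (M j fzero * Det λ r c → M (punchIn j r) (fsuc c)))
      ≈⟨ Det-column-expansion M ⟨
    Det M ∎

  private

    minor : ∀ {n} → Matrix (suc n) → Fin (suc n) → Carrier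
    minor M j = Det λ r c → M (fsuc r) (punchIn j c)

    term : ∀ {n} → Matrix (suc n) → Fin (suc n) → Carrier
    term M j = M fzero j * minor M j

    rest : ∀ {n} → Matrix (suc (suc n)) → Carrier
    rest M = ∑ λ j → sgn (fsuc (fsuc j)) * term M (fsuc (fsuc j))

    -1*1*x≈-x : ∀ x → - 1# * 1# * x ≈ - x
    -1*1*x≈-x x = trans (*-congʳ (*-identityʳ _)) (-1*x≈-x x)

    expand : ∀ {n} (M : Matrix (suc (suc n))) →
             Det M ≈ term M fzero + (- term M (fsuc fzero) + rest M)
    expand M = trans (Det-suc M) (trans (∑-suc _) (+-cong (*-identityˡ _) (trans (∑-suc _) (+-congʳ (-1*1*x≈-x _)))))

    -- In the first-row expansion the terms of columns 0 and 1 change places, and as their signs are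
    -- opposite this is a negation. Every other minor still has the two columns in front, so
    -- induction applies to it.
    swap-columns : ∀ {n} (M N : Matrix (suc (suc n))) →
      (∀ r → M r fzero ≈ N r (fsuc fzero)) → (∀ r → M r (fsuc fzero) ≈ N r fzero) →
      (∀ r c → M r (fsuc (fsuc c)) ≈ N r (fsuc (fsuc c))) → Det M ≈ - Det N
    swap-columns {n} M N e₀ e₁ e = begin
      Det M                                                ≈⟨ expand M ⟩
      term M fzero + (- term M (fsuc fzero) + rest M)
        ≈⟨ +-cong (*-cong (e₀ fzero) (minor₀ M N e₁ e))
             (+-cong (-‿cong (*-cong (e₁ fzero) (sym (minor₀ N M (sym ∘ e₀) λ r c → sym (e r c))))) rest-swap) ⟩
      term N (fsuc fzero) + (- term N fzero + - rest N)
        ≈⟨ +-cong (sym (-‿involutive _)) (-‿+-comm _ _) ⟩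
      - - term N (fsuc fzero) + - (term N fzero + rest N)
        ≈⟨ -‿+-comm _ _ ⟩
      - (- term N (fsuc fzero) + (term N fzero + rest N))
        ≈⟨ -‿cong (x+yz≈y+xz _ _ _) ⟩
      - (term N fzero + (- term N (fsuc fzero) + rest N))  ≈⟨ -‿cong (expand N) ⟨
      - Det N                                              ∎
      where
      minor₀ : ∀ M N → (∀ r → M r (fsuc fzero) ≈ N r fzero) →
               (∀ r c → M r (fsuc (fsuc c)) ≈ N r (fsuc (fsuc c))) → minor M fzero ≈ minor N (fsuc fzero)
      minor₀ M N e₁ e = Det-cong λ { r fzero → e₁ (fsuc r) ; r (fsuc c) → e (fsuc r) c }

      minor-swap : ∀ j → minor M (fsuc (fsuc j)) ≈ - minor N (fsuc (fsuc j))
      -- The two cases are alike: matching on `j` shows that `n` is a successor, so that the minor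
      -- has two columns to swap.
      minor-swap j@fzero    = swap-columns _ _ (e₀ ∘ fsuc) (e₁ ∘ fsuc) (λ r c → e (fsuc r) (punchIn j c))
      minor-swap j@(fsuc _) = swap-columns _ _ (e₀ ∘ fsuc) (e₁ ∘ fsuc) (λ r c → e (fsuc r) (punchIn j c))

      rest-swap : rest M ≈ - rest N
      rest-swap = begin
        rest M
          ≈⟨ ∑-cong (λ j → *-congˡ (*-cong (e fzero j) (trans (minor-swap j) (sym (-1*x≈-x _))))) ⟩
        (∑ λ j → sgn (fsuc (fsuc j)) * (N fzero (fsuc (fsuc j)) * (- 1# * minor N (fsuc (fsuc j)))))
          ≈⟨ ∑-cong (λ j → w∙x∙yz≈y∙w∙xz (sgn (fsuc (fsuc j))) (N fzero (fsuc (fsuc j))) (- 1#) (minor N (fsuc (fsuc j)))) ⟩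
        (∑ λ j → - 1# * (sgn (fsuc (fsuc j)) * term N (fsuc (fsuc j))))
          ≈⟨ *-distribˡ-∑ (- 1#) (λ j → sgn (fsuc (fsuc j)) * term N (fsuc (fsuc j))) ⟨
        - 1# * rest N
          ≈⟨ -1*x≈-x _ ⟩
        - rest N ∎

    -- Does not follow from `swap-columns` over a general commutative ring, where 2x = 0 need not
    -- give x = 0; the same expansion is used once more.
    equal-columns : ∀ {n} (M : Matrix (suc (suc n))) →
      (∀ r → M r fzero ≈ M r (fsuc fzero)) → Det M ≈ 0#
    equal-columns {n} M e = begin
      Det M
        ≈⟨ expand M ⟩
      term M fzero + (- term M (fsuc fzero) + rest M)
        ≈⟨ +-congˡ (+-cong
             (-‿cong (*-cong (sym (e fzero)) (Det-cong λ { r fzero → e (fsuc r) ; r (fsuc c) → refl })))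
             (∑-0 λ j → trans (*-congˡ (trans (*-congˡ (minor-0 j)) (zeroʳ _))) (zeroʳ _))) ⟩
      term M fzero + (- term M fzero + 0#)
        ≈⟨ +-congˡ (+-identityʳ _) ⟩
      term M fzero + - term M fzero
        ≈⟨ -‿inverseʳ _ ⟩
      0# ∎
      where
      minor-0 : ∀ j → minor M (fsuc (fsuc j)) ≈ 0#
      minor-0 fzero    = equal-columns _ (e ∘ fsuc)
      minor-0 (fsuc _) = equal-columns _ (e ∘ fsuc)

  Extensional : ∀ {n} {X : Set} → ((Fin n → X) → Carrier) → Set
  Extensional G = ∀ {f g} → f ≗ g → G f ≈ G g

  -- Only neighbouring arguments are compared: the first two, and recursively those after a fixed
  -- first argument. This makes every argument an induction on `n` and avoids permutations.
  Alternating : ∀ n {X : Set} → ((Fin n → X) → Carrier) → Set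
  Alternating zero          G = ⊤
  Alternating (suc zero)    G = ⊤
  Alternating (suc (suc n)) G =
    (∀ a b f → G (a ◂ b ◂ f) ≈ - G (b ◂ a ◂ f)) ×
    (∀ a f → G (a ◂ a ◂ f) ≈ 0#) ×
    (∀ a → Alternating (suc n) (G ∘ (a ◂_)))

  Alternating-cong : ∀ n {X : Set} {G H : (Fin n → X) → Carrier} →
                     (∀ f → G f ≈ H f) → Alternating n H → Alternating n G
  Alternating-cong zero          e alt                = tt
  Alternating-cong (suc zero)    e alt                = tt
  Alternating-cong (suc (suc n)) e (swap , dup , alt) =
    (λ a b f → trans (e _) (trans (swap a b f) (-‿cong (sym (e _))))) ,
    (λ a f → trans (e _) (dup a f)) ,
    (λ a → Alternating-cong (suc n) (λ f → e (a ◂ f)) (alt a))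

  Alternating-∑ : ∀ n {m} {X : Set} (x : Fin m → Carrier) {G : Fin m → (Fin n → X) → Carrier} →
                    (∀ j → Alternating n (G j)) → Alternating n (λ f → ∑ λ j → x j * G j f)
  Alternating-∑ zero          x alt = tt
  Alternating-∑ (suc zero)    x alt = tt
  Alternating-∑ (suc (suc n)) x {G} alt =
    (λ a b f → begin
      (∑ λ j → x j * G j (a ◂ b ◂ f))
        ≈⟨ ∑-cong (λ j → trans (*-congˡ (trans (proj₁ (alt j) a b f) (sym (-1*x≈-x _)))) (x∙yz≈y∙xz (x j) (- 1#) _)) ⟩
      (∑ λ j → - 1# * (x j * G j (b ◂ a ◂ f)))
        ≈⟨ *-distribˡ-∑ (- 1#) _ ⟨
      - 1# * (∑ λ j → x j * G j (b ◂ a ◂ f))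
        ≈⟨ -1*x≈-x _ ⟩
      - (∑ λ j → x j * G j (b ◂ a ◂ f)) ∎) ,
    (λ a f → ∑-0 λ j → trans (*-congˡ (proj₁ (proj₂ (alt j)) a f)) (zeroʳ _)) ,
    (λ a → Alternating-∑ (suc n) x λ j → proj₂ (proj₂ (alt j)) a)

  -- Alternation in the rows. For the first two rows it is the statement on columns, transposed;
  -- with the first row fixed, the expansion along it is a linear combination of smaller
  -- determinants in the other rows.
  Det-alternating : ∀ n {X : Set} (B : X → Fin n → Carrier) → Alternating n (λ f → Det λ r → B (f r))
  Det-alternating zero          B = tt
  Det-alternating (suc zero)    B = tt
  Det-alternating (suc (suc n)) B =
    (λ a b f → trans (sym (Det-transpose λ r → B ((a ◂ b ◂ f) r)))
      (trans (swap-columns (λ r c → B ((a ◂ b ◂ f) c) r) (λ r c → B ((b ◂ a ◂ f) c) r)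
               (λ _ → refl) (λ _ → refl) (λ _ _ → refl))
             (-‿cong (Det-transpose λ r → B ((b ◂ a ◂ f) r))))) ,
    (λ a f → trans (sym (Det-transpose λ r → B ((a ◂ a ◂ f) r)))
      (equal-columns (λ r c → B ((a ◂ a ◂ f) c) r) (λ _ → refl))) ,
    (λ a → Alternating-cong (suc n) (λ f → trans (Det-suc _) (∑-cong λ j → sym (*-assoc (sgn j) (B a j) _)))
      (Alternating-∑ (suc n) (λ j → sgn j * B a j)
        λ j → Det-alternating (suc n) (λ x c → B x (punchIn j c))))

  private
    ◂-cong : ∀ {n} {X : Set} (a : X) {f g : Fin n → X} → f ≗ g → a ◂ f ≗ a ◂ g
    ◂-cong a e fzero    = ≡.refl
    ◂-cong a e (fsuc i) = e i

    ◂-η : ∀ {n} {X : Set} (f : Fin (suc n) → X) → f ≗ f fzero ◂ (f ∘ fsuc)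
    ◂-η f fzero    = ≡.refl
    ◂-η f (fsuc i) = ≡.refl

    ∘-◂ : ∀ {n} {X Y : Set} (φ : X → Y) (a : X) (f : Fin n → X) → φ ∘ (a ◂ f) ≗ φ a ◂ (φ ∘ f)
    ∘-◂ φ a f fzero    = ≡.refl
    ∘-◂ φ a f (fsuc i) = ≡.refl

    infixr 5 _⟫_
    _⟫_ : ∀ {X : Set} {n} {f g h : Fin n → X} → f ≗ g → g ≗ h → f ≗ h
    (e ⟫ e′) i = ≡.trans (e i) (e′ i)

  Alternating-∘ : ∀ n {X Y : Set} (φ : X → Y) {G : (Fin n → Y) → Carrier} → Extensional G →
                  Alternating n G → Alternating n (λ f → G (φ ∘ f))
  Alternating-∘ zero          φ ext alt = tt
  Alternating-∘ (suc zero)    φ ext alt = tt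
  Alternating-∘ (suc (suc n)) φ ext (swap , dup , alt) =
    (λ a b f → trans (ext (∘-◂² a b f)) (trans (swap (φ a) (φ b) (φ ∘ f)) (-‿cong (sym (ext (∘-◂² b a f)))))) ,
    (λ a f → trans (ext (∘-◂² a a f)) (dup (φ a) (φ ∘ f))) ,
    (λ a → Alternating-cong (suc n) (λ f → ext (∘-◂ φ a f))
      (Alternating-∘ (suc n) φ (λ e → ext (◂-cong (φ a) e)) (alt (φ a))))
    where
    ∘-◂² : ∀ a b f → φ ∘ (a ◂ b ◂ f) ≗ φ a ◂ φ b ◂ (φ ∘ f)
    ∘-◂² a b f = ∘-◂ φ a (b ◂ f) ⟫ ◂-cong (φ a) (∘-◂ φ b f)

  -- Adjacent swaps carry `a` to the right until it stands next to its copy.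
  alternating-repeat : ∀ n {X : Set} {G : (Fin (suc n) → X) → Carrier} → Extensional G →
                       Alternating (suc n) G → ∀ a f i → f i ≡ a → G (a ◂ f) ≈ 0#
  alternating-repeat (suc n) ext (swap , dup , alt) a f fzero    ≡.refl =
    trans (ext (◂-cong a (◂-η f))) (dup a _)
  alternating-repeat (suc n) ext (swap , dup , alt) a f (fsuc i) e =
    trans (ext (◂-cong a (◂-η f))) (trans (swap a (f fzero) _)
      (trans (-‿cong (alternating-repeat n (ext ∘ ◂-cong (f fzero)) (alt (f fzero)) a (f ∘ fsuc) i e)) -0#≈0#))

  -- `j ◂ punchIn j` lists `j` first and then the other indices in order; `toℕ j` adjacent swaps
  -- sort it.
  alternating-cycle : ∀ n {G : (Fin (suc n) → Fin (suc n)) → Carrier} → Extensional G →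
                      Alternating (suc n) G → ∀ j → G (j ◂ punchIn j) ≈ sgn j * G id
  alternating-cycle n ext alt fzero =
    trans (ext λ { fzero → ≡.refl ; (fsuc i) → ≡.refl }) (sym (*-identityˡ _))
  alternating-cycle (suc n) {G} ext (swap , dup , alt) (fsuc j) = begin
    G (fsuc j ◂ punchIn (fsuc j))
      ≈⟨ ext (◂-cong (fsuc j) (◂-η (punchIn (fsuc j)))) ⟩
    G (fsuc j ◂ fzero ◂ (fsuc ∘ punchIn j))
      ≈⟨ swap (fsuc j) fzero _ ⟩
    - G (fzero ◂ fsuc j ◂ (fsuc ∘ punchIn j))
      ≈⟨ -‿cong (ext (◂-cong fzero (∘-◂ fsuc j (punchIn j)))) ⟨
    - G (fzero ◂ (fsuc ∘ (j ◂ punchIn j)))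
      ≈⟨ -‿cong (alternating-cycle n ext′ (Alternating-∘ (suc n) fsuc (ext ∘ ◂-cong fzero) (alt fzero)) j) ⟩
    - (sgn j * G (fzero ◂ fsuc))
      ≈⟨ -1*x≈-x _ ⟨
    - 1# * (sgn j * G (fzero ◂ fsuc))
      ≈⟨ *-assoc _ _ _ ⟨
    - 1# * sgn j * G (fzero ◂ fsuc)
      ≈⟨ *-congˡ (ext λ { fzero → ≡.refl ; (fsuc i) → ≡.refl }) ⟩
    - 1# * sgn j * G id ∎
    where
    ext′ : Extensional (λ f → G (fzero ◂ (fsuc ∘ f)))
    ext′ e = ext (◂-cong fzero (λ i → ≡.cong fsuc (e i)))

  -- If the first value of `f` occurs again, both sides vanish. Otherwise the remaining values avoid
  -- it, hence factor through `punchIn`, and induction applies with the first value fixed; its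
  -- hypothesis at the identity is supplied by `alternating-cycle`.
  alternating-unique : ∀ n {G H : (Fin n → Fin n) → Carrier} → Extensional G → Extensional H →
                       Alternating n G → Alternating n H → G id ≈ H id → ∀ f → G f ≈ H f
  alternating-unique zero    extG extH altG altH e f = trans (extG λ ()) (trans e (extH λ ()))
  alternating-unique (suc n) {G} {H} extG extH altG altH e f
    with any? (λ i → f (fsuc i) ≟ f fzero)
  ... | yes (i , hit) = trans (vanish extG altG) (sym (vanish extH altH))
    where
    vanish : ∀ {G} → Extensional G → Alternating (suc n) G → G f ≈ 0#
    vanish ext alt = trans (ext (◂-η f)) (alternating-repeat n ext alt (f fzero) (f ∘ fsuc) i hit)
  ... | no miss = begin
    G f                          ≈⟨ extG f≗ ⟩
    G (j ◂ (punchIn j ∘ g))      ≈⟨ alternating-unique n (ext′ extG) (ext′ extH) (alt′ extG altG) (alt′ extH altH) e′ g ⟩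
    H (j ◂ (punchIn j ∘ g))      ≈⟨ extH f≗ ⟨
    H f                          ∎
    where
    j : Fin (suc n)
    j = f fzero

    g : Fin n → Fin n
    g i = punchOut {i = j} {j = f (fsuc i)} (λ eq → miss (i , ≡.sym eq))

    f≗ : f ≗ j ◂ (punchIn j ∘ g)
    f≗ fzero    = ≡.refl
    f≗ (fsuc i) = ≡.sym (punchIn-punchOut (λ eq → miss (i , ≡.sym eq)))

    ext′ : ∀ {G : (Fin (suc n) → Fin (suc n)) → Carrier} → Extensional G → Extensional (λ g → G (j ◂ (punchIn j ∘ g)))
    ext′ ext e = ext (◂-cong j (λ i → ≡.cong (punchIn j) (e i)))

    tail : ∀ n {G : (Fin (suc n) → Fin (suc n)) → Carrier} j → Alternating (suc n) G → Alternating n (G ∘ (j ◂_))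
    tail zero    j alt = tt
    tail (suc n) j alt = proj₂ (proj₂ alt) j

    alt′ : ∀ {G} → Extensional G → Alternating (suc n) G → Alternating n (λ g → G (j ◂ (punchIn j ∘ g)))
    alt′ {G} ext alt = Alternating-∘ n (punchIn j) (λ e → ext (◂-cong j e)) (tail n {G} j alt)

    e′ : G (j ◂ punchIn j) ≈ H (j ◂ punchIn j)
    e′ = trans (alternating-cycle n extG altG j) (trans (*-congˡ e) (sym (alternating-cycle n extH altH j)))

  -- The sum of (∏ᵣ A r (f r)) G f over all functions f, nested one row at a time so that the
  -- functions need not be enumerated.
  multilinear : ∀ {n m} → ((Fin n → Fin m) → Carrier) → (Fin n → Fin m → Carrier) → Carrier
  multilinear {zero}  G A = G λ ()
  multilinear {suc n} G A = ∑ λ k → A fzero k * multilinear (λ f → G (k ◂ f)) (λ r → A (fsuc r))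

  multilinear-cong : ∀ {n m} {G H : (Fin n → Fin m) → Carrier} A → (∀ f → G f ≈ H f) →
                     multilinear G A ≈ multilinear H A
  multilinear-cong {zero}  A e = e _
  multilinear-cong {suc n} A e = ∑-cong λ k →
    *-congˡ {A fzero k} (multilinear-cong (λ r → A (fsuc r)) λ f → e (k ◂ f))

  multilinear-∑ : ∀ {n m l} (x : Fin l → Carrier) (G : Fin l → (Fin n → Fin m) → Carrier) A →
                    multilinear (λ f → ∑ λ j → x j * G j f) A ≈ ∑ λ j → x j * multilinear (G j) A
  multilinear-∑ {zero}  x G A = refl
  multilinear-∑ {suc n} x G A = begin
    (∑ λ k → A fzero k * multilinear (λ f → ∑ λ j → x j * G j (k ◂ f)) A′)
      ≈⟨ ∑-cong (λ k → *-congˡ {A fzero k} (multilinear-∑ x (λ j f → G j (k ◂ f)) A′)) ⟩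
    (∑ λ k → A fzero k * (∑ λ j → x j * L j k))
      ≈⟨ ∑-cong (λ k → trans (*-distribˡ-∑ (A fzero k) _) (∑-cong λ j → x∙yz≈y∙xz (A fzero k) (x j) (L j k))) ⟩
    (∑ λ k → ∑ λ j → x j * (A fzero k * L j k))
      ≈⟨ ∑-comm _ ⟩
    (∑ λ j → ∑ λ k → x j * (A fzero k * L j k))
      ≈⟨ ∑-cong (λ j → *-distribˡ-∑ (x j) _) ⟨
    (∑ λ j → x j * ∑ λ k → A fzero k * L j k) ∎
    where
    A′ = λ r → A (fsuc r)
    L = λ j k → multilinear (λ f → G j (k ◂ f)) A′

  multilinear-*ʳ : ∀ {n m} (G : (Fin n → Fin m) → Carrier) x A →
                   multilinear (λ f → G f * x) A ≈ multilinear G A * x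
  multilinear-*ʳ {zero}  G x A = refl
  multilinear-*ʳ {suc n} G x A = trans
    (∑-cong λ k → trans (*-congˡ {A fzero k} (multilinear-*ʳ (λ f → G (k ◂ f)) x (λ r → A (fsuc r)))) (sym (*-assoc _ _ _)))
    (sym (*-distribʳ-∑ x _))

  -- Each row of the product is a linear combination of the rows of `B`; the determinant is expanded
  -- in one row after the other.
  Det-multilinear : ∀ {n m} (A : Fin n → Fin m → Carrier) (B : Fin m → Fin n → Carrier) →
    Det (λ r c → ∑ λ k → A r k * B k c) ≈ multilinear (λ f → Det λ r → B (f r)) A
  Det-multilinear {zero}  A B = trans (Det-zero _) (sym (Det-zero _))
  Det-multilinear {suc n} A B = begin
    Det (λ r c → ∑ λ k → A r k * B k c)
      ≈⟨ Det-suc _ ⟩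
    (∑ λ c → sgn c * ((∑ λ k → A fzero k * B k c) * Det λ r c′ → ∑ λ k → A (fsuc r) k * B k (punchIn c c′)))
      ≈⟨ ∑-cong (λ c → *-congˡ {sgn c} (*-congˡ (Det-multilinear A′ λ k c′ → B k (punchIn c c′)))) ⟩
    (∑ λ c → sgn c * ((∑ λ k → A fzero k * B k c) * D c))
      ≈⟨ ∑-cong (λ c → trans (*-congˡ {sgn c} (*-distribʳ-∑ (D c) _)) (trans (*-distribˡ-∑ (sgn c) _)
           (∑-cong λ k → w∙xy∙z≈x∙wy∙z (sgn c) (A fzero k) (B k c) (D c)))) ⟩
    (∑ λ c → ∑ λ k → A fzero k * ((sgn c * B k c) * D c))
      ≈⟨ ∑-comm _ ⟩
    (∑ λ k → ∑ λ c → A fzero k * ((sgn c * B k c) * D c))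
      ≈⟨ ∑-cong (λ k → trans (*-congˡ {A fzero k} (trans
           (multilinear-cong A′ λ f → trans (Det-suc _) (∑-cong λ c → sym (*-assoc (sgn c) (B k c) _)))
           (multilinear-∑ (λ c → sgn c * B k c) (λ c f → Det λ r c′ → B (f r) (punchIn c c′)) A′)))
           (*-distribˡ-∑ (A fzero k) _)) ⟨
    (∑ λ k → A fzero k * multilinear (λ f → Det λ r → B ((k ◂ f) r)) A′) ∎
    where
    A′ = λ r → A (fsuc r)
    D = λ c → multilinear (λ f → Det λ r c′ → B (f r) (punchIn c c′)) A′

  δ : ∀ {n} → Matrix n
  δ fzero    fzero    = 1#
  δ fzero    (fsuc _) = 0#
  δ (fsuc _) fzero    = 0#
  δ (fsuc i) (fsuc j) = δ i j

  ∑-δ : ∀ {n} (x : Fin n → Carrier) j → (∑ λ k → x k * δ k j) ≈ x j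
  ∑-δ x fzero    = trans (∑-suc _) (trans (+-cong (*-identityʳ _) (∑-0 λ k → zeroʳ _)) (+-identityʳ _))
  ∑-δ x (fsuc j) = trans (∑-suc _) (trans (+-cong (zeroʳ _) (∑-δ (x ∘ fsuc) j)) (+-identityˡ _))

  Det-first-row : ∀ {n} (M : Matrix (suc n)) → M fzero fzero ≈ 1# → (∀ c → M fzero (fsuc c) ≈ 0#) →
                  Det M ≈ Det λ r c → M (fsuc r) (fsuc c)
  Det-first-row M e₁ e₀ = trans (trans (Det-suc M) (trans (∑-suc _)
    (+-cong (trans (*-identityˡ _) (trans (*-congʳ e₁) (*-identityˡ _)))
            (∑-0 λ c → trans (*-congˡ (trans (*-congʳ (e₀ c)) (zeroˡ _))) (zeroʳ _)))))
    (+-identityʳ _)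

  Det-lower : ∀ {n} (M : Matrix n) → (∀ r → M r r ≈ 1#) → (∀ r c → toℕ r ℕ.< toℕ c → M r c ≈ 0#) →
              Det M ≈ 1#
  Det-lower {zero}  M e₁ e₀ = Det-zero M
  Det-lower {suc n} M e₁ e₀ = trans
    (Det-first-row M (e₁ fzero) (λ c → e₀ fzero (fsuc c) (s≤s z≤n)))
    (Det-lower _ (e₁ ∘ fsuc) (λ r c r<c → e₀ (fsuc r) (fsuc c) (s≤s r<c)))

  Det-upper : ∀ {n} (M : Matrix n) → (∀ r → M r r ≈ 1#) → (∀ r c → toℕ c ℕ.< toℕ r → M r c ≈ 0#) →
              Det M ≈ 1#
  Det-upper M e₁ e₀ = trans (sym (Det-transpose M)) (Det-lower _ e₁ λ r c → e₀ c r)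

  δ-lower : ∀ {n} (r c : Fin n) → toℕ r ℕ.< toℕ c → δ r c ≈ 0#
  δ-lower fzero    (fsuc c) _         = refl
  δ-lower (fsuc r) (fsuc c) (s≤s r<c) = δ-lower r c r<c

  δ-diagonal : ∀ {n} (r : Fin n) → δ r r ≈ 1#
  δ-diagonal fzero    = refl
  δ-diagonal (fsuc r) = δ-diagonal r

  -- By uniqueness, an alternating function of the choice of rows of `B` is `Det B` times the one
  -- for the identity matrix `δ`. Summed against `A`, the latter gives `Det A`.
  Det-* : ∀ {n} (A B : Matrix n) → Det (λ r c → ∑ λ k → A r k * B k c) ≈ Det A * Det B
  Det-* {n} A B = begin
    Det (λ r c → ∑ λ k → A r k * B k c)
      ≈⟨ Det-multilinear A B ⟩
    multilinear (λ f → Det λ r → B (f r)) A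
      ≈⟨ multilinear-cong A (alternating-unique n (rows-ext B) (λ e → *-congʳ (rows-ext δ e))
           (Det-alternating n B) alt (sym (trans (*-congʳ Det-δ) (*-identityˡ _)))) ⟩
    multilinear (λ f → Det (λ r → δ (f r)) * Det B) A
      ≈⟨ multilinear-*ʳ _ (Det B) A ⟩
    multilinear (λ f → Det λ r → δ (f r)) A * Det B
      ≈⟨ *-congʳ (trans (Det-cong λ r c → sym (∑-δ (A r) c)) (Det-multilinear A δ)) ⟨
    Det A * Det B ∎
    where
    rows-ext : (B : Matrix n) → Extensional (λ f → Det λ r → B (f r))
    rows-ext B e = Det-cong λ r c → reflexive (≡.cong (λ k → B k c) (e r))

    Det-δ : Det (δ {n}) ≈ 1#
    Det-δ = Det-lower δ δ-diagonal δ-lower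

    alt : Alternating n (λ f → Det (λ r → δ (f r)) * Det B)
    -- The multiple by `Det B` is read as a linear combination with a single term.
    alt = Alternating-cong n
      (λ f → trans (*-comm _ _) (sym (trans (∑-suc _) (trans (+-congˡ (∑-zero _)) (+-identityʳ _)))))
      (Alternating-∑ n {1} (λ _ → Det B) λ _ → Det-alternating n δ)

  Det-scale-rows : ∀ {n} (x : Fin n → Carrier) (M : Matrix n) →
                   Det (λ r c → x r * M r c) ≈ ∏ x * Det M
  Det-scale-rows {zero}  x M = trans (Det-zero _) (sym (trans (*-cong (∏-zero x) (Det-zero M)) (*-identityˡ _)))
  Det-scale-rows {suc n} x M = begin
    Det (λ r c → x r * M r c)
      ≈⟨ Det-suc _ ⟩
    (∑ λ j → sgn j * (x fzero * M fzero j * Det λ r c → x (fsuc r) * M (fsuc r) (punchIn j c)))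
      ≈⟨ ∑-cong (λ j → trans
           (*-congˡ {sgn j} (*-congˡ (Det-scale-rows (x ∘ fsuc) λ r c → M (fsuc r) (punchIn j c))))
           (trans (factor-row (sgn j) (x fzero) (M fzero j) (∏ (x ∘ fsuc)) _) (*-congʳ (sym (∏-suc x))))) ⟩
    (∑ λ j → ∏ x * (sgn j * (M fzero j * Det λ r c → M (fsuc r) (punchIn j c))))
      ≈⟨ *-distribˡ-∑ (∏ x) _ ⟨
    ∏ x * (∑ λ j → sgn j * (M fzero j * Det λ r c → M (fsuc r) (punchIn j c)))
      ≈⟨ *-congˡ (Det-suc M) ⟨
    ∏ x * Det M ∎

  Det-scale-columns : ∀ {n} (x : Fin n → Carrier) (M : Matrix n) →
                      Det (λ r c → x c * M r c) ≈ ∏ x * Det M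
  Det-scale-columns x M = trans (sym (Det-transpose λ r c → x c * M r c))
    (trans (Det-scale-rows x λ r c → M c r) (*-congˡ (Det-transpose M)))

-- Cauchy's determinant

module CauchyDeterminant (R : CommutativeRing 0ℓ 0ℓ) where

  open CommutativeRing R hiding (zero)
  open RawSemiringOps (Semiring.rawSemiring semiring) using (_^_)
  open FiniteSums R
  open DeterminantProperties R
  open SemiringIdentities R
  open SetoidReasoning setoid

  -- e u j is the coefficient of sʲ in ∏ₘ (1 - uₘ s).

  e : ∀ {n} → (Fin n → Carrier) → ℕ → Carrier
  e {zero}  u zero    = 1#
  e {zero}  u (suc j) = 0#
  e {suc n} u zero    = e (u ∘ fsuc) zero
  e {suc n} u (suc j) = e (u ∘ fsuc) (suc j) + - u fzero * e (u ∘ fsuc) j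

  e-zero : ∀ {n} (u : Fin n → Carrier) → e u 0 ≈ 1#
  e-zero {zero}  u = refl
  e-zero {suc n} u = e-zero (u ∘ fsuc)

  private
    ev : ∀ {n} → (Fin n → Carrier) → Carrier → ℕ → Carrier
    ev u s d = ∑ {d} λ j → e u (toℕ j) * s ^ toℕ j

    ev-shift : ∀ {n} (u : Fin (suc n) → Carrier) s d →
               ev u s (suc d) ≈ ev (u ∘ fsuc) s (suc d) + - u fzero * s * ev (u ∘ fsuc) s d
    ev-shift u s d = begin
      ev u s (suc d)
        ≈⟨ ∑-suc _ ⟩
      e′ 0 * 1# + (∑ {d} λ j → (e′ (suc (toℕ j)) + - u₀ * e′ (toℕ j)) * (s * s ^ toℕ j))
        ≈⟨ +-congˡ (trans (∑-cong λ j → distrib-shift (e′ (suc (toℕ j))) (- u₀) (e′ (toℕ j)) s (s ^ toℕ j)) (∑-+ _ _)) ⟩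
      e′ 0 * 1# + ((∑ {d} λ j → e′ (suc (toℕ j)) * (s * s ^ toℕ j)) + ∑ {d} λ j → - u₀ * s * (e′ (toℕ j) * s ^ toℕ j))
        ≈⟨ +-assoc _ _ _ ⟨
      e′ 0 * 1# + (∑ {d} λ j → e′ (suc (toℕ j)) * (s * s ^ toℕ j)) + (∑ {d} λ j → - u₀ * s * (e′ (toℕ j) * s ^ toℕ j))
        ≈⟨ +-cong (∑-suc _) (*-distribˡ-∑ _ _) ⟨
      ev (u ∘ fsuc) s (suc d) + - u₀ * s * ev (u ∘ fsuc) s d ∎
      where
      u₀ = u fzero
      e′ = e (u ∘ fsuc)

  -- The number of coefficients is left free above n, since peeling off one factor needs the shorter
  -- product with two different cut-offs.
  e-factorisation : ∀ {n} (u : Fin n → Carrier) s → ∀ d → n ℕ.≤ d →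
    (∑ {suc d} λ j → e u (toℕ j) * s ^ toℕ j) ≈ ∏ λ m → 1# + - u m * s
  e-factorisation {zero}  u s d _ = begin
    ev u s (suc d)
      ≈⟨ ∑-suc _ ⟩
    1# * 1# + (∑ {d} λ j → 0# * (s * s ^ toℕ j))
      ≈⟨ +-cong (*-identityʳ 1#) (∑-0 λ j → zeroˡ _) ⟩
    1# + 0#
      ≈⟨ +-identityʳ 1# ⟩
    1#
      ≈⟨ ∏-zero _ ⟨
    ∏ (λ m → 1# + - u m * s) ∎
  e-factorisation {suc n} u s (suc d) (s≤s n≤d) = begin
    ev u s (suc (suc d))
      ≈⟨ ev-shift u s (suc d) ⟩
    ev (u ∘ fsuc) s (suc (suc d)) + - u fzero * s * ev (u ∘ fsuc) s (suc d)
      ≈⟨ +-cong (e-factorisation (u ∘ fsuc) s (suc d) (ℕ.m≤n⇒m≤1+n n≤d)) (*-congˡ (e-factorisation (u ∘ fsuc) s d n≤d)) ⟩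
    P + - u fzero * s * P
      ≈⟨ trans (distribʳ _ _ _) (+-congʳ (*-identityˡ P)) ⟨
    (1# + - u fzero * s) * P
      ≈⟨ ∏-suc _ ⟨
    ∏ (λ m → 1# + - u m * s) ∎
    where
    P = ∏ λ m → 1# + - u (fsuc m) * s

  -- The definition of `e` peels off the factor of index 0. As the factors commute, any other factor
  -- can be peeled off by the same formula.
  e-remove : ∀ {n} (u : Fin (suc n) → Carrier) i j →
             e u (suc j) ≈ e (u ∘ punchIn i) (suc j) + - u i * e (u ∘ punchIn i) j
  e-remove {n}     u fzero    j = refl
  e-remove {suc n} u (fsuc i) zero = begin
    e u′ 1 + - u₀ * e u′ 0
      ≈⟨ +-cong (e-remove u′ i 0) (*-congˡ (trans (e-zero u′) (sym (e-zero v)))) ⟩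
    (e v 1 + - uᵢ * e v 0) + - u₀ * e v 0
      ≈⟨ xy+z≈xz+y _ _ _ ⟩
    (e v 1 + - u₀ * e v 0) + - uᵢ * e v 0 ∎
    where
    u₀ = u fzero
    uᵢ = u (fsuc i)
    u′ = u ∘ fsuc
    v = u′ ∘ punchIn i
  e-remove {suc n} u (fsuc i) (suc j) = begin
    e u′ (suc (suc j)) + - u₀ * e u′ (suc j)
      ≈⟨ +-cong (e-remove u′ i (suc j)) (*-congˡ (e-remove u′ i j)) ⟩
    (e v (suc (suc j)) + - uᵢ * e v (suc j)) + - u₀ * (e v (suc j) + - uᵢ * e v j)
      ≈⟨ exchange-factors (e v (suc (suc j))) (- uᵢ) (e v (suc j)) (- u₀) (e v j) ⟩
    (e v (suc (suc j)) + - u₀ * e v (suc j)) + - uᵢ * (e v (suc j) + - u₀ * e v j) ∎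
    where
    u₀ = u fzero
    uᵢ = u (fsuc i)
    u′ = u ∘ fsuc
    v = u′ ∘ punchIn i

  -- The coefficient of sʲ in sᵐ ∏ₗ (1 - uₗ s). With `m` as row index and `j` as column index this
  -- is an upper unitriangular matrix.
  shifted-e : ∀ {n} → (Fin n → Carrier) → ℕ → ℕ → Carrier
  shifted-e u zero    j       = e u j
  shifted-e u (suc m) zero    = 0#
  shifted-e u (suc m) (suc j) = shifted-e u m j

  shifted-e-diagonal : ∀ {n} (u : Fin n → Carrier) m → shifted-e u m m ≈ 1#
  shifted-e-diagonal u zero    = e-zero u
  shifted-e-diagonal u (suc m) = shifted-e-diagonal u m

  shifted-e-lower : ∀ {n} (u : Fin n → Carrier) {m j} → j ℕ.< m → shifted-e u m j ≈ 0#
  shifted-e-lower u {suc m} {zero}  _         = refl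
  shifted-e-lower u {suc m} {suc j} (s≤s j<m) = shifted-e-lower u j<m

  -- Multiplying ∏ₘ (1 - uₘ s) by the geometric series of uᵢ s cancels the i-th factor.

  e-geometric : ∀ {n} (u : Fin (suc n) → Carrier) i d j → j ℕ.< d →
                (∑ {d} λ m → u i ^ toℕ m * shifted-e u (toℕ m) j) ≈ e (u ∘ punchIn i) j
  e-geometric u i (suc d) zero _ = begin
    (∑ {suc d} λ m → u i ^ toℕ m * shifted-e u (toℕ m) 0)
      ≈⟨ ∑-suc _ ⟩
    1# * e u 0 + (∑ {d} λ m → u i ^ suc (toℕ m) * 0#)
      ≈⟨ +-cong (*-identityˡ _) (∑-0 λ m → zeroʳ _) ⟩
    e u 0 + 0#
      ≈⟨ +-identityʳ _ ⟩
    e u 0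
      ≈⟨ trans (e-zero u) (sym (e-zero (u ∘ punchIn i))) ⟩
    e (u ∘ punchIn i) 0 ∎
  e-geometric u i (suc d) (suc j) (s≤s j<d) = begin
    (∑ {suc d} λ m → u i ^ toℕ m * shifted-e u (toℕ m) (suc j))
      ≈⟨ ∑-suc _ ⟩
    1# * e u (suc j) + (∑ {d} λ m → (u i * u i ^ toℕ m) * shifted-e u (toℕ m) j)
      ≈⟨ +-cong (*-identityˡ _) (trans (∑-cong λ m → *-assoc _ _ _) (sym (*-distribˡ-∑ (u i) _))) ⟩
    e u (suc j) + u i * (∑ {d} λ m → u i ^ toℕ m * shifted-e u (toℕ m) j)
      ≈⟨ +-cong (e-remove u i j) (*-congˡ (e-geometric u i d j j<d)) ⟩
    (e v (suc j) + - u i * e v j) + u i * e v j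
      ≈⟨ +-assoc _ _ _ ⟩
    e v (suc j) + (- u i * e v j + u i * e v j)
      ≈⟨ +-congˡ (trans (sym (distribʳ _ _ _)) (trans (*-congʳ (-‿inverseˡ _)) (zeroˡ _))) ⟩
    e v (suc j) + 0#
      ≈⟨ +-identityʳ _ ⟩
    e v (suc j) ∎
    where
    v = u ∘ punchIn i

  -- Cauchy's determinant: c i k is ∏ₘ c m k times the polynomial ∏_{m≠i} (1 - uₘ s)
  -- at s = t k, whose coefficients are the i-th row of (u i ʲ) times a unitriangular matrix.

  cauchy : ∀ {d} (u t : Fin d → Carrier) (c : Matrix d) → (∀ i k → (1# + - u i * t k) * c i k ≈ 1#) →
    Det c ≈ ∏ (λ k → ∏ λ i → c i k) * (Det (λ i j → u i ^ toℕ j) * Det (λ j k → t k ^ toℕ j))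
  cauchy {zero} u t c inv = trans (Det-zero c) (sym (trans
    (*-cong (∏-zero _) (trans (*-cong (Det-zero _) (Det-zero _)) (*-identityˡ 1#))) (*-identityˡ 1#)))
  cauchy {d@(suc n)} u t c inv = begin
    Det c
      ≈⟨ Det-cong c≈ ⟩
    Det (λ i k → Z k * ∑ λ j → (∑ λ m → U i m * E m j) * T j k)
      ≈⟨ Det-scale-columns Z _ ⟩
    ∏ Z * Det (λ i k → ∑ λ j → (∑ λ m → U i m * E m j) * T j k)
      ≈⟨ *-congˡ (trans (Det-* _ T) (*-congʳ (Det-* U E))) ⟩
    ∏ Z * (Det U * Det E * Det T)
      ≈⟨ *-congˡ (*-congʳ (trans (*-congˡ (Det-upper E (λ r → shifted-e-diagonal u (toℕ r)) (λ r k → shifted-e-lower u))) (*-identityʳ _))) ⟩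
    ∏ Z * (Det U * Det T) ∎
    where
    U E T : Matrix d
    U i j = u i ^ toℕ j
    E m j = shifted-e u (toℕ m) (toℕ j)
    T j k = t k ^ toℕ j

    Z : Fin d → Carrier
    Z k = ∏ λ i → c i k

    c≈ : ∀ i k → c i k ≈ Z k * ∑ λ j → (∑ λ m → U i m * E m j) * T j k
    c≈ i k = sym (begin
      Z k * (∑ λ j → (∑ λ m → U i m * E m j) * T j k)
        ≈⟨ *-cong (∏-remove i _) (∑-cong λ j → *-congʳ (e-geometric u i d (toℕ j) (toℕ<n j))) ⟩
      c i k * rest * (∑ λ j → e (u ∘ punchIn i) (toℕ j) * t k ^ toℕ j)
        ≈⟨ *-congˡ (e-factorisation (u ∘ punchIn i) (t k) n ℕ.≤-refl) ⟩
      c i k * rest * (∏ λ m → 1# + - u (punchIn i m) * t k)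
        ≈⟨ *-assoc _ _ _ ⟩
      c i k * (rest * ∏ λ m → 1# + - u (punchIn i m) * t k)
        ≈⟨ *-congˡ (trans (*-comm _ _) (sym (∏-* _ _))) ⟩
      c i k * (∏ λ m → (1# + - u (punchIn i m) * t k) * c (punchIn i m) k)
        ≈⟨ *-congˡ (trans (∏-cong λ m → inv (punchIn i m) k) (∏-1 n)) ⟩
      c i k * 1#
        ≈⟨ *-identityʳ _ ⟩
      c i k ∎)
      where
      rest = ∏ λ m → c (punchIn i m) k

-- Rational scalars and the weights of the exponential series

fromℕ : ℕ → ℚ
fromℕ n = + n ℚ./ 1

private

  toℚᵘ-/ : ∀ a b → ℚ.toℚᵘ (+ a ℚ./ suc b) ℚᵘ.≃ mkℚᵘ (+ a) b
  toℚᵘ-/ a b = ℚ.toℚᵘ-fromℚᵘ (mkℚᵘ (+ a) b)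

  module ≃-Reasoning = SetoidReasoning ℚᵘ.≃-setoid

-- Passing to unnormalised fractions turns an equation between reduced fractions into one between
-- natural numbers.
/-*-/ : ∀ a b c d e f .{{_ : ℕ.NonZero b}} .{{_ : ℕ.NonZero d}} .{{_ : ℕ.NonZero f}} →
        a ℕ.* c ℕ.* f ≡ e ℕ.* (b ℕ.* d) → (+ a ℚ./ b) ℚ.* (+ c ℚ./ d) ≡ + e ℚ./ f
/-*-/ a (suc b) c (suc d) e (suc f) eq = ℚ.toℚᵘ-injective (begin
  ℚ.toℚᵘ ((+ a ℚ./ suc b) ℚ.* (+ c ℚ./ suc d))
    ≈⟨ ℚ.toℚᵘ-homo-* (+ a ℚ./ suc b) (+ c ℚ./ suc d) ⟩
  ℚ.toℚᵘ (+ a ℚ./ suc b) ℚᵘ.* ℚ.toℚᵘ (+ c ℚ./ suc d)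
    ≈⟨ ℚᵘ.*-cong (toℚᵘ-/ a b) (toℚᵘ-/ c d) ⟩
  mkℚᵘ (+ a) b ℚᵘ.* mkℚᵘ (+ c) d
    ≈⟨ *≡* (≡.trans (≡.cong (ℤ._* + suc f) (≡.sym (ℤ.pos-* a c)))
         (≡.trans (≡.sym (ℤ.pos-* (a ℕ.* c) (suc f))) (≡.trans (≡.cong +_ eq) (ℤ.pos-* e _)))) ⟩
  mkℚᵘ (+ e) f
    ≈⟨ toℚᵘ-/ e f ⟨
  ℚ.toℚᵘ (+ e ℚ./ suc f) ∎)
  where open ≃-Reasoning

fromℕ-+ : ∀ m n → fromℕ (m ℕ.+ n) ≡ fromℕ m ℚ.+ fromℕ n
fromℕ-+ m n = ℚ.toℚᵘ-injective (begin
  ℚ.toℚᵘ (fromℕ (m ℕ.+ n))            ≈⟨ toℚᵘ-/ (m ℕ.+ n) 0 ⟩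
  mkℚᵘ (+ (m ℕ.+ n)) 0                ≈⟨ *≡* (≡.cong (ℤ._* + 1) (≡.sym (≡.cong₂ ℤ._+_ (ℤ.*-identityʳ (+ m)) (ℤ.*-identityʳ (+ n))))) ⟩
  mkℚᵘ (+ m) 0 ℚᵘ.+ mkℚᵘ (+ n) 0      ≈⟨ ℚᵘ.+-cong (toℚᵘ-/ m 0) (toℚᵘ-/ n 0) ⟨
  ℚ.toℚᵘ (fromℕ m) ℚᵘ.+ ℚ.toℚᵘ (fromℕ n)  ≈⟨ ℚ.toℚᵘ-homo-+ (fromℕ m) (fromℕ n) ⟨
  ℚ.toℚᵘ (fromℕ m ℚ.+ fromℕ n)        ∎)
  where open ≃-Reasoning

reciprocal : ℕ → ℚ
reciprocal n = + 1 ℚ./ suc n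

reciprocal-inverse : ∀ n → reciprocal n ℚ.* fromℕ (suc n) ≡ 1ℚ
reciprocal-inverse n = /-*-/ 1 (suc n) (suc n) 1 1 1 (cross n)
  where
  cross : ∀ n → 1 ℕ.* suc n ℕ.* 1 ≡ 1 ℕ.* (suc n ℕ.* 1)
  cross = solve-∀

-- Unfolds to the same fraction as `weight` in `Delta`, but depends neither on an algebra nor on
-- operators.
exp-weight : ℕ → ℕ → ℚ
exp-weight k i = (+ (k ℕ.^ i)) ℚ./ (i ℕ.!)
  where instance _ = i ℕ.!≢0

-- The differential equation of y ↦ exp (k y), read off coefficient by coefficient.
exp-weight-suc : ∀ k i → exp-weight k (suc i) ℚ.* fromℕ (suc i) ≡ exp-weight k i ℚ.* fromℕ k
exp-weight-suc k i = ≡.trans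
  (/-*-/ (k ℕ.* k ℕ.^ i) (suc i ℕ.!) (suc i) 1 (k ℕ.^ i ℕ.* k) (i ℕ.!) (cross k (k ℕ.^ i) i (i ℕ.!)))
  (≡.sym (/-*-/ (k ℕ.^ i) (i ℕ.!) k 1 (k ℕ.^ i ℕ.* k) (i ℕ.!) (≡.cong (k ℕ.^ i ℕ.* k ℕ.*_) (≡.sym (ℕ.*-identityʳ (i ℕ.!))))))
  where
  instance
    _ = i ℕ.!≢0
    _ = suc i ℕ.!≢0
  cross : ∀ k p i q → k ℕ.* p ℕ.* suc i ℕ.* q ≡ p ℕ.* k ℕ.* (suc i ℕ.* q ℕ.* 1)
  cross = solve-∀

module Scalars (A : ℚ-Algebra) where

  open ℚ-Algebra A
  open SetoidReasoning setoid

  ⟨_⟩ : ℕ → Carrier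
  ⟨ n ⟩ = ι (fromℕ n)

  ι-* : ∀ {c d e} → c ℚ.* d ≡ e → ι c * ι d ≈ ι e
  ι-* {c} {d} eq = trans (sym (ι.*-homo c d)) (ι.⟦⟧-cong eq)

  ⟨0⟩≈0 : ⟨ 0 ⟩ ≈ 0#
  ⟨0⟩≈0 = ι.0#-homo

  ⟨1⟩≈1 : ⟨ 1 ⟩ ≈ 1#
  ⟨1⟩≈1 = ι.1#-homo

  ⟨+⟩ : ∀ m n → ⟨ m ℕ.+ n ⟩ ≈ ⟨ m ⟩ + ⟨ n ⟩
  ⟨+⟩ m n = trans (ι.⟦⟧-cong (fromℕ-+ m n)) (ι.+-homo (fromℕ m) (fromℕ n))

  ⟨suc⟩ : ∀ n x → ⟨ suc n ⟩ * x ≈ x + ⟨ n ⟩ * x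
  ⟨suc⟩ n x = trans (*-congʳ (trans (⟨+⟩ 1 n) (+-congʳ ⟨1⟩≈1)))
                (trans (distribʳ x 1# ⟨ n ⟩) (+-congʳ (*-identityˡ x)))

  divide : ∀ n {x y} → ⟨ suc n ⟩ * x ≈ y → x ≈ ι (reciprocal n) * y
  divide n {x} {y} e = begin
    x                                      ≈⟨ *-identityˡ x ⟨
    1# * x                                 ≈⟨ *-congʳ (trans (ι-* (reciprocal-inverse n)) ι.1#-homo) ⟨
    ι (reciprocal n) * ⟨ suc n ⟩ * x       ≈⟨ *-assoc _ _ _ ⟩
    ι (reciprocal n) * (⟨ suc n ⟩ * x)     ≈⟨ *-congˡ e ⟩
    ι (reciprocal n) * y                   ∎

  torsion-free : ∀ n {x} → ⟨ suc n ⟩ * x ≈ 0# → x ≈ 0#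
  torsion-free n e = trans (divide n e) (zeroʳ _)

-- Derivations, and the action of Δ on their joint eigenvectors

record IsDerivation (A : ℚ-Algebra) (D : ℚ-Algebra.Carrier A → ℚ-Algebra.Carrier A) : Set where
  open ℚ-Algebra A
  field
    D-cong : ∀ {x y} → x ≈ y → D x ≈ D y
    D-+    : ∀ x y → D (x + y) ≈ D x + D y
    D-ι*   : ∀ c x → D (ι c * x) ≈ ι c * D x
    D-*    : ∀ x y → D (x * y) ≈ D x * y + x * D y

module DerivationProperties (A : ℚ-Algebra) {D : ℚ-Algebra.Carrier A → ℚ-Algebra.Carrier A}
                            (isDerivation : IsDerivation A D) where
  open ℚ-Algebra A hiding (zero)
  open IsDerivation isDerivation public
  open FiniteSums commutativeRing
  open Scalars A
  open RawSemiringOps (Semiring.rawSemiring semiring) using (_^_)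
  open RingProperties ring using (x+x≈x⇒x≈0)
  open SetoidReasoning setoid

  D-0 : D 0# ≈ 0#
  D-0 = x+x≈x⇒x≈0 _ (trans (sym (D-+ 0# 0#)) (D-cong (+-identityˡ 0#)))

  D-1 : D 1# ≈ 0#
  D-1 = x+x≈x⇒x≈0 _ (sym (begin
    D 1#                  ≈⟨ D-cong (*-identityˡ 1#) ⟨
    D (1# * 1#)           ≈⟨ D-* 1# 1# ⟩
    D 1# * 1# + 1# * D 1# ≈⟨ +-cong (*-identityʳ _) (*-identityˡ _) ⟩
    D 1# + D 1#           ∎))

  D-ι : ∀ c → D (ι c) ≈ 0#
  D-ι c = begin
    D (ι c)       ≈⟨ D-cong (*-identityʳ (ι c)) ⟨
    D (ι c * 1#)  ≈⟨ D-ι* c 1# ⟩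
    ι c * D 1#    ≈⟨ trans (*-congˡ D-1) (zeroʳ _) ⟩
    0#            ∎

  D-neg : ∀ x → D (- x) ≈ - D x
  D-neg x = uniqueness (trans (sym (D-+ x (- x))) (trans (D-cong (-‿inverseʳ x)) D-0))
    where
    uniqueness : D x + D (- x) ≈ 0# → D (- x) ≈ - D x
    uniqueness = RingProperties.+-inverseʳ-unique ring (D x) (D (- x))

  D-∑ : ∀ {n} (f : Fin n → Carrier) → D (∑ f) ≈ ∑ (λ i → D (f i))
  D-∑ {zero}  f = trans (D-cong (∑-zero f)) (trans D-0 (sym (∑-zero _)))
  D-∑ {suc n} f = begin
    D (∑ f)                              ≈⟨ D-cong (∑-suc f) ⟩
    D (f fzero + ∑ (f ∘ fsuc))           ≈⟨ D-+ _ _ ⟩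
    D (f fzero) + D (∑ (f ∘ fsuc))       ≈⟨ +-congˡ (D-∑ (f ∘ fsuc)) ⟩
    D (f fzero) + ∑ (D ∘ f ∘ fsuc)       ≈⟨ ∑-suc _ ⟨
    ∑ (D ∘ f)                            ∎

  D-eigen-* : ∀ {x y v w} → D x ≈ v * x → D y ≈ w * y → D (x * y) ≈ (v + w) * (x * y)
  D-eigen-* {x} {y} {v} {w} ex ey = begin
    D (x * y)                  ≈⟨ D-* x y ⟩
    D x * y + x * D y          ≈⟨ +-cong (*-congʳ ex) (*-congˡ ey) ⟩
    v * x * y + x * (w * y)    ≈⟨ +-cong (*-assoc _ _ _) (CommSemigroupProperties.x∙yz≈y∙xz *-commutativeSemigroup x w y) ⟩
    v * (x * y) + w * (x * y)  ≈⟨ distribʳ _ _ _ ⟨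
    (v + w) * (x * y)          ∎

  D-eigen-1 : D 1# ≈ 0# * 1#
  D-eigen-1 = trans D-1 (sym (zeroˡ 1#))

  D-eigen-∏ : ∀ {n} {x w : Fin n → Carrier} → (∀ i → D (x i) ≈ w i * x i) → D (∏ x) ≈ ∑ w * ∏ x
  D-eigen-∏ {zero}  {x} {w} e = trans (D-cong (∏-zero x))
    (trans D-eigen-1 (sym (*-cong (∑-zero w) (∏-zero x))))
  D-eigen-∏ {suc n} {x} {w} e = trans (D-cong (∏-suc x))
    (trans (D-eigen-* (e fzero) (D-eigen-∏ (e ∘ fsuc))) (sym (*-cong (∑-suc w) (∏-suc x))))

  D-eigen-^ : ∀ {x w} → D x ≈ w * x → ∀ n → D (x ^ n) ≈ ⟨ n ⟩ * w * x ^ n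
  D-eigen-^ {x} {w} e zero    = trans D-1 (sym (trans (*-identityʳ _) (trans (*-congʳ ⟨0⟩≈0) (zeroˡ w))))
  D-eigen-^ {x} {w} e (suc n) = trans (D-eigen-* e (D-eigen-^ e n)) (*-congʳ (sym (⟨suc⟩ n w)))

-- On a joint eigenvector Y of all derivations, with eigenvalues that they
-- annihilate, Δ is multiplication by truncated exponentials.

module DeltaOnEigenvectors
  (A : ℚ-Algebra) (D D̃ : ℕ → ℚ-Algebra.Carrier A → ℚ-Algebra.Carrier A)
  (isD : ∀ n → IsDerivation A (D n)) (isD̃ : ∀ n → IsDerivation A (D̃ n))
  where
  open ℚ-Algebra A hiding (zero)
  open Delta A D D̃
  open FiniteSums commutativeRing
  open Scalars A
  open DeterminantProperties commutativeRing using (Det; Det-zero; Det-suc)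
  open SemiringIdentities commutativeRing using (x∙yz≈y∙xz)
  open RingProperties ring using (-0#≈0#)
  open RawSemiringOps (Semiring.rawSemiring semiring) using (_^_)
  open SetoidReasoning setoid
  private
    module D n = DerivationProperties A (isD n)
    module D̃ n = DerivationProperties A (isD̃ n)

  Constant : Carrier → Set
  Constant x = ∀ n → D n x ≈ 0# × D̃ n x ≈ 0#

  private
    kill-+ : ∀ {x y} → x ≈ 0# → y ≈ 0# → x + y ≈ 0#
    kill-+ e f = trans (+-cong e f) (+-identityˡ 0#)

    kill-leibniz : ∀ {E} → IsDerivation A E → ∀ {x y} → E x ≈ 0# → E y ≈ 0# → E (x * y) ≈ 0#
    kill-leibniz isE {x} {y} e f = trans (IsDerivation.D-* isE x y)
      (kill-+ (trans (*-congʳ e) (zeroˡ y)) (trans (*-congˡ f) (zeroʳ x)))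

  constant-1 : Constant 1#
  constant-1 n = D.D-1 n , D̃.D-1 n

  constant-ι : ∀ c → Constant (ι c)
  constant-ι c n = D.D-ι n c , D̃.D-ι n c

  constant-* : ∀ {x y} → Constant x → Constant y → Constant (x * y)
  constant-* cx cy n = kill-leibniz (isD n) (proj₁ (cx n)) (proj₁ (cy n)) ,
                       kill-leibniz (isD̃ n) (proj₂ (cx n)) (proj₂ (cy n))

  constant-∑ : ∀ {m} {f : Fin m → Carrier} → (∀ i → Constant (f i)) → Constant (∑ f)
  constant-∑ c n = trans (D.D-∑ n _) (∑-0 λ i → proj₁ (c i n)) , trans (D̃.D-∑ n _) (∑-0 λ i → proj₂ (c i n))

  constant-^ : ∀ {x} → Constant x → ∀ m → Constant (x ^ m)
  constant-^ c zero    = constant-1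
  constant-^ c (suc m) = constant-* c (constant-^ c m)

  constant-neg : ∀ {x} → Constant x → Constant (- x)
  constant-neg c n = trans (D.D-neg n _) (trans (-‿cong (proj₁ (c n))) -0#≈0#) ,
                     trans (D̃.D-neg n _) (trans (-‿cong (proj₂ (c n))) -0#≈0#)

  constant-cong : ∀ {x y} → x ≈ y → Constant y → Constant x
  constant-cong e c n = trans (D.D-cong n e) (proj₁ (c n)) , trans (D̃.D-cong n e) (proj₂ (c n))

  constant-Det : ∀ {m} {M : Fin m → Fin m → Carrier} → (∀ r k → Constant (M r k)) → Constant (Det M)
  constant-Det {zero}  c = constant-cong (Det-zero _) constant-1
  constant-Det {suc m} c = constant-cong (Det-suc _) (constant-∑ λ j → constant-*
    (constant-^ (constant-neg constant-1) (toℕ j))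
    (constant-* (c fzero j) (constant-Det λ r k → c (fsuc r) (punchIn j k))))

  iterate-cong : ∀ n i {f g} → f ≈ g → iterate (D n ∘ D̃ n) f i ≈ iterate (D n ∘ D̃ n) g i
  iterate-cong n zero    e = e
  iterate-cong n (suc i) e = iterate-cong n i (D.D-cong n (D̃.D-cong n e))

  factor-cong : ∀ I n {f g} → f ≈ g → factor I n f ≈ factor I n g
  factor-cong I n {f} {g} e = trans (sym (∑≈sum {I} _))
    (trans (∑-cong λ i → *-congˡ (iterate-cong n (toℕ i) e)) (∑≈sum {I} _))

  truncated-cong : ∀ K I {f g} → f ≈ g → truncated K I f ≈ truncated K I g
  truncated-cong zero    I e = e
  truncated-cong (suc K) I e = truncated-cong K I (factor-cong I K e)

  module _ (Y : Carrier) (a ã : ℕ → Carrier)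
           (D-Y : ∀ n → D n Y ≈ a n * Y) (D̃-Y : ∀ n → D̃ n Y ≈ ã n * Y)
           (constant-a : ∀ n → Constant (a n)) (constant-ã : ∀ n → Constant (ã n)) where

    private
      y : ℕ → Carrier
      y n = a n * ã n

      pull : ∀ {E} → IsDerivation A E → ∀ {w b} → E w ≈ 0# → E Y ≈ b * Y → E (w * Y) ≈ w * b * Y
      pull {E} isE {w} {b} ew eY = begin
        E (w * Y)            ≈⟨ IsDerivation.D-* isE w Y ⟩
        E w * Y + w * E Y    ≈⟨ +-cong (trans (*-congʳ ew) (zeroˡ Y)) (*-congˡ eY) ⟩
        0# + w * (b * Y)     ≈⟨ trans (+-identityˡ _) (sym (*-assoc _ _ _)) ⟩
        w * b * Y            ∎

      constant-y : ∀ n → Constant (y n)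
      constant-y n = constant-* (constant-a n) (constant-ã n)

    -- The constant `w` is carried along for the induction: `iterate` applies the operator to its
    -- argument first, so the eigenvalues gather there.
    iterate-eigenvector : ∀ n i {w} → Constant w → iterate (D n ∘ D̃ n) (w * Y) i ≈ y n ^ i * (w * Y)
    iterate-eigenvector n zero    {w} c = sym (*-identityˡ _)
    iterate-eigenvector n (suc i) {w} c = begin
      iterate (D n ∘ D̃ n) (D n (D̃ n (w * Y))) i
        ≈⟨ iterate-cong n i (trans (D.D-cong n (pull (isD̃ n) (proj₂ (c n)) (D̃-Y n)))
             (pull (isD n) (proj₁ (constant-* c (constant-ã n) n)) (D-Y n))) ⟩
      iterate (D n ∘ D̃ n) (w * ã n * a n * Y) i
        ≈⟨ iterate-eigenvector n i (constant-* (constant-* c (constant-ã n)) (constant-a n)) ⟩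
      y n ^ i * (w * ã n * a n * Y)
        ≈⟨ *-congˡ (*-congʳ (trans (*-assoc _ _ _) (trans (*-comm _ _) (*-congʳ (*-comm _ _))))) ⟩
      y n ^ i * (y n * w * Y)
        ≈⟨ *-congˡ (*-assoc _ _ _) ⟩
      y n ^ i * (y n * (w * Y))
        ≈⟨ trans (x∙yz≈y∙xz _ _ _) (sym (*-assoc _ _ _)) ⟩
      y n ^ suc i * (w * Y) ∎

    truncatedExp : ℕ → ℕ → Carrier
    truncatedExp I n = ∑ {I} λ i → ι (exp-weight (suc n) (toℕ i)) * y n ^ toℕ i

    factor-eigenvector : ∀ I n {w} → Constant w → factor I n (w * Y) ≈ truncatedExp I n * w * Y
    factor-eigenvector I n {w} c = begin
      factor I n (w * Y)
        ≈⟨ ∑≈sum {I} _ ⟨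
      (∑ {I} λ i → ι (exp-weight (suc n) (toℕ i)) * iterate (D n ∘ D̃ n) (w * Y) (toℕ i))
        ≈⟨ ∑-cong (λ i → trans (*-congˡ (iterate-eigenvector n (toℕ i) c)) (sym (*-assoc _ _ _))) ⟩
      (∑ {I} λ i → ι (exp-weight (suc n) (toℕ i)) * y n ^ toℕ i * (w * Y))
        ≈⟨ *-distribʳ-∑ (w * Y) _ ⟨
      truncatedExp I n * (w * Y)
        ≈⟨ *-assoc _ _ _ ⟨
      truncatedExp I n * w * Y ∎

    expProduct : ℕ → ℕ → Carrier
    expProduct zero    I = 1#
    expProduct (suc K) I = expProduct K I * truncatedExp I K

    -- Every factor of the cut-off product turns `w * Y` into another constant multiple of `Y`; this
    -- is why `w` is arbitrary.
    truncated-eigenvector : ∀ K I {w} → Constant w → truncated K I (w * Y) ≈ expProduct K I * (w * Y)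
    truncated-eigenvector zero    I c     = sym (*-identityˡ _)
    truncated-eigenvector (suc K) I {w} c = begin
      truncated K I (factor I K (w * Y))
        ≈⟨ truncated-cong K I (factor-eigenvector I K c) ⟩
      truncated K I (truncatedExp I K * w * Y)
        ≈⟨ truncated-eigenvector K I (constant-* (constant-∑ λ i → constant-* (constant-ι _) (constant-^ (constant-y K) (toℕ i))) c) ⟩
      expProduct K I * (truncatedExp I K * w * Y)
        ≈⟨ trans (*-congˡ (*-assoc _ _ _)) (sym (*-assoc _ _ _)) ⟩
      expProduct K I * truncatedExp I K * (w * Y) ∎

-- Orders of power series and logarithmic derivatives

-- What is needed of the order of a series in the uᵢ and of the Euler derivation θ = ∑ uᵢ ∂/∂uᵢ.
-- `Order-θ` reflects that θ multiplies the part of degree m + 1 by m + 1, which is invertible over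
-- ℚ; it begins in degree 1 because θ kills degree 0.
record Filtration (A : ℚ-Algebra) : Set₁ where
  open ℚ-Algebra A
  field
    Order≥      : ℕ → Carrier → Set
    Order-cong  : ∀ {m x y} → x ≈ y → Order≥ m x → Order≥ m y
    Order-0#    : ∀ m → Order≥ m 0#
    Order-+     : ∀ {m x y} → Order≥ m x → Order≥ m y → Order≥ m (x + y)
    Order-*     : ∀ {m n x y} → Order≥ m x → Order≥ n y → Order≥ (m ℕ.+ n) (x * y)
    Order-any   : ∀ x → Order≥ 0 x
    Order-mono  : ∀ {m n x} → m ℕ.≤ n → Order≥ n x → Order≥ m x
    θ           : Carrier → Carrier
    θ-isDerivation : IsDerivation A θ
    Order-θ     : ∀ {m x} → Order≥ (suc m) x → Order≥ (suc (suc m)) (θ x) → Order≥ (suc (suc m)) x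

module FiltrationProperties (A : ℚ-Algebra) (filtration : Filtration A) where
  open ℚ-Algebra A hiding (zero)
  open Filtration filtration
  open DerivationProperties A θ-isDerivation
  open FiniteSums commutativeRing
  open Scalars A
  open SemiringIdentities commutativeRing
  open RawSemiringOps (Semiring.rawSemiring semiring) using (_^_)
  open RingProperties ring using (-1*x≈-x; -‿distribˡ-*; -‿distribʳ-*; -‿+-comm; -‿involutive)
  open SetoidReasoning setoid

  Order-neg : ∀ {m x} → Order≥ m x → Order≥ m (- x)
  Order-neg o = Order-cong (-1*x≈-x _) (Order-* (Order-any (- 1#)) o)

  Order-*ˡ : ∀ {m x} y → Order≥ m x → Order≥ m (y * x)
  Order-*ˡ y o = Order-* (Order-any y) o

  Order-∑ : ∀ {n m} {f : Fin n → Carrier} → (∀ i → Order≥ m (f i)) → Order≥ m (∑ f)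
  Order-∑ {zero}  o = Order-cong (sym (∑-zero _)) (Order-0# _)
  Order-∑ {suc n} o = Order-cong (sym (∑-suc _)) (Order-+ (o fzero) (Order-∑ (o ∘ fsuc)))

  Order-^ : ∀ {x} → Order≥ 1 x → ∀ n → Order≥ n (x ^ n)
  Order-^ o zero    = Order-any 1#
  Order-^ o (suc n) = Order-* o (Order-^ o n)

  infix 4 _≈[_]_
  _≈[_]_ : Carrier → ℕ → Carrier → Set
  x ≈[ m ] y = Order≥ m (x + - y)

  ≈⇒≈[] : ∀ {m x y} → x ≈ y → x ≈[ m ] y
  ≈⇒≈[] {m} {x} {y} e = Order-cong (sym (trans (+-congʳ e) (-‿inverseʳ y))) (Order-0# m)

  ≈[]-sym : ∀ {m x y} → x ≈[ m ] y → y ≈[ m ] x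
  ≈[]-sym {m} {x} {y} o = Order-cong
    (trans (sym (-‿+-comm x (- y))) (trans (+-congˡ (-‿involutive y)) (+-comm (- x) y))) (Order-neg o)

  ≈[]-trans : ∀ {m x y z} → x ≈[ m ] y → y ≈[ m ] z → x ≈[ m ] z
  ≈[]-trans {m} {x} {y} {z} o p = Order-cong (begin
    (x + - y) + (y + - z)  ≈⟨ +-assoc _ _ _ ⟩
    x + (- y + (y + - z))  ≈⟨ +-congˡ (trans (sym (+-assoc _ _ _)) (trans (+-congʳ (-‿inverseˡ y)) (+-identityˡ _))) ⟩
    x + - z                ∎) (Order-+ o p)

  ≈[]-+ : ∀ {m x x′ y y′} → x ≈[ m ] x′ → y ≈[ m ] y′ → x + y ≈[ m ] x′ + y′
  ≈[]-+ {m} {x} {x′} {y} {y′} o p = Order-cong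
    (trans (CommSemigroupProperties.interchange +-commutativeSemigroup x (- x′) y (- y′)) (+-congˡ (-‿+-comm x′ y′)))
    (Order-+ o p)

  ≈[]-*ˡ : ∀ {m} z {x y} → x ≈[ m ] y → z * x ≈[ m ] z * y
  ≈[]-*ˡ z {x} {y} o = Order-cong (trans (distribˡ z x (- y)) (+-congˡ (sym (-‿distribʳ-* z y)))) (Order-*ˡ z o)

  ≈[]-* : ∀ {m x x′ y y′} → x ≈[ m ] x′ → y ≈[ m ] y′ → x * y ≈[ m ] x′ * y′
  ≈[]-* {m} {x} {x′} {y} {y′} o p = ≈[]-trans (≈[]-*ˡ x p)
    (≈[]-trans (≈⇒≈[] (*-comm x y′)) (≈[]-trans (≈[]-*ˡ y′ o) (≈⇒≈[] (*-comm y′ x′))))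

  LogDerivative : ℕ → Carrier → Carrier → Set
  LogDerivative m w x = θ x ≈[ m ] w * x

  logDerivative-* : ∀ {m v w x y} → LogDerivative m v x → LogDerivative m w y → LogDerivative m (v + w) (x * y)
  logDerivative-* {m} {v} {w} {x} {y} lx ly = ≈[]-trans (≈⇒≈[] (trans (D-* x y) (+-congˡ (*-comm x (θ y)))))
    (≈[]-trans (≈[]-+ (≈[]-* lx (≈⇒≈[] refl)) (≈[]-* ly (≈⇒≈[] refl)))
      (≈⇒≈[] (trans (+-cong (*-assoc v x y) (trans (*-assoc w y x) (*-congˡ (*-comm y x)))) (sym (distribʳ (x * y) v w)))))

  logDerivative-1 : ∀ {m} → LogDerivative m 0# 1#
  logDerivative-1 = ≈⇒≈[] D-eigen-1

  logDerivative-∏ : ∀ {n m} {w x : Fin n → Carrier} → (∀ i → LogDerivative m (w i) (x i)) → LogDerivative m (∑ w) (∏ x)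
  logDerivative-∏ {zero}  {w = w} {x} l = ≈[]-trans (≈⇒≈[] (D-cong (∏-zero x)))
    (≈[]-trans logDerivative-1 (≈⇒≈[] (sym (*-cong (∑-zero w) (∏-zero x)))))
  logDerivative-∏ {suc n} {w = w} {x} l = ≈[]-trans (≈⇒≈[] (D-cong (∏-suc x)))
    (≈[]-trans (logDerivative-* (l fzero) (logDerivative-∏ (l ∘ fsuc))) (≈⇒≈[] (sym (*-cong (∑-suc w) (∏-suc x)))))

  ≈[]-1-∏ : ∀ {n m} {x : Fin n → Carrier} → (∀ i → x i ≈[ m ] 1#) → ∏ x ≈[ m ] 1#
  ≈[]-1-∏ {zero}  l = ≈⇒≈[] (∏-zero _)
  ≈[]-1-∏ {suc n} l = ≈[]-trans (≈⇒≈[] (∏-suc _))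
    (≈[]-trans (≈[]-* (l fzero) (≈[]-1-∏ (l ∘ fsuc))) (≈⇒≈[] (*-identityˡ 1#)))

  -- The difference satisfies θ (x - y) ≡ w (x - y) in the given range. As `w` has order at least 1,
  -- the right side has one order more than x - y, and `Order-θ` passes the gain on to x - y itself.
  logDerivative-unique : ∀ {w x y} M → Order≥ 1 w → x ≈[ 1 ] 1# → y ≈[ 1 ] 1# →
                         LogDerivative (suc M) w x → LogDerivative (suc M) w y → x ≈[ suc M ] y
  logDerivative-unique {w} {x} {y} M ow x₁ y₁ lx ly = go M ℕ.≤-refl
    where
    go : ∀ m → m ℕ.≤ M → x ≈[ suc m ] y
    go zero    _   = ≈[]-trans x₁ (≈[]-sym y₁)
    go (suc m) m<M = Order-θ (go m (ℕ.<⇒≤ m<M)) (Order-cong θ-difference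
      (Order-+ (Order-mono (s≤s m<M) (Order-+ lx (Order-neg ly))) (Order-* ow (go m (ℕ.<⇒≤ m<M)))))
      where
      θ-difference : ((θ x + - (w * x)) + - (θ y + - (w * y))) + w * (x + - y) ≈ θ (x + - y)
      θ-difference = begin
        ((θ x + - (w * x)) + - (θ y + - (w * y))) + w * (x + - y)
          ≈⟨ +-cong (+-congˡ (trans (sym (-‿+-comm _ _)) (+-congˡ (-‿involutive _))))
               (trans (distribˡ w x (- y)) (+-congˡ (sym (-‿distribʳ-* w y)))) ⟩
        ((θ x + - (w * x)) + (- θ y + w * y)) + (w * x + - (w * y))
          ≈⟨ regroup (θ x) (- (w * x)) (- θ y) (w * y) (w * x) (- (w * y)) ⟩
        (θ x + - θ y) + ((- (w * x) + w * x) + (w * y + - (w * y)))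
          ≈⟨ +-congˡ (trans (+-cong (-‿inverseˡ _) (-‿inverseʳ _)) (+-identityˡ 0#)) ⟩
        (θ x + - θ y) + 0#
          ≈⟨ trans (+-identityʳ _) (+-congˡ (sym (D-neg y))) ⟩
        θ x + θ (- y)
          ≈⟨ D-+ x (- y) ⟨
        θ (x + - y) ∎

  module _ {x c : Carrier} (ox : Order≥ 1 x) (θx : θ x ≈ x) (inv : (1# + - x) * c ≈ 1#) where

    private
      [1-x]c : c + - (x * c) ≈ 1#
      [1-x]c = trans (sym (trans (distribʳ c 1# (- x)) (+-cong (*-identityˡ c) (sym (-‿distribˡ-* x c))))) inv

      c≈1+xc : c ≈ 1# + x * c
      c≈1+xc = begin
        c                             ≈⟨ +-identityʳ c ⟨
        c + 0#                        ≈⟨ +-congˡ (-‿inverseˡ (x * c)) ⟨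
        c + (- (x * c) + x * c)       ≈⟨ +-assoc _ _ _ ⟨
        (c + - (x * c)) + x * c       ≈⟨ +-congʳ [1-x]c ⟩
        1# + x * c                    ∎

      xc≈powers : ∀ K → x * c ≈ (∑ {K} λ n → x ^ suc (toℕ n)) + x ^ suc K * c
      xc≈powers zero    = sym (trans (+-cong (∑-zero _) (*-congʳ (*-identityʳ x))) (+-identityˡ _))
      xc≈powers (suc K) = begin
        x * c
          ≈⟨ *-congˡ c≈1+xc ⟩
        x * (1# + x * c)
          ≈⟨ *-congˡ (+-congˡ (xc≈powers K)) ⟩
        x * (1# + ((∑ {K} λ n → x ^ suc (toℕ n)) + x ^ suc K * c))
          ≈⟨ trans (distribˡ _ _ _) (+-congˡ (distribˡ _ _ _)) ⟩
        x * 1# + (x * (∑ {K} λ n → x ^ suc (toℕ n)) + x * (x ^ suc K * c))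
          ≈⟨ trans (sym (+-assoc _ _ _)) (+-cong (trans (+-congˡ (*-distribˡ-∑ x _)) (sym (∑-suc _))) (sym (*-assoc _ _ _))) ⟩
        (∑ {suc K} λ n → x ^ suc (toℕ n)) + x ^ suc (suc K) * c ∎

    geometric-≈1 : c ≈[ 1 ] 1#
    geometric-≈1 = Order-cong (begin
      x * c                    ≈⟨ trans (+-identityˡ _) refl ⟨
      0# + x * c               ≈⟨ +-congʳ (-‿inverseʳ 1#) ⟨
      (1# + - 1#) + x * c      ≈⟨ xy+z≈xz+y _ _ _ ⟩
      (1# + x * c) + - 1#      ≈⟨ +-congʳ c≈1+xc ⟨
      c + - 1#                 ∎) (Order-cong (*-comm c x) (Order-*ˡ c ox))

    -- For c = 1/(1 - x) the exact logarithmic derivative is x c = x + x² + ...; what follows xᴷ has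
    -- order above K.
    geometric-logDerivative : ∀ K → LogDerivative (suc K) (∑ {K} λ n → x ^ suc (toℕ n)) c
    geometric-logDerivative K = ≈[]-trans (≈⇒≈[] θc)
      (≈[]-* (≈[]-trans (≈⇒≈[] (xc≈powers K)) drop) (≈⇒≈[] refl))
      where
      drop : (∑ {K} λ n → x ^ suc (toℕ n)) + x ^ suc K * c ≈[ suc K ] ∑ {K} λ n → x ^ suc (toℕ n)
      drop = Order-cong (begin
        c * x ^ suc K                        ≈⟨ *-comm _ _ ⟩
        r                                    ≈⟨ +-identityˡ r ⟨
        0# + r                               ≈⟨ +-congʳ (-‿inverseʳ s) ⟨
        (s + - s) + r                        ≈⟨ xy+z≈xz+y _ _ _ ⟩
        (s + r) + - s                        ∎) (Order-*ˡ c (Order-^ ox (suc K)))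
        where
        s = ∑ {K} λ n → x ^ suc (toℕ n)
        r = x ^ suc K * c

      -- From (1 - x) c = 1: (1 - x) θ c = x c, and then multiply by c.
      θc : θ c ≈ x * c * c
      θc = begin
        θ c                                   ≈⟨ *-identityˡ _ ⟨
        1# * θ c                              ≈⟨ *-congʳ inv ⟨
        ((1# + - x) * c) * θ c                ≈⟨ trans (*-congʳ (*-comm _ c)) (*-assoc _ _ _) ⟩
        c * ((1# + - x) * θ c)                ≈⟨ *-congˡ step ⟩
        c * (x * c)                           ≈⟨ *-comm _ _ ⟩
        x * c * c                             ∎
        where
        step : (1# + - x) * θ c ≈ x * c
        step = begin
          (1# + - x) * θ c                          ≈⟨ x+y≈0⇒y≈-x (begin
            - x * c + (1# + - x) * θ c              ≈⟨ +-congʳ (*-congʳ θ[1-x]) ⟨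
            θ (1# + - x) * c + (1# + - x) * θ c     ≈⟨ D-* (1# + - x) c ⟨
            θ ((1# + - x) * c)                      ≈⟨ trans (D-cong inv) D-1 ⟩
            0#                                      ∎) ⟩
          - (- x * c)                               ≈⟨ -‿cong (-‿distribˡ-* x c) ⟨
          - - (x * c)                               ≈⟨ -‿involutive _ ⟩
          x * c                                     ∎
          where
          x+y≈0⇒y≈-x : ∀ {x y} → x + y ≈ 0# → y ≈ - x
          x+y≈0⇒y≈-x = RingProperties.+-inverseʳ-unique ring _ _

          θ[1-x] : θ (1# + - x) ≈ - x
          θ[1-x] = trans (D-+ 1# (- x)) (trans (+-cong D-1 (trans (D-neg x) (-‿cong θx))) (+-identityˡ _))

  module _ {y : Carrier} (n : ℕ) (oy : Order≥ 1 y) (θy : θ y ≈ ⟨ suc n ⟩ * y) where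

    private
      k = suc n
      term : ℕ → Carrier
      term i = ι (exp-weight k i) * y ^ i

    exp-≈1 : ∀ I → (∑ {suc I} λ i → ι (exp-weight k (toℕ i)) * y ^ toℕ i) ≈[ 1 ] 1#
    exp-≈1 I = Order-cong (begin
      s                             ≈⟨ +-identityˡ s ⟨
      0# + s                        ≈⟨ +-congʳ (-‿inverseʳ 1#) ⟨
      (1# + - 1#) + s               ≈⟨ xy+z≈xz+y _ _ _ ⟩
      (1# + s) + - 1#               ≈⟨ +-congʳ (+-congʳ (trans (*-identityʳ _) (trans (ι.⟦⟧-cong ≡.refl) ι.1#-homo))) ⟨
      (ι (exp-weight k 0) * 1# + s) + - 1#   ≈⟨ +-congʳ (∑-suc _) ⟨
      (∑ {suc I} λ i → term (toℕ i)) + - 1#  ∎)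
      (Order-∑ λ i → Order-*ˡ _ (Order-mono (s≤s z≤n) (Order-^ oy (suc (toℕ i)))))
      where
      s = ∑ {I} λ i → term (suc (toℕ i))

    -- One factor k = n + 1 comes from the exponent k y, the other from θ y = k y. Differentiating
    -- the truncated series loses its last term, which after multiplication by y has order at least
    -- I + 1.
    exp-logDerivative : ∀ I →
      LogDerivative (suc I) (⟨ k ⟩ * ⟨ k ⟩ * y) (∑ {suc I} λ i → ι (exp-weight k (toℕ i)) * y ^ toℕ i)
    exp-logDerivative I = ≈[]-trans (≈⇒≈[] (begin
      θ (∑ {suc I} λ i → term (toℕ i))
        ≈⟨ trans (D-∑ _) (∑-cong λ i → θ-term (toℕ i)) ⟩
      (∑ {suc I} λ i → ι (exp-weight k (toℕ i)) * (⟨ toℕ i ⟩ * ⟨ k ⟩ * y ^ toℕ i))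
        ≈⟨ ∑-suc _ ⟩
      ι (exp-weight k 0) * (⟨ 0 ⟩ * ⟨ k ⟩ * 1#) + (∑ {I} λ i → ι (exp-weight k (suc (toℕ i))) * (⟨ suc (toℕ i) ⟩ * ⟨ k ⟩ * (y * y ^ toℕ i)))
        ≈⟨ +-cong (trans (*-congˡ (trans (*-identityʳ _) (trans (*-congʳ ⟨0⟩≈0) (zeroˡ _)))) (zeroʳ _))
             (∑-cong λ i → shift (toℕ i)) ⟩
      0# + (∑ {I} λ i → q * term (toℕ i))
        ≈⟨ trans (+-identityˡ _) (sym (*-distribˡ-∑ q _)) ⟩
      q * s ∎)) (≈[]-sym (Order-cong (begin
        q * term I                         ≈⟨ +-identityˡ _ ⟨
        0# + q * term I                    ≈⟨ +-congʳ (-‿inverseʳ _) ⟨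
        (q * s + - (q * s)) + q * term I   ≈⟨ xy+z≈xz+y _ _ _ ⟩
        (q * s + q * term I) + - (q * s)   ≈⟨ +-congʳ (distribˡ q s (term I)) ⟨
        q * (s + term I) + - (q * s)       ≈⟨ +-congʳ (*-congˡ (∑-last I term)) ⟨
        q * (∑ {suc I} λ i → term (toℕ i)) + - (q * s) ∎)
        (Order-* (Order-*ˡ _ oy) (Order-*ˡ _ (Order-^ oy I)))))
      where
      q = ⟨ k ⟩ * ⟨ k ⟩ * y
      s = ∑ {I} λ i → term (toℕ i)

      θ-term : ∀ i → θ (term i) ≈ ι (exp-weight k i) * (⟨ i ⟩ * ⟨ k ⟩ * y ^ i)
      θ-term i = trans (D-ι* (exp-weight k i) (y ^ i)) (*-congˡ (D-eigen-^ θy i))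

      shift : ∀ i → ι (exp-weight k (suc i)) * (⟨ suc i ⟩ * ⟨ k ⟩ * (y * y ^ i)) ≈ q * term i
      shift i = begin
        ι (exp-weight k (suc i)) * (⟨ suc i ⟩ * ⟨ k ⟩ * (y * y ^ i))
          ≈⟨ trans (*-congˡ (*-assoc _ _ _)) (sym (*-assoc _ _ _)) ⟩
        ι (exp-weight k (suc i)) * ⟨ suc i ⟩ * (⟨ k ⟩ * (y * y ^ i))
          ≈⟨ *-congʳ (trans (ι-* (exp-weight-suc k i)) (ι.*-homo (exp-weight k i) (fromℕ k))) ⟩
        ι (exp-weight k i) * ⟨ k ⟩ * (⟨ k ⟩ * (y * y ^ i))
          ≈⟨ collect (ι (exp-weight k i)) ⟨ k ⟩ y (y ^ i) ⟩
        q * term i ∎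

-- Δ on products of generating functions

module GeneratingFunctionKernel (A : ℚ-Algebra) (filtration : Filtration A) where
  open ℚ-Algebra A hiding (zero)
  open Filtration filtration
  open RawSemiringOps (Semiring.rawSemiring semiring) using (_^_)

  module Derivations
    (D D̃ : ℕ → Carrier → Carrier)
    (isD : ∀ n → IsDerivation A (D n)) (isD̃ : ∀ n → IsDerivation A (D̃ n)) where
    open DeltaOnEigenvectors A D D̃ isD isD̃

    -- H k and H̃ i stand for the generating functions of the hₙ in the variable
    -- t k and of the h̃ₙ in the variable u i.

    module Kernel
      {d : ℕ} (t u H H̃ : Fin d → Carrier) (c : Fin d → Fin d → Carrier)
      (Order-u : ∀ i → Order≥ 1 (u i)) (θ-u : ∀ i → θ (u i) ≈ u i) (θ-t : ∀ k → θ (t k) ≈ 0#)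
      (geometric : ∀ i k → c i k ≈ 1# + u i * (t k * c i k))
      (constant-t : ∀ k → Constant (t k)) (constant-u : ∀ i → Constant (u i))
      (D-H : ∀ n k → D n (H k) ≈ ι (reciprocal n) * t k ^ suc n * H k) (D̃-H : ∀ n k → D̃ n (H k) ≈ 0#)
      (D-H̃ : ∀ n i → D n (H̃ i) ≈ 0#) (D̃-H̃ : ∀ n i → D̃ n (H̃ i) ≈ ι (reciprocal n) * u i ^ suc n * H̃ i)
      where

      open Delta A D D̃
      open FiltrationProperties A filtration
      open FiniteSums commutativeRing
      open DeterminantProperties commutativeRing
      open CauchyDeterminant commutativeRing
      open Scalars A
      open SemiringIdentities commutativeRing
      open RingProperties ring using (-‿distribˡ-*)
      open CommSemigroupProperties *-commutativeSemigroup using (interchange)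
      open SetoidReasoning setoid
      private
        module θ = DerivationProperties A θ-isDerivation
        module D n = DerivationProperties A (isD n)
        module D̃ n = DerivationProperties A (isD̃ n)

        -- The eigenvalue on the product of the generating functions: logarithmic derivatives add,
        -- and each variable contributes its power tₖⁿ⁺¹ divided by n + 1.
        power : (Fin d → Carrier) → ℕ → Carrier
        power t n = ∑ λ k → ι (reciprocal n) * t k ^ suc n

        a ã y : ℕ → Carrier
        a n = power t n
        ã n = power u n
        y n = a n * ã n

        Y w : Carrier
        Y = ∏ H * ∏ H̃
        w = Det (λ i j → u i ^ toℕ j) * Det (λ j k → t k ^ toℕ j)

        constant-power : ∀ {t} → (∀ k → Constant (t k)) → ∀ n → Constant (power t n)
        constant-power ct n = constant-∑ λ k → constant-* (constant-ι _) (constant-^ (ct k) (suc n))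

        constant-w : Constant w
        constant-w = constant-* (constant-Det λ i j → constant-^ (constant-u i) (toℕ j))
                                (constant-Det λ j k → constant-^ (constant-t k) (toℕ j))

        kill-∏ : ∀ {E} → IsDerivation A E → ∀ {H : Fin d → Carrier} → (∀ k → E (H k) ≈ 0#) → E (∏ H) ≈ 0#
        kill-∏ isE {H} e = trans (DerivationProperties.D-eigen-∏ A isE {w = λ _ → 0#} λ k → trans (e k) (sym (zeroˡ (H k))))
          (trans (*-congʳ (∑-0 {d} λ k → refl)) (zeroˡ _))

        D-Y : ∀ n → D n Y ≈ a n * Y
        D-Y n = begin
          D n Y                                ≈⟨ D.D-* n _ _ ⟩
          D n (∏ H) * ∏ H̃ + ∏ H * D n (∏ H̃)    ≈⟨ +-cong (*-congʳ (D.D-eigen-∏ n (D-H n))) (trans (*-congˡ (kill-∏ (isD n) (D-H̃ n))) (zeroʳ _)) ⟩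
          a n * ∏ H * ∏ H̃ + 0#                 ≈⟨ trans (+-identityʳ _) (*-assoc _ _ _) ⟩
          a n * Y                              ∎

        D̃-Y : ∀ n → D̃ n Y ≈ ã n * Y
        D̃-Y n = begin
          D̃ n Y                                ≈⟨ D̃.D-* n _ _ ⟩
          D̃ n (∏ H) * ∏ H̃ + ∏ H * D̃ n (∏ H̃)    ≈⟨ +-cong (trans (*-congʳ (kill-∏ (isD̃ n) (D̃-H n))) (zeroˡ _)) (*-congˡ (D̃.D-eigen-∏ n (D̃-H̃ n))) ⟩
          0# + ∏ H * (ã n * ∏ H̃)               ≈⟨ trans (+-identityˡ _) (x∙yz≈y∙xz _ _ _) ⟩
          ã n * Y                              ∎

        E : ℕ → ℕ → Carrier
        E = expProduct Y a ã D-Y D̃-Y (constant-power constant-t) (constant-power constant-u)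

        θ-a : ∀ n → θ (a n) ≈ 0#
        θ-a n = trans (θ.D-∑ _) (∑-0 λ k → trans (θ.D-ι* _ _) (trans (*-congˡ (begin
          θ (t k ^ suc n)                  ≈⟨ θ.D-eigen-^ (trans (θ-t k) (sym (zeroˡ (t k)))) (suc n) ⟩
          ⟨ suc n ⟩ * 0# * t k ^ suc n     ≈⟨ trans (*-congʳ (zeroʳ _)) (zeroˡ _) ⟩
          0#                               ∎)) (zeroʳ _)))

        θ-ã : ∀ n → θ (ã n) ≈ ⟨ suc n ⟩ * ã n
        θ-ã n = trans (θ.D-∑ _) (trans (∑-cong λ k → trans (θ.D-ι* _ _) (trans (*-congˡ (begin
          θ (u k ^ suc n)                  ≈⟨ θ.D-eigen-^ (trans (θ-u k) (sym (*-identityˡ (u k)))) (suc n) ⟩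
          ⟨ suc n ⟩ * 1# * u k ^ suc n     ≈⟨ *-congʳ (*-identityʳ _) ⟩
          ⟨ suc n ⟩ * u k ^ suc n          ∎)) (x∙yz≈y∙xz _ _ _))) (sym (*-distribˡ-∑ _ _)))

        θ-y : ∀ n → θ (y n) ≈ ⟨ suc n ⟩ * y n
        θ-y n = begin
          θ (y n)                          ≈⟨ θ.D-* _ _ ⟩
          θ (a n) * ã n + a n * θ (ã n)    ≈⟨ +-cong (trans (*-congʳ (θ-a n)) (zeroˡ _)) (*-congˡ (θ-ã n)) ⟩
          0# + a n * (⟨ suc n ⟩ * ã n)     ≈⟨ trans (+-identityˡ _) (x∙yz≈y∙xz _ _ _) ⟩
          ⟨ suc n ⟩ * y n                  ∎

        Order-y : ∀ n → Order≥ 1 (y n)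
        Order-y n = Order-*ˡ (a n) (Order-∑ λ i → Order-*ˡ _ (Order-mono (s≤s z≤n) (Order-^ (Order-u i) (suc n))))

        -- The logarithmic derivative of the factor of Δ for k = n + 1. The square of k cancels the
        -- two reciprocals in `a n` and `ã n`, leaving a product of two power sums, which `q≈`
        -- expands into the powers of all products uᵢ tₖ.
        q : ℕ → Carrier
        q n = ⟨ suc n ⟩ * ⟨ suc n ⟩ * y n

        E-logDerivative : ∀ K I → LogDerivative (suc I) (∑ {K} λ n → q (toℕ n)) (E K (suc I))
        E-logDerivative zero    I = ≈[]-trans logDerivative-1 (≈⇒≈[] (*-congʳ (sym (∑-zero _))))
        E-logDerivative (suc K) I = ≈[]-trans
          (logDerivative-* (E-logDerivative K I) (exp-logDerivative K (Order-y K) (θ-y K) I))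
          (≈⇒≈[] (*-congʳ (sym (∑-last K q))))

        E-≈1 : ∀ K I → E K (suc I) ≈[ 1 ] 1#
        E-≈1 zero    I = ≈⇒≈[] refl
        E-≈1 (suc K) I = ≈[]-trans (≈[]-* (E-≈1 K I) (exp-≈1 K (Order-y K) (θ-y K) I)) (≈⇒≈[] (*-identityˡ 1#))

        x : Fin d → Fin d → Carrier
        x i k = u i * t k

        Order-x : ∀ i k → Order≥ 1 (x i k)
        Order-x i k = Order-cong (*-comm _ _) (Order-*ˡ (t k) (Order-u i))

        θ-x : ∀ i k → θ (x i k) ≈ x i k
        θ-x i k = trans (θ.D-* _ _) (trans (+-cong (*-congʳ (θ-u i)) (trans (*-congˡ (θ-t k)) (zeroʳ _))) (+-identityʳ _))

        inverse : ∀ i k → (1# + - x i k) * c i k ≈ 1#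
        inverse i k = begin
          (1# + - x i k) * c i k          ≈⟨ trans (distribʳ _ _ _) (+-cong (*-identityˡ _) (sym (-‿distribˡ-* _ _))) ⟩
          c i k + - (x i k * c i k)       ≈⟨ +-congʳ (trans (geometric i k) (+-congˡ (sym (*-assoc _ _ _)))) ⟩
          (1# + x i k * c i k) + - (x i k * c i k)  ≈⟨ trans (+-assoc _ _ _) (+-congˡ (-‿inverseʳ _)) ⟩
          1# + 0#                         ≈⟨ +-identityʳ 1# ⟩
          1#                              ∎

        Z : Carrier
        Z = ∏ λ k → ∏ λ i → c i k

        Z-≈1 : Z ≈[ 1 ] 1#
        Z-≈1 = ≈[]-1-∏ λ k → ≈[]-1-∏ λ i → geometric-≈1 (Order-x i k) (θ-x i k) (inverse i k)

        Z-logDerivative : ∀ K → LogDerivative (suc K) (∑ λ k → ∑ λ i → ∑ {K} λ n → x i k ^ suc (toℕ n)) Z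
        Z-logDerivative K = logDerivative-∏ λ k → logDerivative-∏ λ i →
          geometric-logDerivative (Order-x i k) (θ-x i k) (inverse i k) K

        power-sum : ∀ t n → ⟨ suc n ⟩ * power t n ≈ ∑ λ k → t k ^ suc n
        power-sum t n = trans (*-distribˡ-∑ _ _) (∑-cong λ k → trans (sym (*-assoc _ _ _))
          (trans (*-congʳ (trans (*-comm _ _) (trans (ι-* (reciprocal-inverse n)) ι.1#-homo))) (*-identityˡ _)))

        q≈ : ∀ n → q n ≈ ∑ λ k → ∑ λ i → x i k ^ suc n
        q≈ n = begin
          ⟨ suc n ⟩ * ⟨ suc n ⟩ * (a n * ã n)
            ≈⟨ interchange _ _ _ _ ⟩
          ⟨ suc n ⟩ * a n * (⟨ suc n ⟩ * ã n)
            ≈⟨ *-cong (power-sum t n) (power-sum u n) ⟩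
          (∑ λ k → t k ^ suc n) * (∑ λ i → u i ^ suc n)
            ≈⟨ *-distribʳ-∑ _ _ ⟩
          (∑ λ k → t k ^ suc n * (∑ λ i → u i ^ suc n))
            ≈⟨ ∑-cong (λ k → *-distribˡ-∑ _ _) ⟩
          (∑ λ k → ∑ λ i → t k ^ suc n * u i ^ suc n)
            ≈⟨ ∑-cong (λ k → ∑-cong λ i → trans (CommExp.^-distrib-* commutativeSemiring (u i) (t k) (suc n)) (*-comm _ _)) ⟨
          (∑ λ k → ∑ λ i → x i k ^ suc n) ∎

        ∑q≈ : ∀ K → (∑ {K} λ n → q (toℕ n)) ≈ ∑ λ k → ∑ λ i → ∑ {K} λ n → x i k ^ suc (toℕ n)
        ∑q≈ K = trans (∑-cong λ n → q≈ (toℕ n))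
          (trans (∑-comm λ n k → ∑ λ i → x i k ^ suc (toℕ n)) (∑-cong λ k → ∑-comm λ n i → x i k ^ suc (toℕ n)))

        -- Both sides have constant term 1. The cut-off at I spoils the logarithmic derivative of
        -- `E` only from order I on, and comparing that of `Z` with K power sums costs an error of
        -- order above K.
        E≈Z : ∀ M K I → suc M ℕ.≤ K → suc M ℕ.≤ I → E K I ≈[ suc M ] Z
        E≈Z M K (suc I) M<K M<I = logDerivative-unique M
          (Order-∑ λ k → Order-*ˡ _ (Order-y (toℕ k))) (E-≈1 K I) Z-≈1
          (Order-mono M<I (E-logDerivative K I))
          (Order-mono (ℕ.m≤n⇒m≤1+n M<K) (≈[]-trans (Z-logDerivative K) (≈⇒≈[] (*-congʳ (sym (∑q≈ K))))))

      -- Only a congruence, since cut-offs of Δ do not reach ∏ 1/(1 - tₖ uᵢ) in general. The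
      -- Vandermonde determinants are constants for the derivations, so they pass through Δ and meet
      -- `Z` in Cauchy's formula.
      Δ-kernel : ∀ M K I → suc M ℕ.≤ K → suc M ℕ.≤ I →
        truncated K I (Det (λ i j → u i ^ toℕ j) * Det (λ j k → t k ^ toℕ j) * (∏ H * ∏ H̃))
          ≈[ suc M ] Det λ i k → H̃ i * (H k * c i k)
      Δ-kernel M K I M<K M<I = ≈[]-trans
        (≈⇒≈[] (truncated-eigenvector Y a ã D-Y D̃-Y (constant-power constant-t) (constant-power constant-u) K I constant-w))
        (≈[]-trans (≈[]-* (E≈Z M K I M<K M<I) (≈⇒≈[] refl)) (≈⇒≈[] (begin
          Z * (w * Y)
            ≈⟨ *-assoc _ _ _ ⟨
          Z * w * Y
            ≈⟨ *-congʳ (cauchy u t c λ i k → trans (*-congʳ (+-congˡ (sym (-‿distribˡ-* (u i) (t k))))) (inverse i k)) ⟨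
          Det c * (∏ H * ∏ H̃)
            ≈⟨ trans (*-comm _ _) (trans (*-congʳ (*-comm _ _)) (*-assoc _ _ _)) ⟩
          ∏ H̃ * (∏ H * Det c)
            ≈⟨ trans (Det-scale-rows H̃ _) (*-congˡ (Det-scale-columns H c)) ⟨
          Det (λ i k → H̃ i * (H k * c i k)) ∎)))

-- Homomorphisms, coefficient sequences and power series

module HomomorphismProperties (R S : CommutativeRing 0ℓ 0ℓ)
  {f : CommutativeRing.Carrier R → CommutativeRing.Carrier S}
  (isHom : IsRingHomomorphism (CommutativeRing.rawRing R) (CommutativeRing.rawRing S) f) where

  open IsRingHomomorphism isHom public
  private
    module R = CommutativeRing R
    module S = CommutativeRing S
    module ΣR = FiniteSums R
    module ΣS = FiniteSums S
    module DR = DeterminantProperties R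
    module DS = DeterminantProperties S
    module ^R = RawSemiringOps (Semiring.rawSemiring R.semiring)
    module ^S = RawSemiringOps (Semiring.rawSemiring S.semiring)
  open S using (trans; sym)

  ∑-homo : ∀ {n} (x : Fin n → R.Carrier) → f (ΣR.∑ x) S.≈ ΣS.∑ (f ∘ x)
  ∑-homo {zero}  x = trans (⟦⟧-cong (ΣR.∑-zero x)) (trans 0#-homo (sym (ΣS.∑-zero _)))
  ∑-homo {suc n} x = trans (⟦⟧-cong (ΣR.∑-suc x)) (trans (+-homo _ _)
    (trans (S.+-congˡ (∑-homo (x ∘ fsuc))) (sym (ΣS.∑-suc _))))

  ^-homo : ∀ x n → f (x ^R.^ n) S.≈ f x ^S.^ n
  ^-homo x zero    = 1#-homo
  ^-homo x (suc n) = trans (*-homo _ _) (S.*-congˡ (^-homo x n))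

  sgn-homo : ∀ {n} (j : Fin n) → f (DR.sgn j) S.≈ DS.sgn j
  sgn-homo fzero    = 1#-homo
  sgn-homo (fsuc j) = trans (*-homo _ _) (S.*-cong (trans (-‿homo _) (S.-‿cong 1#-homo)) (sgn-homo j))

  Det-homo : ∀ {n} (M : Fin n → Fin n → R.Carrier) → f (DR.Det M) S.≈ DS.Det (λ r c → f (M r c))
  Det-homo {zero}  M = trans (⟦⟧-cong (DR.Det-zero M)) (trans 1#-homo (sym (DS.Det-zero _)))
  Det-homo {suc n} M = trans (⟦⟧-cong (DR.Det-suc M)) (trans (∑-homo _)
    (trans (ΣS.∑-cong λ j → trans (*-homo _ _) (S.*-cong (sgn-homo j) (trans (*-homo _ _)
      (S.*-congˡ (Det-homo λ r c → M (fsuc r) (punchIn j c))))))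
    (sym (DS.Det-suc _))))

conv-additive : ∀ (A B : ℚ-Algebra) (let module A = ℚ-Algebra A) (let module B = ℚ-Algebra B) {f : A.Carrier → B.Carrier} →
                (∀ x y → f (x A.+ y) B.≈ f x B.+ f y) →
                ∀ a φ → f (PowerSeries.∑ A a φ) B.≈ PowerSeries.∑ B a (λ i j → f (φ i j))
conv-additive A B +-homo zero    φ = ℚ-Algebra.refl B
conv-additive A B +-homo (suc a) φ = ℚ-Algebra.trans B (+-homo _ _)
  (ℚ-Algebra.+-congˡ B (conv-additive A B +-homo a (λ i j → φ (suc i) j)))

module Sequences (A : ℚ-Algebra) where
  open ℚ-Algebra A hiding (zero)
  open PowerSeries A public using () renaming
    ( ∑ to conv; ∑-cong to conv-cong; ∑-0 to conv-0; ∑-+ to conv-+; ∑-first to conv-first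
    ; ∑-last to conv-last; ∑-flip to conv-flip )

  conv-cong-bounded : ∀ a {φ ψ} → (∀ i j → i ℕ.+ j ≡ a → φ i j ≈ ψ i j) → conv a φ ≈ conv a ψ
  conv-cong-bounded zero    e = e 0 0 ≡.refl
  conv-cong-bounded (suc a) e =
    +-cong (e 0 (suc a) ≡.refl) (conv-cong-bounded a λ i j eq → e (suc i) j (≡.cong suc eq))

  *-distribˡ-conv : ∀ x a φ → x * conv a φ ≈ conv a (λ i j → x * φ i j)
  *-distribˡ-conv x = conv-additive A A (distribˡ x)

  δ₀ : ℕ → Carrier
  δ₀ zero    = 1#
  δ₀ (suc _) = 0#

  shift : (ℕ → Carrier) → ℕ → Carrier
  shift f zero    = 0#
  shift f (suc n) = f n

  -- Multiplication of ∑ f m tᵐ by tⁿ. Thus `shiftⁿ n h m` is h with index m - n, read as zero when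
  -- that is negative, without recourse to integers.
  shiftⁿ : ℕ → (ℕ → Carrier) → ℕ → Carrier
  shiftⁿ zero    f = f
  shiftⁿ (suc n) f = shift (shiftⁿ n f)

  conv-δ₀ : ∀ (f : ℕ → Carrier) a → conv a (λ i j → δ₀ i * f j) ≈ f a
  conv-δ₀ f a = trans (conv-first a _ λ i j → zeroˡ _) (*-identityˡ _)

  conv-shift : ∀ (f g : ℕ → Carrier) a → conv a (λ i j → shift f i * g j) ≈ shift (λ b → conv b λ i j → f i * g j) a
  conv-shift f g zero    = zeroˡ _
  conv-shift f g (suc a) = trans (+-congʳ (zeroˡ _)) (+-identityˡ _)

  shift-cong : ∀ {f g} → (∀ n → f n ≈ g n) → ∀ n → shift f n ≈ shift g n
  shift-cong e zero    = refl
  shift-cong e (suc n) = e n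

module DerivationTypes (A : ℚ-Algebra) where
  open ℚ-Algebra A
  open Sequences A

  LowersIndex : (ℕ → Carrier → Carrier) → (ℕ → Carrier) → Set
  LowersIndex D h = ∀ n m → D n (h m) ≈ ι (reciprocal n) * shiftⁿ (suc n) h m

  Annihilates : (ℕ → Carrier → Carrier) → (ℕ → Carrier) → Set
  Annihilates D h = ∀ n m → D n (h m) ≈ 0#

module SeriesProperties (A : ℚ-Algebra) where

  open ℚ-Algebra A hiding (zero)
  open PowerSeries A using
    ( Coefficients; Series; series; coeff; trailing; _≋_; _⊛_; _⊗_; _⊕_; constant; const; algebra; ⊛-cong; ⊛-comm
    ; ⊛-zeroˡ; constant-⊛; constant-trailing; constant-cong; constant-+; constant-0; constant-*; constant-neg )
  open Sequences A
  open Scalars A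
  open FiniteSums commutativeRing
  open CommSemigroupProperties *-commutativeSemigroup using (x∙yz≈y∙xz)
  open RawSemiringOps (Semiring.rawSemiring semiring) using (_^_)
  open SetoidReasoning setoid
  private
    module S = ℚ-Algebra algebra
    module ΣS = FiniteSums S.commutativeRing
    module DS = DeterminantProperties S.commutativeRing
    module DA = DeterminantProperties commutativeRing
    module ^S = RawSemiringOps (Semiring.rawSemiring S.semiring)

  ⊛-zeroʳ : ∀ f g → (∀ β → g β ≈ 0#) → ∀ α → (f ⊛ g) α ≈ 0#
  ⊛-zeroʳ f g e α = trans (⊛-comm f g α) (⊛-zeroˡ g f e α)

  private
    ⊛-at : Coefficients → Coefficients → List ℕ → ℕ → ℕ → Carrier
    ⊛-at f g α i j = ((f ∘ (i ∷_)) ⊛ (g ∘ (j ∷_))) α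

  ⊛-suc-zero : ∀ f g a α → (∀ i β → f (suc i ∷ β) ≈ 0#) → (∀ j β → g (suc j ∷ β) ≈ 0#) →
               (f ⊛ g) (suc a ∷ α) ≈ 0#
  ⊛-suc-zero f g a α ef eg = conv-0 (suc a) (⊛-at f g α) λ
    { zero    (suc j) _ → ⊛-zeroʳ (f ∘ (0 ∷_)) (g ∘ (suc j ∷_)) (eg j) α
    ; (suc i) j       _ → ⊛-zeroˡ (f ∘ (suc i ∷_)) (g ∘ (j ∷_)) (ef i) α }

  conv-only-last : ∀ a φ → (∀ i j → φ i (suc j) ≈ 0#) → conv a φ ≈ φ a 0
  conv-only-last a φ e = trans (conv-flip a φ) (conv-first a _ λ i j → e j i)

  const-isHomomorphism : IsRingHomomorphism rawRing S.rawRing const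
  const-isHomomorphism = record
    { isSemiringHomomorphism = record
      { isNearSemiringHomomorphism = record
        { +-isMonoidHomomorphism = record
          { isMagmaHomomorphism = record
            { isRelHomomorphism = record { cong = constant-cong }
            ; homo = constant-+ }
          ; ε-homo = constant-0 }
        ; *-homo = λ x y α → trans (constant-* x y α) (sym (constant-⊛ x _ α)) }
      ; 1#-homo = λ α → refl }
    ; -‿homo = constant-neg }

  module const = HomomorphismProperties commutativeRing S.commutativeRing const-isHomomorphism

  constant-degree-0 : ∀ c α → sum α ≡ 0 → constant c α ≈ c
  constant-degree-0 c []         e = refl
  constant-degree-0 c (zero ∷ α) e = constant-degree-0 c α e

  -- inVar n f is the series ∑ₘ f m zₙ₊₁ᵐ.

  inVar : ℕ → (ℕ → Carrier) → Series
  inVar n f = series (v n f) (v-trailing n f)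
    module InVar where
    v : ℕ → (ℕ → Carrier) → Coefficients
    v n       f []          = f 0
    v zero    f (a ∷ α)     = constant (f a) α
    v (suc n) f (zero ∷ α)  = v n f α
    v (suc n) f (suc _ ∷ α) = 0#

    v-trailing : ∀ n f α → v n f (α ∷ʳ 0) ≈ v n f α
    v-trailing zero    f []          = refl
    v-trailing (suc n) f []          = v-[] n
      where
      v-[] : ∀ n → v n f [] ≈ f 0
      v-[] zero    = refl
      v-[] (suc n) = refl
    v-trailing zero    f (a ∷ α)     = constant-trailing (f a) α
    v-trailing (suc n) f (zero ∷ α)  = v-trailing n f α
    v-trailing (suc n) f (suc _ ∷ α) = refl

  inVar-map : ∀ n f g (φ : Carrier → Carrier) → φ 0# ≈ 0# → (∀ m → g m ≈ φ (f m)) →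
              (∀ c d α → d ≈ φ c → constant d α ≈ φ (constant c α)) →
              ∀ α → coeff (inVar n g) α ≈ φ (coeff (inVar n f) α)
  inVar-map n       f g φ φ0 e ec []          = e 0
  inVar-map zero    f g φ φ0 e ec (a ∷ α)     = ec (f a) (g a) α (e a)
  inVar-map (suc n) f g φ φ0 e ec (zero ∷ α)  = inVar-map n f g φ φ0 e ec α
  inVar-map (suc n) f g φ φ0 e ec (suc _ ∷ α) = sym φ0

  constant-map : ∀ (φ : Carrier → Carrier) → φ 0# ≈ 0# →
                 ∀ c d α → d ≈ φ c → constant d α ≈ φ (constant c α)
  constant-map φ φ0 c d []          e = e
  constant-map φ φ0 c d (zero ∷ α)  e = constant-map φ φ0 c d α e
  constant-map φ φ0 c d (suc _ ∷ α) e = sym φ0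

  inVar-cong : ∀ n {f g} → (∀ m → f m ≈ g m) → inVar n f ≋ inVar n g
  inVar-cong n {f} {g} e = inVar-map n g f id refl e (constant-map id refl)

  inVar-scale : ∀ n x f → const x ⊗ inVar n f ≋ inVar n (λ m → x * f m)
  inVar-scale n x f α = trans (constant-⊛ x _ α)
    (sym (inVar-map n f _ (x *_) (zeroʳ x) (λ m → refl) (constant-map (x *_) (zeroʳ x)) α))

  inVar-+ : ∀ n f g → inVar n (λ m → f m + g m) ≋ inVar n f ⊕ inVar n g
  inVar-+ n       f g []          = refl
  inVar-+ zero    f g (a ∷ α)     = constant-+ _ _ α
  inVar-+ (suc n) f g (zero ∷ α)  = inVar-+ n f g α
  inVar-+ (suc n) f g (suc _ ∷ α) = sym (+-identityˡ 0#)

  inVar-* : ∀ n f g → inVar n f ⊗ inVar n g ≋ inVar n (λ m → conv m λ i j → f i * g j)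
  inVar-* n       f g []          = refl
  inVar-* zero    f g (a ∷ α)     = trans
    (conv-cong a λ i j → trans (constant-⊛ (f i) _ α) (sym (constant-* (f i) (g j) α)))
    (sym (conv-additive A A {λ c → constant c α} (λ x y → constant-+ x y α) a _))
  inVar-* (suc n) f g (zero ∷ α)  = inVar-* n f g α
  inVar-* (suc n) f g (suc a ∷ α) =
    ⊛-suc-zero (coeff (inVar (suc n) f)) (coeff (inVar (suc n) g)) a α (λ _ _ → refl) (λ _ _ → refl)

  inVar-δ₀ : ∀ n → inVar n δ₀ ≋ S.1#
  inVar-δ₀ n       []          = refl
  inVar-δ₀ zero    (zero ∷ α)  = refl
  inVar-δ₀ zero    (suc _ ∷ α) = constant-0 α
  inVar-δ₀ (suc n) (zero ∷ α)  = inVar-δ₀ n α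
  inVar-δ₀ (suc n) (suc _ ∷ α) = refl

  inVar-0 : ∀ n f → (∀ m → f m ≈ 0#) → inVar n f ≋ S.0#
  inVar-0 n f e = inVar-map n f f (λ _ → 0#) refl e (λ c d α e → trans (constant-cong e α) (constant-0 α))

  inVar-degree-0 : ∀ n f α → sum α ≡ 0 → coeff (inVar n f) α ≈ f 0
  inVar-degree-0 n       f []         e = refl
  inVar-degree-0 zero    f (zero ∷ α) e = constant-degree-0 (f 0) α e
  inVar-degree-0 (suc n) f (zero ∷ α) e = inVar-degree-0 n f α e

  z : ℕ → Series
  z n = inVar n (shift δ₀)

  z-* : ∀ n f → z n ⊗ inVar n f ≋ inVar n (shift f)
  z-* n f α = trans (inVar-* n (shift δ₀) f α)
    (inVar-cong n (λ m → trans (conv-shift δ₀ f m) (shift-cong (conv-δ₀ f) m)) α)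

  z^-* : ∀ n j f → (z n ^S.^ j) ⊗ inVar n f ≋ inVar n (shiftⁿ j f)
  z^-* n zero    f = S.*-identityˡ (inVar n f)
  z^-* n (suc j) f α = begin
    coeff (z n ⊗ (z n ^S.^ j) ⊗ inVar n f) α
      ≈⟨ S.*-assoc (z n) (z n ^S.^ j) (inVar n f) α ⟩
    coeff (z n ⊗ ((z n ^S.^ j) ⊗ inVar n f)) α
      ≈⟨ ⊛-cong {coeff (z n)} (λ β → refl) (z^-* n j f) α ⟩
    coeff (z n ⊗ inVar n (shiftⁿ j f)) α
      ≈⟨ z-* n (shiftⁿ j f) α ⟩
    coeff (inVar n (shiftⁿ (suc j) f)) α ∎

  coeff-∑ : ∀ {n} (f : Fin n → Series) α → coeff (ΣS.∑ f) α ≈ ∑ λ i → coeff (f i) α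
  coeff-∑ {zero}  f α = trans (ΣS.∑-zero f α) (sym (∑-zero _))
  coeff-∑ {suc n} f α = trans (ΣS.∑-suc f α) (trans (+-congˡ (coeff-∑ (f ∘ fsuc) α)) (sym (∑-suc _)))

  private

    -- z₁, z₂, … ↦ z₂, z₃, …

    raiseVars : Series → Series
    raiseVars f = series w w-trailing
      where
      w : Coefficients
      w []          = coeff f []
      w (zero ∷ α)  = coeff f α
      w (suc _ ∷ α) = 0#

      w-trailing : ∀ α → w (α ∷ʳ 0) ≈ w α
      w-trailing []          = refl
      w-trailing (zero ∷ α)  = trailing f α
      w-trailing (suc _ ∷ α) = refl

    raiseVars-* : ∀ f g → raiseVars (f ⊗ g) ≋ raiseVars f ⊗ raiseVars g
    raiseVars-* f g []          = refl
    raiseVars-* f g (zero ∷ α)  = refl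
    raiseVars-* f g (suc a ∷ α) =
      sym (⊛-suc-zero (coeff (raiseVars f)) (coeff (raiseVars g)) a α (λ _ _ → refl) (λ _ _ → refl))

    raiseVars-isHomomorphism : IsRingHomomorphism S.rawRing S.rawRing raiseVars
    raiseVars-isHomomorphism = record
      { isSemiringHomomorphism = record
        { isNearSemiringHomomorphism = record
          { +-isMonoidHomomorphism = record
            { isMagmaHomomorphism = record
              { isRelHomomorphism = record { cong = λ { e [] → e [] ; e (zero ∷ α) → e α ; e (suc _ ∷ α) → refl } }
              ; homo = λ { f g [] → refl ; f g (zero ∷ α) → refl ; f g (suc _ ∷ α) → sym (+-identityˡ 0#) } }
            ; ε-homo = λ { [] → refl ; (zero ∷ α) → refl ; (suc _ ∷ α) → refl } }
          ; *-homo = raiseVars-* }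
        ; 1#-homo = λ { [] → refl ; (zero ∷ α) → refl ; (suc _ ∷ α) → refl } }
      ; -‿homo = λ { f [] → refl ; f (zero ∷ α) → refl ; f (suc _ ∷ α) → sym (RingProperties.-0#≈0# ring) } }

    module raiseVars = HomomorphismProperties S.commutativeRing S.commutativeRing raiseVars-isHomomorphism

    inVar-suc : ∀ n f → inVar (suc n) f ≋ raiseVars (inVar n f)
    inVar-suc n       f (zero ∷ α)  = refl
    inVar-suc n       f (suc _ ∷ α) = refl
    inVar-suc zero    f []          = refl
    inVar-suc (suc n) f []          = refl

    coeff-first-var : ∀ f g a α → coeff (inVar 0 f ⊗ raiseVars g) (a ∷ α) ≈ f a * coeff g α
    coeff-first-var f g a α = trans
      (conv-only-last a (⊛-at (coeff (inVar 0 f)) (coeff (raiseVars g)) α)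
        λ i j → ⊛-zeroʳ (constant (f i)) (λ β → 0#) (λ β → refl) α)
      (constant-⊛ (f a) (coeff g) α)

  -- Each row involves a variable of its own, so the coefficient can be taken row by row. In the
  -- expansion along the first row the minors are free of the first variable: they are images under
  -- `raiseVars` of determinants of the same shape.
  coeff-Det : ∀ {n} (N : Fin n → Fin n → ℕ → Carrier) (a : Fin n → ℕ) →
              coeff (DS.Det λ r c → inVar (toℕ r) (N r c)) (tabulate a) ≈ DA.Det λ r c → N r c (a r)
  coeff-Det {zero}  N a = trans (DS.Det-zero (λ r c → inVar (toℕ r) (N r c)) []) (sym (DA.Det-zero _))
  coeff-Det {suc n} N a = begin
    coeff (DS.Det M) (tabulate a)
      ≈⟨ DS.Det-suc M (tabulate a) ⟩
    coeff (ΣS.∑ λ j → DS.sgn j S.* (M fzero j S.* DS.Det λ r c → M (fsuc r) (punchIn j c))) (tabulate a)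
      ≈⟨ coeff-∑ _ (tabulate a) ⟩
    (∑ λ j → coeff (DS.sgn j S.* (M fzero j S.* DS.Det λ r c → M (fsuc r) (punchIn j c))) (tabulate a))
      ≈⟨ ∑-cong (λ j → begin
           coeff (DS.sgn j S.* (M fzero j S.* DS.Det λ r c → M (fsuc r) (punchIn j c))) (tabulate a)
             ≈⟨ ⊛-cong (λ β → sym (const.sgn-homo j β))
                  (⊛-cong {coeff (M fzero j)} (λ β → refl) (minor j)) (tabulate a) ⟩
           coeff (const (DA.sgn j) S.* (M fzero j S.* raiseVars (M′ j))) (tabulate a)
             ≈⟨ constant-⊛ (DA.sgn j) (coeff (M fzero j S.* raiseVars (M′ j))) (tabulate a) ⟩
           DA.sgn j * coeff (M fzero j S.* raiseVars (M′ j)) (tabulate a)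
             ≈⟨ *-congˡ (coeff-first-var (N fzero j) (M′ j) (a fzero) (tabulate (a ∘ fsuc))) ⟩
           DA.sgn j * (N fzero j (a fzero) * coeff (M′ j) (tabulate (a ∘ fsuc)))
             ≈⟨ *-congˡ (*-congˡ (coeff-Det (λ r c → N (fsuc r) (punchIn j c)) (a ∘ fsuc))) ⟩
           DA.sgn j * (N fzero j (a fzero) * DA.Det λ r c → N (fsuc r) (punchIn j c) (a (fsuc r))) ∎) ⟩
    (∑ λ j → DA.sgn j * (N fzero j (a fzero) * DA.Det λ r c → N (fsuc r) (punchIn j c) (a (fsuc r))))
      ≈⟨ DA.Det-suc _ ⟨
    DA.Det (λ r c → N r c (a r)) ∎
    where
    M : Fin (suc n) → Fin (suc n) → Series
    M r c = inVar (toℕ r) (N r c)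

    M′ : Fin (suc n) → Series
    M′ j = DS.Det λ r c → inVar (toℕ r) (N (fsuc r) (punchIn j c))

    minor : ∀ j α → coeff (DS.Det λ r c → M (fsuc r) (punchIn j c)) α ≈ coeff (raiseVars (M′ j)) α
    minor j α = trans (DS.Det-cong (λ r c → inVar-suc (toℕ r) (N (fsuc r) (punchIn j c))) α)
      (sym (raiseVars.Det-homo (λ r c → inVar (toℕ r) (N (fsuc r) (punchIn j c))) α))

  module Lift {D : Carrier → Carrier} (isDerivation : IsDerivation A D) where
    open DerivationProperties A isDerivation using (D-cong; D-+; D-ι*; D-*; D-0)

    lift : Series → Series
    lift f = series (λ α → D (coeff f α)) (λ α → D-cong (trailing f α))

    lift-⊛ : ∀ f g α → D ((f ⊛ g) α) ≈ ((D ∘ f) ⊛ g) α + (f ⊛ (D ∘ g)) α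
    lift-⊛ f g []      = D-* _ _
    lift-⊛ f g (a ∷ α) = trans (conv-additive A A D-+ a _) (trans (conv-cong a λ i j → lift-⊛ _ _ α) (conv-+ a _ _))

    lift-isDerivation : IsDerivation algebra lift
    lift-isDerivation = record
      { D-cong = λ e α → D-cong (e α)
      ; D-+    = λ f g α → D-+ _ _
      ; D-ι*   = λ c f α → trans (D-cong (constant-⊛ (ι c) (coeff f) α))
                   (trans (D-ι* c _) (sym (constant-⊛ (ι c) (D ∘ coeff f) α)))
      ; D-*    = λ f g → lift-⊛ (coeff f) (coeff g) }

    lift-const : ∀ x → lift (const x) ≋ const (D x)
    lift-const x α = sym (constant-map D D-0 x (D x) α refl)

    lift-inVar : ∀ n f → lift (inVar n f) ≋ inVar n (D ∘ f)
    lift-inVar n f α = sym (inVar-map n f (D ∘ f) D D-0 (λ m → refl) (constant-map D D-0) α)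

  private
    sum-trailing : ∀ α → sum (α ∷ʳ 0) ≡ sum α
    sum-trailing α = ≡.trans (sum-++ α (0 ∷ [])) (ℕ.+-identityʳ (sum α))

  θ : Series → Series
  θ f = series (λ α → ⟨ sum α ⟩ * coeff f α)
    (λ α → *-cong (reflexive (≡.cong ⟨_⟩ (sum-trailing α))) (trailing f α))

  -- `m` and `n` are the exponents already read off the two factors when the recursion has passed
  -- some variables; for m = n = 0 this is the Leibniz rule for θ.
  θ-⊛ : ∀ m n f g α → ⟨ m ℕ.+ n ℕ.+ sum α ⟩ * (f ⊛ g) α ≈
        ((λ β → ⟨ m ℕ.+ sum β ⟩ * f β) ⊛ g) α + (f ⊛ (λ β → ⟨ n ℕ.+ sum β ⟩ * g β)) α
  θ-⊛ m n f g [] = begin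
    ⟨ m ℕ.+ n ℕ.+ 0 ⟩ * (f [] * g [])
      ≈⟨ *-congʳ (trans (reflexive (≡.cong ⟨_⟩ (regroup m n))) (⟨+⟩ (m ℕ.+ 0) (n ℕ.+ 0))) ⟩
    (⟨ m ℕ.+ 0 ⟩ + ⟨ n ℕ.+ 0 ⟩) * (f [] * g [])
      ≈⟨ distribʳ _ _ _ ⟩
    ⟨ m ℕ.+ 0 ⟩ * (f [] * g []) + ⟨ n ℕ.+ 0 ⟩ * (f [] * g [])
      ≈⟨ +-cong (sym (*-assoc _ _ _)) (x∙yz≈y∙xz _ _ _) ⟩
    ⟨ m ℕ.+ 0 ⟩ * f [] * g [] + f [] * (⟨ n ℕ.+ 0 ⟩ * g []) ∎
    where
    regroup : ∀ m n → m ℕ.+ n ℕ.+ 0 ≡ m ℕ.+ 0 ℕ.+ (n ℕ.+ 0)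
    regroup = solve-∀
  θ-⊛ m n f g (a ∷ α) = begin
    ⟨ m ℕ.+ n ℕ.+ (a ℕ.+ sum α) ⟩ * conv a φ
      ≈⟨ *-distribˡ-conv _ a φ ⟩
    conv a (λ i j → ⟨ m ℕ.+ n ℕ.+ (a ℕ.+ sum α) ⟩ * φ i j)
      ≈⟨ conv-cong-bounded a (λ i j i+j≡a → trans
           (*-congʳ (reflexive (≡.cong ⟨_⟩ (≡.trans (≡.cong (λ a → m ℕ.+ n ℕ.+ (a ℕ.+ sum α)) (≡.sym i+j≡a)) (regroup m n i j (sum α))))))
           (trans (θ-⊛ (m ℕ.+ i) (n ℕ.+ j) (f ∘ (i ∷_)) (g ∘ (j ∷_)) α)
             (+-cong (⊛-cong (λ β → *-congʳ (reflexive (≡.cong ⟨_⟩ (ℕ.+-assoc m i (sum β))))) (λ β → refl) α)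
                     (⊛-cong (λ β → refl) (λ β → *-congʳ (reflexive (≡.cong ⟨_⟩ (ℕ.+-assoc n j (sum β))))) α)))) ⟩
    conv a (λ i j → ψ₁ i j + ψ₂ i j)
      ≈⟨ conv-+ a ψ₁ ψ₂ ⟩
    conv a ψ₁ + conv a ψ₂ ∎
    where
    φ ψ₁ ψ₂ : ℕ → ℕ → Carrier
    φ i j = ((f ∘ (i ∷_)) ⊛ (g ∘ (j ∷_))) α
    ψ₁ i j = ((λ β → ⟨ m ℕ.+ sum (i ∷ β) ⟩ * f (i ∷ β)) ⊛ (g ∘ (j ∷_))) α
    ψ₂ i j = ((f ∘ (i ∷_)) ⊛ (λ β → ⟨ n ℕ.+ sum (j ∷ β) ⟩ * g (j ∷ β))) α

    regroup : ∀ m n i j s → m ℕ.+ n ℕ.+ (i ℕ.+ j ℕ.+ s) ≡ m ℕ.+ i ℕ.+ (n ℕ.+ j) ℕ.+ s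
    regroup = solve-∀

  θ-isDerivation : IsDerivation algebra θ
  θ-isDerivation = record
    { D-cong = λ e α → *-congˡ (e α)
    ; D-+    = λ f g α → distribˡ _ _ _
    ; D-ι*   = λ c f α → trans (*-congˡ (constant-⊛ (ι c) (coeff f) α))
                 (trans (x∙yz≈y∙xz _ _ _) (sym (constant-⊛ (ι c) (λ β → ⟨ sum β ⟩ * coeff f β) α)))
    ; D-*    = λ f g → θ-⊛ 0 0 (coeff f) (coeff g) }

  θ-z : ∀ n → θ (z n) ≋ z n
  θ-z n []       = trans (*-congʳ ⟨0⟩≈0) (zeroˡ _)
  θ-z zero (zero ∷ α) = trans (*-congˡ (constant-0 α)) (trans (zeroʳ _) (sym (constant-0 α)))
  θ-z zero (suc zero ∷ α) = go α
    where
    go : ∀ α → ⟨ suc (sum α) ⟩ * constant 1# α ≈ constant 1# α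
    go []          = trans (*-congʳ ⟨1⟩≈1) (*-identityˡ _)
    go (zero ∷ α)  = go α
    go (suc _ ∷ α) = zeroʳ _
  θ-z zero (suc (suc _) ∷ α) = trans (*-congˡ (constant-0 α)) (trans (zeroʳ _) (sym (constant-0 α)))
  θ-z (suc n) (zero ∷ α) = θ-z n α
  θ-z (suc n) (suc _ ∷ α) = zeroʳ _

  θ-const : ∀ x → θ (const x) ≋ S.0#
  θ-const x []          = trans (*-congʳ ⟨0⟩≈0) (zeroˡ _)
  θ-const x (zero ∷ α)  = θ-const x α
  θ-const x (suc _ ∷ α) = zeroʳ _

  Order≥ : ℕ → Series → Set
  Order≥ m f = ∀ α → sum α ℕ.< m → coeff f α ≈ 0#

  -- As in `θ-⊛`, `p` and `q` account for the variables already passed. At the end of the list one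
  -- of the two factors must still lie below its order.
  ⊛-order : ∀ m n p q f g →
            (∀ α → p ℕ.+ sum α ℕ.< m → f α ≈ 0#) → (∀ α → q ℕ.+ sum α ℕ.< n → g α ≈ 0#) →
            ∀ α → p ℕ.+ q ℕ.+ sum α ℕ.< m ℕ.+ n → (f ⊛ g) α ≈ 0#
  ⊛-order m n p q f g of og []      lt with p ℕ.+ 0 ℕ.<? m
  ... | yes p<m = trans (*-congʳ (of [] p<m)) (zeroˡ _)
  ... | no  p≮m = trans (*-congˡ (og [] q<n)) (zeroʳ _)
    where
    regroup : ∀ p q → p ℕ.+ q ℕ.+ 0 ≡ p ℕ.+ 0 ℕ.+ (q ℕ.+ 0)
    regroup = solve-∀
    q<n : q ℕ.+ 0 ℕ.< n
    q<n = ℕ.+-cancelˡ-< m (q ℕ.+ 0) n (ℕ.≤-<-trans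
            (ℕ.+-monoˡ-≤ (q ℕ.+ 0) (ℕ.≮⇒≥ p≮m)) (≡.subst (ℕ._< m ℕ.+ n) (regroup p q) lt))
  ⊛-order m n p q f g of og (a ∷ α) lt = conv-0 a _ λ i j i+j≡a →
    ⊛-order m n (p ℕ.+ i) (q ℕ.+ j) _ _
      (λ β → of (i ∷ β) ∘ ≡.subst (ℕ._< m) (ℕ.+-assoc p i (sum β)))
      (λ β → og (j ∷ β) ∘ ≡.subst (ℕ._< n) (ℕ.+-assoc q j (sum β)))
      α (≡.subst (ℕ._< m ℕ.+ n)
          (≡.trans (≡.cong (λ a → p ℕ.+ q ℕ.+ (a ℕ.+ sum α)) (≡.sym i+j≡a)) (regroup p q i j (sum α))) lt)
    where
    regroup : ∀ m n i j s → m ℕ.+ n ℕ.+ (i ℕ.+ j ℕ.+ s) ≡ m ℕ.+ i ℕ.+ (n ℕ.+ j) ℕ.+ s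
    regroup = solve-∀

  Order-z : ∀ n → Order≥ 1 (z n)
  Order-z n α (s≤s lt) = inVar-degree-0 n (shift δ₀) α (ℕ.n≤0⇒n≡0 lt)

  filtration : Filtration algebra
  filtration = record
    { Order≥     = Order≥
    ; Order-cong = λ e o α lt → trans (sym (e α)) (o α lt)
    ; Order-0#   = λ m α lt → refl
    ; Order-+    = λ o p α lt → trans (+-cong (o α lt) (p α lt)) (+-identityˡ 0#)
    ; Order-*    = λ {m} {n} {f} {g} → ⊛-order m n 0 0 (coeff f) (coeff g)
    ; Order-any  = λ f α ()
    ; Order-mono = λ m≤n o α lt → o α (ℕ.<-≤-trans lt m≤n)
    ; θ          = θ
    ; θ-isDerivation = θ-isDerivation
    ; Order-θ    = λ {m} {f} → order-θ {m} {f} }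
    where
    order-θ : ∀ {m f} → Order≥ (suc m) f → Order≥ (suc (suc m)) (θ f) → Order≥ (suc (suc m)) f
    order-θ {m} {f} o oθ α lt with sum α ℕ.<? suc m
    ... | yes lt′ = o α lt′
    ... | no  ≮   = torsion-free m (trans (*-congʳ (reflexive (≡.cong ⟨_⟩ (≡.sym eq)))) (oθ α lt))
      where
      eq : sum α ≡ suc m
      eq = ℕ.≤-antisym (ℕ.≤-pred lt) (ℕ.≮⇒≥ ≮)

-- Generating functions over a ℚ-algebra and extraction of coefficients

module GeneratingFunctions
  (A : ℚ-Algebra) (D D̃ : ℕ → ℚ-Algebra.Carrier A → ℚ-Algebra.Carrier A)
  (isD : ∀ n → IsDerivation A (D n)) (isD̃ : ∀ n → IsDerivation A (D̃ n))
  (h h̃ : ℕ → ℚ-Algebra.Carrier A)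
  (D-h : DerivationTypes.LowersIndex A D h) (D̃-h : DerivationTypes.Annihilates A D̃ h)
  (D-h̃ : DerivationTypes.Annihilates A D h̃) (D̃-h̃ : DerivationTypes.LowersIndex A D̃ h̃)
  where

  open ℚ-Algebra A hiding (zero)
  open Sequences A

  private
    -- `B` adjoins the tₖ to `A`, and `C` adjoins the uᵢ to `B`. With the uᵢ outermost, the order on
    -- `C` counts them alone, and the tₖ are scalars that θ kills.
    B : ℚ-Algebra
    B = PowerSeries.algebra A

    C : ℚ-Algebra
    C = PowerSeries.algebra B

    module B = ℚ-Algebra B
    module C = ℚ-Algebra C
    module PA = PowerSeries A
    module PB = PowerSeries B
    module SA = SeriesProperties A
    module SB = SeriesProperties B
    module BSeq = Sequences B
    module DA = DeterminantProperties commutativeRing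
    module DB = DeterminantProperties B.commutativeRing
    module DC = DeterminantProperties C.commutativeRing
    module ΣA = FiniteSums commutativeRing
    module ΣB = FiniteSums B.commutativeRing
    module ΣC = FiniteSums C.commutativeRing
    module ^B = RawSemiringOps (Semiring.rawSemiring B.semiring)
    module ^C = RawSemiringOps (Semiring.rawSemiring C.semiring)
    module LA {E : Carrier → Carrier} (isE : IsDerivation A E) = SA.Lift isE
    module LB {E : B.Carrier → B.Carrier} (isE : IsDerivation B E) = SB.Lift isE

    lift² : {E : Carrier → Carrier} → IsDerivation A E → C.Carrier → C.Carrier
    lift² isE = LB.lift (LA.lift-isDerivation isE)

    lift²-isDerivation : {E : Carrier → Carrier} (isE : IsDerivation A E) → IsDerivation C (lift² isE)
    lift²-isDerivation isE = LB.lift-isDerivation (LA.lift-isDerivation isE)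

    κ : Carrier → B.Carrier
    κ = PA.const

    τ η : ℕ → B.Carrier
    τ k = SA.z k
    η k = SA.inVar k h

    t u H H̃ : ℕ → C.Carrier
    t k = PB.const (τ k)
    u i = SB.z i
    H k = PB.const (η k)
    H̃ i = SB.inVar i (κ ∘ h̃)

    -- The inverse of 1 - tₖ uᵢ as an explicit series in uᵢ. The action of Δ uses it through
    -- `c-geometric` only; its coefficients serve to read off the final determinant.
    c : ℕ → ℕ → C.Carrier
    c i k = SB.inVar i (τ k ^B.^_)

    ητ : ∀ k r → η k B.* (τ k ^B.^ r) B.≈ SA.inVar k (shiftⁿ r h)
    ητ k r α = trans (B.*-comm (η k) (τ k ^B.^ r) α) (SA.z^-* k r h α)

    lift²-const : ∀ {E} (isE : IsDerivation A E) k f →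
                  lift² isE (PB.const (SA.inVar k f)) C.≈ PB.const (SA.inVar k (E ∘ f))
    lift²-const {E} isE k f β = begin
      PB.coeff (lift² isE (PB.const (SA.inVar k f))) β
        ≈⟨ LB.lift-const (LA.lift-isDerivation isE) (SA.inVar k f) β ⟩
      PB.constant (LA.lift isE (SA.inVar k f)) β
        ≈⟨ PB.constant-cong {LA.lift isE (SA.inVar k f)} {SA.inVar k (E ∘ f)} (LA.lift-inVar isE k f) β ⟩
      PB.constant (SA.inVar k (E ∘ f)) β ∎
      where open SetoidReasoning B.setoid

    lift²-inVar : ∀ {E} (isE : IsDerivation A E) i f →
                  lift² isE (SB.inVar i (κ ∘ f)) C.≈ SB.inVar i (κ ∘ E ∘ f)
    lift²-inVar {E} isE i f β = begin
      PB.coeff (lift² isE (SB.inVar i (κ ∘ f))) β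
        ≈⟨ LB.lift-inVar (LA.lift-isDerivation isE) i (κ ∘ f) β ⟩
      PB.coeff (SB.inVar i (LA.lift isE ∘ κ ∘ f)) β
        ≈⟨ SB.inVar-cong i {LA.lift isE ∘ κ ∘ f} {κ ∘ E ∘ f} (λ m → LA.lift-const isE (f m)) β ⟩
      PB.coeff (SB.inVar i (κ ∘ E ∘ f)) β ∎
      where open SetoidReasoning B.setoid

    kill-const : ∀ {E} (isE : IsDerivation A E) k f → (∀ m → E (f m) ≈ 0#) →
                 lift² isE (PB.const (SA.inVar k f)) C.≈ C.0#
    kill-const {E} isE k f e β = begin
      PB.coeff (lift² isE (PB.const (SA.inVar k f))) β
        ≈⟨ lift²-const isE k f β ⟩
      PB.constant (SA.inVar k (E ∘ f)) β
        ≈⟨ PB.constant-cong {SA.inVar k (E ∘ f)} {B.0#} (SA.inVar-0 k (E ∘ f) e) β ⟩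
      PB.constant B.0# β
        ≈⟨ PB.constant-0 β ⟩
      B.0# ∎
      where open SetoidReasoning B.setoid

    kill-inVar : ∀ {E} (isE : IsDerivation A E) i f → (∀ m → E (f m) ≈ 0#) →
                 lift² isE (SB.inVar i (κ ∘ f)) C.≈ C.0#
    kill-inVar {E} isE i f e β = begin
      PB.coeff (lift² isE (SB.inVar i (κ ∘ f))) β
        ≈⟨ lift²-inVar isE i f β ⟩
      PB.coeff (SB.inVar i (κ ∘ E ∘ f)) β
        ≈⟨ SB.inVar-0 i (κ ∘ E ∘ f) (λ m α → trans (PA.constant-cong (e m) α) (PA.constant-0 α)) β ⟩
      B.0# ∎
      where open SetoidReasoning B.setoid

    kill-shift-δ₀ : ∀ {E} (isE : IsDerivation A E) m → E (shift δ₀ m) ≈ 0#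
    kill-shift-δ₀ isE zero          = DerivationProperties.D-0 A isE
    kill-shift-δ₀ isE (suc zero)    = DerivationProperties.D-1 A isE
    kill-shift-δ₀ isE (suc (suc m)) = DerivationProperties.D-0 A isE

    κ-shift-δ₀ : ∀ m → BSeq.shift BSeq.δ₀ m B.≈ κ (shift δ₀ m)
    κ-shift-δ₀ zero          α = sym (PA.constant-0 α)
    κ-shift-δ₀ (suc zero)    α = refl
    κ-shift-δ₀ (suc (suc m)) α = sym (PA.constant-0 α)

    kill-u : ∀ {E} (isE : IsDerivation A E) i → lift² isE (u i) C.≈ C.0#
    kill-u isE i β = begin
      PB.coeff (lift² isE (u i)) β
        ≈⟨ IsDerivation.D-cong (lift²-isDerivation isE) {u i} {SB.inVar i (κ ∘ shift δ₀)}
             (SB.inVar-cong i {BSeq.shift BSeq.δ₀} {κ ∘ shift δ₀} κ-shift-δ₀) β ⟩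
      PB.coeff (lift² isE (SB.inVar i (κ ∘ shift δ₀))) β
        ≈⟨ kill-inVar isE i (shift δ₀) (kill-shift-δ₀ isE) β ⟩
      B.0# ∎
      where open SetoidReasoning B.setoid

    κ-shiftⁿ : ∀ n (f : ℕ → Carrier) m → BSeq.shiftⁿ n (κ ∘ f) m B.≈ κ (shiftⁿ n f m)
    κ-shiftⁿ zero    f m       α = refl
    κ-shiftⁿ (suc n) f zero    α = sym (PA.constant-0 α)
    κ-shiftⁿ (suc n) f (suc m) α = κ-shiftⁿ n f m α

    -- The lifted derivation acts on coefficients, and lowering the index of every h by n + 1 is
    -- multiplication of the series by tₖⁿ⁺¹.
    lift-H : ∀ {E} (isE : IsDerivation A E) n → (∀ m → E (h m) ≈ ι (reciprocal n) * shiftⁿ (suc n) h m) →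
             ∀ k → lift² isE (H k) C.≈ C.ι (reciprocal n) C.* (t k ^C.^ suc n) C.* H k
    lift-H {E} isE n e k β = begin
      PB.coeff (lift² isE (H k)) β
        ≈⟨ lift²-const isE k h β ⟩
      PB.constant (SA.inVar k (E ∘ h)) β
        ≈⟨ PB.constant-cong {SA.inVar k (E ∘ h)} {ιr B.* τⁿ B.* η k} inB β ⟩
      PB.constant (ιr B.* τⁿ B.* η k) β
        ≈⟨ SB.const.*-homo (ιr B.* τⁿ) (η k) β ⟩
      PB.coeff (PB.const (ιr B.* τⁿ) C.* H k) β
        ≈⟨ C.*-congʳ {H k} {PB.const (ιr B.* τⁿ)} {PB.const ιr C.* PB.const τⁿ} (SB.const.*-homo ιr τⁿ) β ⟩
      PB.coeff (PB.const ιr C.* PB.const τⁿ C.* H k) β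
        ≈⟨ C.*-congʳ {H k} {PB.const ιr C.* PB.const τⁿ} {PB.const ιr C.* (t k ^C.^ suc n)}
             (C.*-congˡ {PB.const ιr} {PB.const τⁿ} {t k ^C.^ suc n} (SB.const.^-homo (τ k) (suc n))) β ⟩
      PB.coeff (C.ι (reciprocal n) C.* (t k ^C.^ suc n) C.* H k) β ∎
      where
      open SetoidReasoning B.setoid
      ιr τⁿ : B.Carrier
      ιr = B.ι (reciprocal n)
      τⁿ = τ k ^B.^ suc n

      inB : SA.inVar k (E ∘ h) B.≈ ιr B.* τⁿ B.* η k
      inB α = trans (SA.inVar-cong k e α)
        (trans (sym (SA.inVar-scale k (ι (reciprocal n)) (shiftⁿ (suc n) h) α))
        (trans (PA.⊛-cong {PA.coeff ιr} (λ γ → refl) (λ γ → sym (SA.z^-* k (suc n) h γ)) α)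
        (sym (B.*-assoc ιr τⁿ (η k) α))))

    lift-H̃ : ∀ {E} (isE : IsDerivation A E) n → (∀ m → E (h̃ m) ≈ ι (reciprocal n) * shiftⁿ (suc n) h̃ m) →
             ∀ i → lift² isE (H̃ i) C.≈ C.ι (reciprocal n) C.* (u i ^C.^ suc n) C.* H̃ i
    lift-H̃ {E} isE n e i β = begin
      PB.coeff (lift² isE (H̃ i)) β
        ≈⟨ lift²-inVar isE i h̃ β ⟩
      PB.coeff (SB.inVar i (κ ∘ E ∘ h̃)) β
        ≈⟨ SB.inVar-cong i {κ ∘ E ∘ h̃} {λ m → B.ι (reciprocal n) B.* BSeq.shiftⁿ (suc n) (κ ∘ h̃) m} inB β ⟩
      PB.coeff (SB.inVar i (λ m → B.ι (reciprocal n) B.* BSeq.shiftⁿ (suc n) (κ ∘ h̃) m)) β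
        ≈⟨ SB.inVar-scale i (B.ι (reciprocal n)) (BSeq.shiftⁿ (suc n) (κ ∘ h̃)) β ⟨
      PB.coeff (C.ι (reciprocal n) C.* SB.inVar i (BSeq.shiftⁿ (suc n) (κ ∘ h̃))) β
        ≈⟨ C.*-congˡ {C.ι (reciprocal n)} {(u i ^C.^ suc n) C.* H̃ i} {SB.inVar i (BSeq.shiftⁿ (suc n) (κ ∘ h̃))}
             (SB.z^-* i (suc n) (κ ∘ h̃)) β ⟨
      PB.coeff (C.ι (reciprocal n) C.* ((u i ^C.^ suc n) C.* H̃ i)) β
        ≈⟨ C.*-assoc (C.ι (reciprocal n)) (u i ^C.^ suc n) (H̃ i) β ⟨
      PB.coeff (C.ι (reciprocal n) C.* (u i ^C.^ suc n) C.* H̃ i) β ∎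
      where
      open SetoidReasoning B.setoid
      inB : ∀ m → κ (E (h̃ m)) B.≈ B.ι (reciprocal n) B.* BSeq.shiftⁿ (suc n) (κ ∘ h̃) m
      inB m α = trans (PA.constant-cong (e m) α) (trans (SA.const.*-homo (ι (reciprocal n)) (shiftⁿ (suc n) h̃ m) α)
        (PA.⊛-cong {PA.coeff (B.ι (reciprocal n))} (λ γ → refl) (λ γ → sym (κ-shiftⁿ (suc n) h̃ m γ)) α))

    c-geometric : ∀ i k → c i k C.≈ C.1# C.+ u i C.* (t k C.* c i k)
    c-geometric i k β = begin
      PB.coeff (c i k) β
        ≈⟨ SB.inVar-cong i {τ k ^B.^_} {λ m → BSeq.δ₀ m B.+ BSeq.shift τ⁺ m} split β ⟩
      PB.coeff (SB.inVar i (λ m → BSeq.δ₀ m B.+ BSeq.shift τ⁺ m)) β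
        ≈⟨ SB.inVar-+ i BSeq.δ₀ (BSeq.shift τ⁺) β ⟩
      PB.coeff (SB.inVar i BSeq.δ₀ C.+ SB.inVar i (BSeq.shift τ⁺)) β
        ≈⟨ C.+-cong {SB.inVar i BSeq.δ₀} {C.1#} {SB.inVar i (BSeq.shift τ⁺)} {u i C.* SB.inVar i τ⁺}
             (SB.inVar-δ₀ i) (C.sym {u i C.* SB.inVar i τ⁺} {SB.inVar i (BSeq.shift τ⁺)} (SB.z-* i τ⁺)) β ⟩
      PB.coeff (C.1# C.+ u i C.* SB.inVar i τ⁺) β
        ≈⟨ C.+-congˡ {C.1#} {u i C.* (t k C.* c i k)} {u i C.* SB.inVar i τ⁺}
             (C.*-congˡ {u i} {t k C.* c i k} {SB.inVar i τ⁺} (SB.inVar-scale i (τ k) (τ k ^B.^_))) β ⟨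
      PB.coeff (C.1# C.+ u i C.* (t k C.* c i k)) β ∎
      where
      open SetoidReasoning B.setoid
      τ⁺ : ℕ → B.Carrier
      τ⁺ m = τ k B.* (τ k ^B.^ m)

      split : ∀ m → τ k ^B.^ m B.≈ BSeq.δ₀ m B.+ BSeq.shift τ⁺ m
      split zero    α = sym (+-identityʳ _)
      split (suc m) α = sym (+-identityˡ _)

    module _ {d : ℕ} where

      at : (ℕ → C.Carrier) → Fin d → C.Carrier
      at f k = f (toℕ k)

      open GeneratingFunctionKernel.Derivations.Kernel C SB.filtration
        (λ n → lift² (isD n)) (λ n → lift² (isD̃ n))
        (λ n → lift²-isDerivation (isD n)) (λ n → lift²-isDerivation (isD̃ n))
        {d} (at t) (at u) (at H) (at H̃) (λ i k → c (toℕ i) (toℕ k))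
        (λ i → SB.Order-z (toℕ i)) (λ i → SB.θ-z (toℕ i)) (λ k → SB.θ-const (τ (toℕ k)))
        (λ i k → c-geometric (toℕ i) (toℕ k))
        (λ k n → kill-const (isD n) (toℕ k) (shift δ₀) (kill-shift-δ₀ (isD n)) ,
                 kill-const (isD̃ n) (toℕ k) (shift δ₀) (kill-shift-δ₀ (isD̃ n)))
        (λ i n → kill-u (isD n) (toℕ i) , kill-u (isD̃ n) (toℕ i))
        (λ n k → lift-H (isD n) n (D-h n) (toℕ k)) (λ n k → kill-const (isD̃ n) (toℕ k) h (D̃-h n))
        (λ n i → kill-inVar (isD n) (toℕ i) h̃ (D-h̃ n)) (λ n i → lift-H̃ (isD̃ n) n (D̃-h̃ n) (toℕ i))
        public

  module _ {d : ℕ} (a b : Fin d → ℕ) where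

    private
      α β : List ℕ
      α = tabulate a
      β = tabulate b

      -- The coefficient at the monomial with exponents α in the tₖ and β in the uᵢ. It commutes
      -- with every cut-off of Δ because the lifted derivations act coefficientwise, and so brings
      -- identities of series back to `A`.
      Φ : C.Carrier → Carrier
      Φ f = PA.coeff (PB.coeff f β) α

      module ΔA = Delta A D D̃
      module ΔC = Delta C (λ n → lift² (isD n)) (λ n → lift² (isD̃ n))
      module EA = DeltaOnEigenvectors A D D̃ isD isD̃

      Φ-∑ : ∀ {n} (f : Fin n → C.Carrier) → Φ (ΣC.∑ f) ≈ ΣA.∑ (Φ ∘ f)
      Φ-∑ f = trans (SB.coeff-∑ f β α) (SA.coeff-∑ (λ i → PB.coeff (f i) β) α)

      Φ-ι* : ∀ x f → Φ (C.ι x C.* f) ≈ ι x * Φ f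
      Φ-ι* x f = trans (PB.constant-⊛ (B.ι x) (PB.coeff f) β α) (PA.constant-⊛ (ι x) (PA.coeff (PB.coeff f β)) α)

      Φ-iterate : ∀ n i f →
        iterate (D n ∘ D̃ n) (Φ f) i ≡ Φ (iterate (lift² (isD n) ∘ lift² (isD̃ n)) f i)
      Φ-iterate n zero    f = ≡.refl
      Φ-iterate n (suc i) f = Φ-iterate n i (lift² (isD n) (lift² (isD̃ n) f))

      Φ-factor : ∀ I n f → ΔA.factor I n (Φ f) ≈ Φ (ΔC.factor I n f)
      Φ-factor I n f = begin
        ΔA.factor I n (Φ f)
          ≈⟨ ΣA.∑≈sum {I} _ ⟨
        ΣA.∑ {I} (λ i → ι (exp-weight (suc n) (toℕ i)) * iterate (D n ∘ D̃ n) (Φ f) (toℕ i))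
          ≈⟨ ΣA.∑-cong (λ i → trans (*-congˡ (reflexive (Φ-iterate n (toℕ i) f)))
               (sym (Φ-ι* (exp-weight (suc n) (toℕ i)) (f^ (toℕ i))))) ⟩
        ΣA.∑ {I} (λ i → Φ (C.ι (exp-weight (suc n) (toℕ i)) C.* f^ (toℕ i)))
          ≈⟨ Φ-∑ {I} (λ i → C.ι (exp-weight (suc n) (toℕ i)) C.* f^ (toℕ i)) ⟨
        Φ (ΣC.∑ {I} λ i → C.ι (exp-weight (suc n) (toℕ i)) C.* f^ (toℕ i))
          ≈⟨ ΣC.∑≈sum {I} (λ i → C.ι (exp-weight (suc n) (toℕ i)) C.* f^ (toℕ i)) β α ⟩
        Φ (ΔC.factor I n f) ∎
        where
        open SetoidReasoning setoid
        f^ : ℕ → C.Carrier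
        f^ i = iterate (lift² (isD n) ∘ lift² (isD̃ n)) f i

      Φ-truncated : ∀ K I f → ΔA.truncated K I (Φ f) ≈ Φ (ΔC.truncated K I f)
      Φ-truncated zero    I f = refl
      Φ-truncated (suc K) I f = trans (EA.truncated-cong K I (Φ-factor I K f)) (Φ-truncated K I (ΔC.factor I K f))

      -- Congruent series agree below the order of the congruence, and `sum β` is the degree in the
      -- uᵢ of the coefficient taken.
      Φ-≈[] : ∀ f g → SB.Order≥ (suc (sum β)) (f C.+ C.- g) → Φ f ≈ Φ g
      Φ-≈[] f g o = RingProperties.x∙y⁻¹≈ε⇒x≈y ring (Φ f) (Φ g) (o β (ℕ.n<1+n (sum β)) α)

      U T : Fin d → Fin d → C.Carrier
      U i j = u (toℕ i) ^C.^ toℕ j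
      T j k = t (toℕ k) ^C.^ toℕ j

      ∏H ∏H̃ : C.Carrier
      ∏H = ΣC.∏ {d} (at H)
      ∏H̃ = ΣC.∏ {d} (at H̃)

      S S̃ : Carrier
      S = DA.Det {d} λ r k → shiftⁿ (toℕ r) h (a k)
      S̃ = DA.Det {d} λ r k → shiftⁿ (toℕ k) h̃ (b r)

      P : B.Carrier
      P = DB.Det {d} λ r k → η (toℕ k) B.* (τ (toℕ k) ^B.^ toℕ r)

      ∏H*T : ∏H C.* DC.Det T C.≈ PB.const P
      ∏H*T γ = begin
        PB.coeff (∏H C.* DC.Det T) γ
          ≈⟨ DC.Det-scale-columns (at H) T γ ⟨
        PB.coeff (DC.Det λ r k → H (toℕ k) C.* T r k) γ
          ≈⟨ DC.Det-cong {M = λ r k → PB.const (η (toℕ k) B.* (τ (toℕ k) ^B.^ toℕ r))} {N = λ r k → H (toℕ k) C.* T r k} (λ r k δ → entry (toℕ r) (toℕ k) δ) γ ⟨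
        PB.coeff (DC.Det λ r k → PB.const (η (toℕ k) B.* (τ (toℕ k) ^B.^ toℕ r))) γ
          ≈⟨ SB.const.Det-homo (λ r k → η (toℕ k) B.* (τ (toℕ k) ^B.^ toℕ r)) γ ⟨
        PB.coeff (PB.const P) γ ∎
        where
        open SetoidReasoning B.setoid
        entry : ∀ r k → PB.const (η k B.* (τ k ^B.^ r)) C.≈ H k C.* (t k ^C.^ r)
        entry r k δ = begin
          PB.constant (η k B.* (τ k ^B.^ r)) δ
            ≈⟨ SB.const.*-homo (η k) (τ k ^B.^ r) δ ⟩
          PB.coeff (H k C.* PB.const (τ k ^B.^ r)) δ
            ≈⟨ C.*-congˡ {H k} {PB.const (τ k ^B.^ r)} {t k ^C.^ r} (SB.const.^-homo (τ k) r) δ ⟩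
          PB.coeff (H k C.* (t k ^C.^ r)) δ ∎

      ∏H̃*U : PB.coeff (∏H̃ C.* DC.Det U) β B.≈ κ S̃
      ∏H̃*U = begin
        PB.coeff (∏H̃ C.* DC.Det U) β
          ≈⟨ DC.Det-scale-rows (at H̃) U β ⟨
        PB.coeff (DC.Det λ r k → H̃ (toℕ r) C.* U r k) β
          ≈⟨ DC.Det-cong {M = λ r k → H̃ (toℕ r) C.* U r k} {N = λ r k → SB.inVar (toℕ r) (BSeq.shiftⁿ (toℕ k) (κ ∘ h̃))}
               (λ r k → entry (toℕ r) (toℕ k)) β ⟩
        PB.coeff (DC.Det λ r k → SB.inVar (toℕ r) (BSeq.shiftⁿ (toℕ k) (κ ∘ h̃))) β
          ≈⟨ SB.coeff-Det (λ r k → BSeq.shiftⁿ (toℕ k) (κ ∘ h̃)) b ⟩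
        DB.Det (λ r k → BSeq.shiftⁿ (toℕ k) (κ ∘ h̃) (b r))
          ≈⟨ DB.Det-cong {M = λ r k → BSeq.shiftⁿ (toℕ k) (κ ∘ h̃) (b r)} {N = λ r k → κ (shiftⁿ (toℕ k) h̃ (b r))}
               (λ r k → κ-shiftⁿ (toℕ k) h̃ (b r)) ⟩
        DB.Det (λ r k → κ (shiftⁿ (toℕ k) h̃ (b r)))
          ≈⟨ SA.const.Det-homo (λ r k → shiftⁿ (toℕ k) h̃ (b r)) ⟨
        κ S̃ ∎
        where
        open SetoidReasoning B.setoid
        entry : ∀ r k → H̃ r C.* (u r ^C.^ k) C.≈ SB.inVar r (BSeq.shiftⁿ k (κ ∘ h̃))
        entry r k δ = begin
          PB.coeff (H̃ r C.* (u r ^C.^ k)) δ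
            ≈⟨ C.*-comm (H̃ r) (u r ^C.^ k) δ ⟩
          PB.coeff ((u r ^C.^ k) C.* H̃ r) δ
            ≈⟨ SB.z^-* r k (κ ∘ h̃) δ ⟩
          PB.coeff (SB.inVar r (BSeq.shiftⁿ k (κ ∘ h̃))) δ ∎

      coeff-P : PA.coeff P α ≈ S
      coeff-P = begin
        PA.coeff P α
          ≈⟨ DB.Det-cong {M = λ r k → η (toℕ k) B.* (τ (toℕ k) ^B.^ toℕ r)} {N = λ r k → SA.inVar (toℕ k) (shiftⁿ (toℕ r) h)}
               (λ r k → ητ (toℕ k) (toℕ r)) α ⟩
        PA.coeff (DB.Det λ r k → SA.inVar (toℕ k) (shiftⁿ (toℕ r) h)) α
          -- Here each column has its own variable, whereas `coeff-Det` expects one variable for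
          -- each row.
          ≈⟨ DB.Det-transpose (λ r k → SA.inVar (toℕ r) (shiftⁿ (toℕ k) h)) α ⟩
        PA.coeff (DB.Det λ r k → SA.inVar (toℕ r) (shiftⁿ (toℕ k) h)) α
          ≈⟨ SA.coeff-Det (λ r k → shiftⁿ (toℕ k) h) a ⟩
        DA.Det (λ r k → shiftⁿ (toℕ k) h (a r))
          ≈⟨ DA.Det-transpose (λ r k → shiftⁿ (toℕ r) h (a k)) ⟩
        S ∎
        where open SetoidReasoning setoid

      -- The product separates: one factor is free of the uᵢ, and the coefficient of the other at β
      -- is free of the tₖ.
      Φ-source : Φ (DC.Det U C.* DC.Det T C.* (∏H C.* ∏H̃)) ≈ S * S̃
      Φ-source = begin
        Φ (DC.Det U C.* DC.Det T C.* (∏H C.* ∏H̃))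
          ≈⟨ SemiringIdentities.reorder C.commutativeRing (DC.Det U) (DC.Det T) ∏H ∏H̃ β α ⟩
        Φ ((∏H C.* DC.Det T) C.* (∏H̃ C.* DC.Det U))
          ≈⟨ C.*-congʳ {∏H̃ C.* DC.Det U} {∏H C.* DC.Det T} {PB.const P} ∏H*T β α ⟩
        Φ (PB.const P C.* (∏H̃ C.* DC.Det U))
          ≈⟨ PB.constant-⊛ P (PB.coeff (∏H̃ C.* DC.Det U)) β α ⟩
        PA.coeff (P B.* PB.coeff (∏H̃ C.* DC.Det U) β) α
          ≈⟨ B.*-congˡ {P} {PB.coeff (∏H̃ C.* DC.Det U) β} {κ S̃} ∏H̃*U α ⟩
        PA.coeff (P B.* κ S̃) α
          ≈⟨ B.*-comm P (κ S̃) α ⟩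
        PA.coeff (κ S̃ B.* P) α
          ≈⟨ PA.constant-⊛ S̃ (PA.coeff P) α ⟩
        S̃ * PA.coeff P α
          ≈⟨ trans (*-comm _ _) (*-congʳ coeff-P) ⟩
        S * S̃ ∎
        where open SetoidReasoning setoid

      module convB = Sequences B

      inVar-conv : ∀ k n (f : ℕ → ℕ → ℕ → Carrier) →
        convB.conv n (λ i j → SA.inVar k (f i j)) B.≈ SA.inVar k (λ m → conv n λ i j → f i j m)
      inVar-conv k zero    f γ = refl
      inVar-conv k (suc n) f γ = trans (+-congˡ (inVar-conv k n (λ i j → f (suc i) j) γ))
        (sym (SA.inVar-+ k (f 0 (suc n)) (λ m → conv n λ i j → f (suc i) j m) γ))

      -- Row i involves only uᵢ among the outer variables, so its coefficient at `b i` can be taken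
      -- inside the determinant. In what remains, column k involves only tₖ, and the same is done
      -- after a transposition.
      Φ-target : Φ (DC.Det λ (i k : Fin d) → at H̃ i C.* (at H k C.* c (toℕ i) (toℕ k))) ≈
                 DA.Det λ r k → conv (b r) λ j l → shiftⁿ j h (a k) * h̃ l
      Φ-target = begin
        Φ (DC.Det λ (i k : Fin d) → at H̃ i C.* (at H k C.* c (toℕ i) (toℕ k)))
          ≈⟨ DC.Det-cong {M = λ i k → at H̃ i C.* (at H k C.* c (toℕ i) (toℕ k))} {N = λ i k → SB.inVar (toℕ i) (entry k)}
               (λ i k → ∏-entry (toℕ i) k) β α ⟩
        Φ (DC.Det λ i k → SB.inVar (toℕ i) (entry k))
          ≈⟨ SB.coeff-Det (λ i k → entry k) b α ⟩
        PA.coeff (DB.Det λ i k → entry k (b i)) α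
          ≈⟨ DB.Det-cong {M = λ i k → entry k (b i)} {N = λ i k → SA.inVar (toℕ k) (entry′ i)} (λ i k → entry-inVar k (b i)) α ⟩
        PA.coeff (DB.Det λ i k → SA.inVar (toℕ k) (entry′ i)) α
          ≈⟨ DB.Det-transpose (λ i k → SA.inVar (toℕ i) (entry′ k)) α ⟩
        PA.coeff (DB.Det λ i k → SA.inVar (toℕ i) (entry′ k)) α
          ≈⟨ SA.coeff-Det (λ i k → entry′ k) a ⟩
        DA.Det (λ i k → entry′ k (a i))
          ≈⟨ DA.Det-transpose (λ i k → entry′ i (a k)) ⟩
        DA.Det (λ i k → entry′ i (a k))
          ≈⟨ DA.Det-cong (λ i k → trans (conv-flip (b i) _) (conv-cong (b i) λ l j → *-comm _ _)) ⟩
        DA.Det (λ r k → conv (b r) λ j l → shiftⁿ j h (a k) * h̃ l) ∎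
        where
        open SetoidReasoning setoid
        entry : Fin d → ℕ → B.Carrier
        entry k n = convB.conv n λ l j → κ (h̃ l) B.* (η (toℕ k) B.* (τ (toℕ k) ^B.^ j))

        entry′ : Fin d → ℕ → Carrier
        entry′ i m = conv (b i) λ l j → h̃ l * shiftⁿ j h m

        ∏-entry : ∀ i k → H̃ i C.* (at H k C.* c i (toℕ k)) C.≈ SB.inVar i (entry k)
        ∏-entry i k γ δ = trans
          (C.*-congˡ {H̃ i} {at H k C.* c i (toℕ k)} {SB.inVar i (λ j → η (toℕ k) B.* (τ (toℕ k) ^B.^ j))}
            (SB.inVar-scale i (η (toℕ k)) (τ (toℕ k) ^B.^_)) γ δ)
          (SB.inVar-* i (κ ∘ h̃) (λ j → η (toℕ k) B.* (τ (toℕ k) ^B.^ j)) γ δ)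

        entry-inVar : ∀ k n → entry k n B.≈ SA.inVar (toℕ k) (λ m → conv n λ l j → h̃ l * shiftⁿ j h m)
        entry-inVar k n γ = trans
          (convB.conv-cong n {λ l j → κ (h̃ l) B.* (η (toℕ k) B.* (τ (toℕ k) ^B.^ j))} {λ l j → SA.inVar (toℕ k) λ m → h̃ l * shiftⁿ j h m}
            (λ l j δ → trans (B.*-congˡ {κ (h̃ l)} {η (toℕ k) B.* (τ (toℕ k) ^B.^ j)} {SA.inVar (toℕ k) (shiftⁿ j h)} (ητ (toℕ k) j) δ)
              (SA.inVar-scale (toℕ k) (h̃ l) (shiftⁿ j h) δ)) γ)
          (inVar-conv (toℕ k) n (λ l j m → h̃ l * shiftⁿ j h m) γ)

    Δ-Det : Delta.Δ_↝_ A D D̃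
      ((DA.Det λ (r k : Fin d) → shiftⁿ (toℕ r) h (a k)) * (DA.Det λ (r k : Fin d) → shiftⁿ (toℕ k) h̃ (b r)))
      (DA.Det λ r k → conv (b r) λ j l → shiftⁿ j h (a k) * h̃ l)
    -- One more than the degree in the uᵢ of the extracted coefficient: `Δ-kernel` with M = `sum β`
    -- then fixes that coefficient.
    Δ-Det = suc (sum β) , λ K I N≤K N≤I → begin
      ΔA.truncated K I (S * S̃)
        ≈⟨ EA.truncated-cong K I Φ-source ⟨
      ΔA.truncated K I (Φ (DC.Det U C.* DC.Det T C.* (∏H C.* ∏H̃)))
        ≈⟨ Φ-truncated K I (DC.Det U C.* DC.Det T C.* (∏H C.* ∏H̃)) ⟩
      Φ (ΔC.truncated K I (DC.Det U C.* DC.Det T C.* (∏H C.* ∏H̃)))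
        ≈⟨ Φ-≈[] (ΔC.truncated K I (DC.Det U C.* DC.Det T C.* (∏H C.* ∏H̃))) (DC.Det λ (i k : Fin d) → at H̃ i C.* (at H k C.* c (toℕ i) (toℕ k))) (Δ-kernel (sum β) K I N≤K N≤I) ⟩
      Φ (DC.Det λ (i k : Fin d) → at H̃ i C.* (at H k C.* c (toℕ i) (toℕ k)))
        ≈⟨ Φ-target ⟩
      DA.Det (λ r k → conv (b r) λ j l → shiftⁿ j h (a k) * h̃ l) ∎
      where open SetoidReasoning setoid

-- Newton's identities and the derivatives of the complete functions

-- x i and h n play the (i+1)-st power sum and the n-th complete function.

record IsNewton (A : ℚ-Algebra) (x h : ℕ → ℚ-Algebra.Carrier A) : Set where
  open ℚ-Algebra A
  open Sequences A
  open Scalars A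
  field
    h-zero : h 0 ≈ 1#
    newton : ∀ n → ⟨ suc n ⟩ * h (suc n) ≈ conv n (λ i j → x i * h j)

module NewtonDerivatives (A : ℚ-Algebra) {x h : ℕ → ℚ-Algebra.Carrier A} (isNewton : IsNewton A x h) where
  open ℚ-Algebra A hiding (zero)
  open Sequences A
  open Scalars A
  open IsNewton isNewton
  open CommSemigroupProperties *-commutativeSemigroup using (x∙yz≈y∙xz)
  open SetoidReasoning setoid

  Recurrence : (ℕ → Carrier) → (ℕ → Carrier) → Set
  Recurrence r f = ∀ n → ⟨ suc n ⟩ * f (suc n) ≈ r n + conv n (λ i j → x i * f j)

  -- Division by n + 1 expresses each value through earlier ones. The bound `m` in `go` makes the
  -- strong induction structural.
  recurrence-unique : ∀ {r f g} → Recurrence r f → Recurrence r g → f 0 ≈ g 0 → ∀ n → f n ≈ g n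
  recurrence-unique {r} {f} {g} rf rg e n = go n n ℕ.≤-refl
    where
    go : ∀ m n → n ℕ.≤ m → f n ≈ g n
    go m       zero    _         = e
    go (suc m) (suc n) (s≤s n≤m) = trans (divide n (trans (rf n) (trans (+-congˡ
      (conv-cong-bounded n λ i j i+j≡n → *-congˡ (go m j (ℕ.≤-trans (ℕ.m+n≤o⇒n≤o i (ℕ.≤-reflexive i+j≡n)) n≤m))))
      (sym (rg n))))) (sym (divide n refl))

  -- With H(t) = ∑ hₙ tⁿ, this is the coefficient of tⁿ⁺¹ in the Leibniz rule for t d/dt applied to
  -- tᵏ H(t), with Newton's identity for t H′(t).
  shift-newton : ∀ k n → ⟨ suc n ⟩ * shiftⁿ k h (suc n) ≈
                 ⟨ k ⟩ * shiftⁿ k h (suc n) + conv n (λ i j → x i * shiftⁿ k h j)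
  shift-newton zero    n = trans (newton n) (sym (trans (+-congʳ (trans (*-congʳ ⟨0⟩≈0) (zeroˡ _))) (+-identityˡ _)))
  shift-newton (suc k) zero = begin
    ⟨ 1 ⟩ * s 0
      ≈⟨ ⟨suc⟩ 0 (s 0) ⟩
    s 0 + ⟨ 0 ⟩ * s 0
      ≈⟨ +-congˡ (degree-0 k) ⟩
    s 0 + ⟨ k ⟩ * s 0
      ≈⟨ ⟨suc⟩ k (s 0) ⟨
    ⟨ suc k ⟩ * s 0
      ≈⟨ trans (+-congˡ (zeroʳ (x 0))) (+-identityʳ _) ⟨
    ⟨ suc k ⟩ * s 0 + x 0 * 0# ∎
    where
    s = shiftⁿ k h
    degree-0 : ∀ k → ⟨ 0 ⟩ * shiftⁿ k h 0 ≈ ⟨ k ⟩ * shiftⁿ k h 0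
    degree-0 zero    = refl
    degree-0 (suc k) = trans (zeroʳ _) (sym (zeroʳ _))
  shift-newton (suc k) (suc n) = begin
    ⟨ suc (suc n) ⟩ * s (suc n)
      ≈⟨ ⟨suc⟩ (suc n) _ ⟩
    s (suc n) + ⟨ suc n ⟩ * s (suc n)
      ≈⟨ +-congˡ (shift-newton k n) ⟩
    s (suc n) + (⟨ k ⟩ * s (suc n) + conv n (λ i j → x i * s j))
      ≈⟨ +-assoc _ _ _ ⟨
    s (suc n) + ⟨ k ⟩ * s (suc n) + conv n (λ i j → x i * s j)
      ≈⟨ +-cong (⟨suc⟩ k _) (trans (conv-last n (λ i j → x i * shift s j)) (trans (+-congˡ (zeroʳ _)) (+-identityʳ _))) ⟨
    ⟨ suc k ⟩ * s (suc n) + conv (suc n) (λ i j → x i * shift s j) ∎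
    where
    s = shiftⁿ k h

  conv-indicator : ∀ k (y f : ℕ → Carrier) → y k ≈ 1# → (∀ {i} → k ≢ i → y i ≈ 0#) →
                   ∀ n → conv n (λ i j → y i * f j) ≈ shiftⁿ k f n
  conv-indicator zero    y f y₁ y₀ n       = trans
    (conv-first n _ λ i j → trans (*-congʳ (y₀ λ ())) (zeroˡ _)) (trans (*-congʳ y₁) (*-identityˡ _))
  conv-indicator (suc k) y f y₁ y₀ zero    = trans (*-congʳ (y₀ λ ())) (zeroˡ _)
  conv-indicator (suc k) y f y₁ y₀ (suc n) = trans (+-cong (trans (*-congʳ (y₀ λ ())) (zeroˡ _))
    (conv-indicator k (y ∘ suc) f y₁ (λ k≢i → y₀ (k≢i ∘ ℕ.suc-injective)) n)) (+-identityˡ _)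

  module _ {E : Carrier → Carrier} (isE : IsDerivation A E) where
    open DerivationProperties A isE

    private
      D-recurrence : Recurrence (λ n → conv n λ i j → E (x i) * h j) (E ∘ h)
      D-recurrence n = begin
        ⟨ suc n ⟩ * E (h (suc n))       ≈⟨ D-ι* _ _ ⟨
        E (⟨ suc n ⟩ * h (suc n))       ≈⟨ D-cong (newton n) ⟩
        E (conv n λ i j → x i * h j)    ≈⟨ conv-additive A A D-+ n _ ⟩
        conv n (λ i j → E (x i * h j))  ≈⟨ conv-cong n (λ i j → D-* _ _) ⟩
        conv n (λ i j → E (x i) * h j + x i * E (h j))  ≈⟨ conv-+ n _ _ ⟩
        conv n (λ i j → E (x i) * h j) + conv n (λ i j → x i * E (h j)) ∎

      E-h₀ : E (h 0) ≈ 0#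
      E-h₀ = trans (D-cong h-zero) D-1

    D-h≈0 : (∀ i → E (x i) ≈ 0#) → ∀ n → E (h n) ≈ 0#
    D-h≈0 e = recurrence-unique D-recurrence (λ n → trans (zeroʳ _) (sym (trans
      (+-cong (conv-0 n _ λ i j _ → trans (*-congʳ (e i)) (zeroˡ _)) (conv-0 n _ λ i j _ → zeroʳ _)) (+-identityˡ 0#)))) E-h₀

    -- Differentiating Newton's identity shows that (k + 1) E(hₙ) solves the recurrence that
    -- `shift-newton` gives for the sequence shifted by k + 1. Both start at zero, so they agree.
    D-h≈shift : ∀ k → E (x k) ≈ 1# → (∀ {i} → k ≢ i → E (x i) ≈ 0#) →
                ∀ n → E (h n) ≈ ι (reciprocal k) * shiftⁿ (suc k) h n
    D-h≈shift k e₁ e₀ n = divide k (recurrence-unique {r = λ n → ⟨ suc k ⟩ * s (suc n)} scaled (shift-newton (suc k))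
      (trans (*-congˡ E-h₀) (zeroʳ _)) n)
      where
      s = shiftⁿ (suc k) h

      scaled : Recurrence (λ n → ⟨ suc k ⟩ * s (suc n)) (λ n → ⟨ suc k ⟩ * E (h n))
      scaled n = begin
        ⟨ suc n ⟩ * (⟨ suc k ⟩ * E (h (suc n)))
          ≈⟨ x∙yz≈y∙xz _ _ _ ⟩
        ⟨ suc k ⟩ * (⟨ suc n ⟩ * E (h (suc n)))
          ≈⟨ *-congˡ (D-recurrence n) ⟩
        ⟨ suc k ⟩ * (conv n (λ i j → E (x i) * h j) + conv n (λ i j → x i * E (h j)))
          ≈⟨ distribˡ _ _ _ ⟩
        ⟨ suc k ⟩ * conv n (λ i j → E (x i) * h j) + ⟨ suc k ⟩ * conv n (λ i j → x i * E (h j))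
          ≈⟨ +-cong (*-congˡ (conv-indicator k (E ∘ x) h e₁ e₀ n))
               (trans (*-distribˡ-conv _ n _) (conv-cong n λ i j → x∙yz≈y∙xz _ _ _)) ⟩
        ⟨ suc k ⟩ * s (suc n) + conv n (λ i j → x i * (⟨ suc k ⟩ * E (h j))) ∎

module NewtonSymmetric where

  open PowerSeries ℚ-algebra using (_⊛_; constant; Coefficients; coeff; ⊛-cong; constant-⊛)
  open SymmetricFunctions using (toSeries)
  open Sequences ℚ-algebra
  open ≡.≡-Reasoning

  private

    module Λ = ℚ-Algebra Λ

    [_] : Bool → ℚ
    [ b ] = if b then 1ℚ else 0ℚ

    pow : ℕ → Coefficients
    pow k = coeff (toSeries (powerSum (suc k)))

    η : ℕ → Coefficients
    η k α = [ sum α ≡ᵇ k ]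

    ≡ᵇ-≢ : ∀ m n → m ≢ n → (m ≡ᵇ n) ≡ false
    ≡ᵇ-≢ zero    zero    m≢n = ⊥-elim (m≢n ≡.refl)
    ≡ᵇ-≢ zero    (suc n) m≢n = ≡.refl
    ≡ᵇ-≢ (suc m) zero    m≢n = ≡.refl
    ≡ᵇ-≢ (suc m) (suc n) m≢n = ≡ᵇ-≢ m n (m≢n ∘ ≡.cong suc)

    no-parts : List ℕ → Bool
    no-parts α = does (List.≡-dec ℕ._≟_ (filter (λ a → ¬? (a ℕ.≟ 0)) α) [])

    no-parts-constant : ∀ α → [ no-parts α ] ≡ constant 1ℚ α
    no-parts-constant []          = ≡.refl
    no-parts-constant (zero ∷ α)  = no-parts-constant α
    no-parts-constant (suc _ ∷ α) = ≡.refl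

    ∧-* : ∀ a b → [ a ∧ b ] ≡ [ a ] ℚ.* [ b ]
    ∧-* true  b = ≡.sym (ℚ.*-identityˡ [ b ])
    ∧-* false b = ≡.sym (ℚ.*-zeroˡ [ b ])

    pow-suc : ∀ k i β → pow k (suc i ∷ β) ≡ constant [ i ≡ᵇ k ] β
    pow-suc k i β = ≡.trans (∧-* (i ≡ᵇ k) (no-parts β)) (≡.trans (≡.cong ([ i ≡ᵇ k ] ℚ.*_) (no-parts-constant β))
      (≡.trans (≡.sym (PowerSeries.constant-* ℚ-algebra [ i ≡ᵇ k ] 1ℚ β))
        (≡.cong (λ c → constant c β) (ℚ.*-identityʳ [ i ≡ᵇ k ]))))

    -- The number of exponents greater than k. In the degree k + 1 + j it is the coefficient at z^α
    -- of the (k + 1)-st power sum times hⱼ: each such exponent can give up k + 1 to the power sum.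
    partsOver : ℕ → List ℕ → ℚ
    partsOver k []      = 0ℚ
    partsOver k (a ∷ α) = partsOver k α ℚ.+ [ k <ᵇ a ]

    -- The contribution of one variable of exponent a + 1 when it supplies the power sum: at most
    -- one way of splitting the exponent survives. `c` and `s` are the degrees before and after that
    -- variable.
    single-part : ∀ k a c s j →
      conv a (λ i i′ → [ i ≡ᵇ k ] ℚ.* [ c ℕ.+ (i′ ℕ.+ s) ≡ᵇ j ]) ≡
      [ k <ᵇ suc a ] ℚ.* [ c ℕ.+ (suc a ℕ.+ s) ≡ᵇ suc k ℕ.+ j ]
    single-part zero a c s j = ≡.trans (conv-first a _ λ i i′ → ℚ.*-zeroˡ [ c ℕ.+ (i′ ℕ.+ s) ≡ᵇ j ])
      (≡.cong (λ m → 1ℚ ℚ.* [ m ≡ᵇ suc j ]) (≡.sym (ℕ.+-suc c (a ℕ.+ s))))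
    single-part (suc k) zero c s j = ≡.trans (ℚ.*-zeroˡ [ c ℕ.+ s ≡ᵇ j ]) (≡.sym (ℚ.*-zeroˡ [ c ℕ.+ suc s ≡ᵇ suc (suc k ℕ.+ j) ]))
    single-part (suc k) (suc a) c s j = begin
      0ℚ ℚ.* [ c ℕ.+ (suc a ℕ.+ s) ≡ᵇ j ] ℚ.+ conv a (λ i i′ → [ i ≡ᵇ k ] ℚ.* [ c ℕ.+ (i′ ℕ.+ s) ≡ᵇ j ])
        ≡⟨ ≡.cong₂ ℚ._+_ (ℚ.*-zeroˡ [ c ℕ.+ (suc a ℕ.+ s) ≡ᵇ j ]) (single-part k a c s j) ⟩
      0ℚ ℚ.+ [ k <ᵇ suc a ] ℚ.* [ c ℕ.+ (suc a ℕ.+ s) ≡ᵇ suc k ℕ.+ j ]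
        ≡⟨ ℚ.+-identityˡ _ ⟩
      [ k <ᵇ suc a ] ℚ.* [ c ℕ.+ (suc a ℕ.+ s) ≡ᵇ suc k ℕ.+ j ]
        ≡⟨ ≡.cong (λ m → [ k <ᵇ suc a ] ℚ.* [ m ≡ᵇ suc (suc k) ℕ.+ j ]) (ℕ.+-suc c (suc a ℕ.+ s)) ⟨
      [ k <ᵇ suc a ] ℚ.* [ c ℕ.+ (suc (suc a) ℕ.+ s) ≡ᵇ suc (suc k) ℕ.+ j ] ∎

    -- `c` is the degree assigned to hⱼ by the variables already passed. The power sum either skips
    -- the current variable, which is the induction, or lies wholly in it, which is `single-part`.
    pow-⊛ : ∀ k c j α → (pow k ⊛ λ β → [ c ℕ.+ sum β ≡ᵇ j ]) α ≡
                      partsOver k α ℚ.* [ c ℕ.+ sum α ≡ᵇ suc k ℕ.+ j ]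
    pow-⊛ k c j [] = ≡.trans (ℚ.*-zeroˡ [ c ℕ.+ 0 ≡ᵇ j ]) (≡.sym (ℚ.*-zeroˡ [ c ℕ.+ 0 ≡ᵇ suc k ℕ.+ j ]))
    pow-⊛ k c j (a ∷ α) = ≡.trans (split a) (≡.trans
      (≡.cong₂ ℚ._+_ first (rest a)) (≡.sym (ℚ.*-distribʳ-+ [ c ℕ.+ (a ℕ.+ sum α) ≡ᵇ suc k ℕ.+ j ] (partsOver k α) [ k <ᵇ a ])))
      where
      φ : ℕ → ℕ → ℚ
      φ i i′ = ((λ β → pow k (i ∷ β)) ⊛ (λ β → [ c ℕ.+ (i′ ℕ.+ sum β) ≡ᵇ j ])) α

      tail : ℕ → ℚ
      tail zero    = 0ℚ
      tail (suc a) = conv a (λ i i′ → φ (suc i) i′)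

      split : ∀ a → conv a φ ≡ φ 0 a ℚ.+ tail a
      split zero    = ≡.sym (ℚ.+-identityʳ _)
      split (suc a) = ≡.refl

      first : φ 0 a ≡ partsOver k α ℚ.* [ c ℕ.+ (a ℕ.+ sum α) ≡ᵇ suc k ℕ.+ j ]
      first = ≡.trans
        (⊛-cong {pow k} (λ β → ≡.refl) (λ β → ≡.cong (λ m → [ m ≡ᵇ j ]) (≡.sym (ℕ.+-assoc c a (sum β)))) α)
        (≡.trans (pow-⊛ k (c ℕ.+ a) j α) (≡.cong (λ m → partsOver k α ℚ.* [ m ≡ᵇ suc k ℕ.+ j ]) (ℕ.+-assoc c a (sum α))))

      rest : ∀ a → tail a ≡ [ k <ᵇ a ] ℚ.* [ c ℕ.+ (a ℕ.+ sum α) ≡ᵇ suc k ℕ.+ j ]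
      rest zero    = ≡.sym (ℚ.*-zeroˡ [ c ℕ.+ sum α ≡ᵇ suc k ℕ.+ j ])
      rest (suc a) = ≡.trans
        (conv-cong a λ i i′ → ≡.trans
          (⊛-cong {λ β → pow k (suc i ∷ β)} {g = λ β → [ c ℕ.+ (i′ ℕ.+ sum β) ≡ᵇ j ]} (pow-suc k i) (λ β → ≡.refl) α)
          (constant-⊛ [ i ≡ᵇ k ] (λ β → [ c ℕ.+ (i′ ℕ.+ sum β) ≡ᵇ j ]) α))
        (single-part k a c (sum α) j)

    one-part-total : ∀ n a → a ℕ.≤ suc n → conv n (λ i _ → [ i <ᵇ a ]) ≡ fromℕ a
    one-part-total n       zero          _         = conv-0 n _ λ i j _ → ≡.refl
    one-part-total zero    (suc zero)    _         = ≡.refl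
    one-part-total zero    (suc (suc a)) (s≤s ())
    one-part-total (suc n) (suc a)       (s≤s a≤n) =
      ≡.trans (≡.cong (1ℚ ℚ.+_) (one-part-total n a a≤n)) (≡.sym (fromℕ-+ 1 a))

    -- Double counting: an exponent a exceeds exactly the a numbers 0, ..., a - 1, all of which lie
    -- in the range of summation by the bound on the degree.
    parts-total : ∀ n α → sum α ℕ.≤ suc n → conv n (λ i _ → partsOver i α) ≡ fromℕ (sum α)
    parts-total n []      _  = conv-0 n _ λ i j _ → ≡.refl
    parts-total n (a ∷ α) le = begin
      conv n (λ i _ → partsOver i α ℚ.+ [ i <ᵇ a ])
        ≡⟨ conv-+ n (λ i _ → partsOver i α) (λ i _ → [ i <ᵇ a ]) ⟩
      conv n (λ i _ → partsOver i α) ℚ.+ conv n (λ i _ → [ i <ᵇ a ])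
        ≡⟨ ≡.cong₂ ℚ._+_ (parts-total n α (ℕ.m+n≤o⇒n≤o a le)) (one-part-total n a (ℕ.m+n≤o⇒m≤o a le)) ⟩
      fromℕ (sum α) ℚ.+ fromℕ a
        ≡⟨ fromℕ-+ (sum α) a ⟨
      fromℕ (sum α ℕ.+ a)
        ≡⟨ ≡.cong fromℕ (ℕ.+-comm (sum α) a) ⟩
      fromℕ (a ℕ.+ sum α) ∎

    newton-coeff : ∀ n α → fromℕ (suc n) ℚ.* η (suc n) α ≡ conv n (λ i j → (pow i ⊛ η j) α)
    newton-coeff n α = ≡.sym (begin
      conv n (λ i j → (pow i ⊛ η j) α)
        ≡⟨ conv-cong-bounded n (λ i j i+j≡n → ≡.trans (pow-⊛ i 0 j α)
             (≡.trans (≡.cong (λ m → partsOver i α ℚ.* [ sum α ≡ᵇ suc m ]) i+j≡n) (ℚ.*-comm (partsOver i α) _))) ⟩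
      conv n (λ i j → η (suc n) α ℚ.* partsOver i α)
        ≡⟨ *-distribˡ-conv (η (suc n) α) n (λ i _ → partsOver i α) ⟨
      η (suc n) α ℚ.* conv n (λ i _ → partsOver i α)
        ≡⟨ total (sum α ℕ.≟ suc n) ⟩
      η (suc n) α ℚ.* fromℕ (suc n)
        ≡⟨ ℚ.*-comm (η (suc n) α) (fromℕ (suc n)) ⟩
      fromℕ (suc n) ℚ.* η (suc n) α ∎)
      where
      -- Outside degree n + 1 the bound of `parts-total` may fail, but there the common factor
      -- `η (suc n) α` is zero.
      total : Dec (sum α ≡ suc n) → η (suc n) α ℚ.* conv n (λ i _ → partsOver i α) ≡ η (suc n) α ℚ.* fromℕ (suc n)
      total (yes eq) = ≡.cong (η (suc n) α ℚ.*_) (≡.trans (parts-total n α (ℕ.≤-reflexive eq)) (≡.cong fromℕ eq))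
      total (no  ≢)  = ≡.trans (vanish _) (≡.sym (vanish _))
        where
        vanish : ∀ x → η (suc n) α ℚ.* x ≡ 0ℚ
        vanish x = ≡.trans (≡.cong (λ b → [ b ] ℚ.* x) (≡ᵇ-≢ _ _ ≢)) (ℚ.*-zeroˡ x)

  complete-zero : ∀ α → coeff (toSeries (complete (+ 0))) α ≡ constant 1ℚ α
  complete-zero []          = ≡.refl
  complete-zero (zero ∷ α)  = complete-zero α
  complete-zero (suc _ ∷ α) = ≡.refl

  isNewton : IsNewton Λ (λ i → powerSum (suc i)) (λ n → complete (+ n))
  isNewton = record
    { h-zero = complete-zero
    ; newton = λ n α → ≡.trans (constant-⊛ (fromℕ (suc n)) (η (suc n)) α)
        (≡.trans (newton-coeff n α) (≡.sym (conv-additive Λ ℚ-algebra {λ f → coeff (toSeries f) α} (λ f g → ≡.refl) n (λ i j → powerSum (suc i) Λ.* complete (+ j))))) }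

-- Partial derivatives of power series

module PartialDerivatives (A : ℚ-Algebra) where

  open ℚ-Algebra A hiding (zero)
  open RawMonoidOps +-rawMonoid using () renaming (_×_ to _·_)
  open PowerSeries A
    using (Coefficients; Series; series; coeff; trailing; _≋_; _⊛_; _⊗_; constant; const; algebra; var; ∂; ∂-cong; exponent; raise
          ; ⊛-cong; ⊛-comm; constant-⊛)
  open Sequences A
  open Scalars A
  open CommSemigroupProperties *-commutativeSemigroup using (x∙yz≈y∙xz)
  open SetoidReasoning setoid
  private module S = ℚ-Algebra algebra

  ·≈* : ∀ n x → n · x ≈ ⟨ n ⟩ * x
  ·≈* zero    x = sym (trans (*-congʳ ⟨0⟩≈0) (zeroˡ x))
  ·≈* (suc n) x = trans (+-congˡ (·≈* n x)) (sym (⟨suc⟩ n x))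

  coeff-∂ : ∀ n f α → coeff (∂ n f) α ≈ ⟨ suc (exponent n α) ⟩ * coeff f (raise n α)
  coeff-∂ n f α = ·≈* (suc (exponent n α)) (coeff f (raise n α))

  ⊛-scaleˡ : ∀ c f g α → ((λ β → c * f β) ⊛ g) α ≈ c * (f ⊛ g) α
  ⊛-scaleˡ c f g []      = *-assoc _ _ _
  ⊛-scaleˡ c f g (a ∷ α) = trans (conv-cong a λ i j → ⊛-scaleˡ c (f ∘ (i ∷_)) (g ∘ (j ∷_)) α) (sym (*-distribˡ-conv c a _))

  ⊛-scaleʳ : ∀ c f g α → (f ⊛ (λ β → c * g β)) α ≈ c * (f ⊛ g) α
  ⊛-scaleʳ c f g α = trans (⊛-comm f (λ β → c * g β) α) (trans (⊛-scaleˡ c g f α) (*-congˡ (⊛-comm g f α)))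

  private

    slice : Series → ℕ → Series
    slice f i = series (coeff f ∘ (i ∷_)) (λ α → trailing f (i ∷ α))

    -- The Leibniz rule in one variable: a + 1 is split as i + j within each term, and the terms
    -- with i = 0 or j = 0 drop out of the respective sums.
    conv-euler : ∀ a φ → ⟨ suc a ⟩ * conv (suc a) φ ≈
      conv a (λ i j → ⟨ suc i ⟩ * φ (suc i) j) + conv a (λ i j → ⟨ suc j ⟩ * φ i (suc j))
    conv-euler a φ = begin
      ⟨ suc a ⟩ * conv (suc a) φ
        ≈⟨ *-distribˡ-conv ⟨ suc a ⟩ (suc a) φ ⟩
      conv (suc a) (λ i j → ⟨ suc a ⟩ * φ i j)
        ≈⟨ conv-cong-bounded (suc a) (λ i j i+j≡a → trans
             (*-congʳ (trans (reflexive (≡.cong ⟨_⟩ (≡.sym i+j≡a))) (⟨+⟩ i j))) (distribʳ (φ i j) ⟨ i ⟩ ⟨ j ⟩)) ⟩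
      conv (suc a) (λ i j → ⟨ i ⟩ * φ i j + ⟨ j ⟩ * φ i j)
        ≈⟨ conv-+ (suc a) (λ i j → ⟨ i ⟩ * φ i j) (λ i j → ⟨ j ⟩ * φ i j) ⟩
      conv (suc a) (λ i j → ⟨ i ⟩ * φ i j) + conv (suc a) (λ i j → ⟨ j ⟩ * φ i j)
        ≈⟨ +-cong (trans (+-congʳ (trans (*-congʳ ⟨0⟩≈0) (zeroˡ _))) (+-identityˡ _))
             (trans (conv-last a (λ i j → ⟨ j ⟩ * φ i j)) (trans (+-congˡ (trans (*-congʳ ⟨0⟩≈0) (zeroˡ _))) (+-identityʳ _))) ⟩
      conv a (λ i j → ⟨ suc i ⟩ * φ (suc i) j) + conv a (λ i j → ⟨ suc j ⟩ * φ i (suc j)) ∎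

    exponent-[] : ∀ n → exponent n [] ≡ 0
    exponent-[] zero    = ≡.refl
    exponent-[] (suc n) = ≡.refl

    ∂-*-zero : ∀ f g a α → coeff (∂ 0 (f ⊗ g)) (a ∷ α) ≈ coeff (∂ 0 f ⊗ g) (a ∷ α) + coeff (f ⊗ ∂ 0 g) (a ∷ α)
    ∂-*-zero f g a α = begin
      coeff (∂ 0 (f ⊗ g)) (a ∷ α)
        ≈⟨ coeff-∂ 0 (f ⊗ g) (a ∷ α) ⟩
      ⟨ suc a ⟩ * conv (suc a) (λ i j → (coeff (slice f i) ⊛ coeff (slice g j)) α)
        ≈⟨ conv-euler a (λ i j → (coeff (slice f i) ⊛ coeff (slice g j)) α) ⟩
      conv a (λ i j → ⟨ suc i ⟩ * (coeff (slice f (suc i)) ⊛ coeff (slice g j)) α) +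
      conv a (λ i j → ⟨ suc j ⟩ * (coeff (slice f i) ⊛ coeff (slice g (suc j))) α)
        ≈⟨ +-cong
             (conv-cong a λ i j → trans
               (⊛-cong {coeff (slice (∂ 0 f) i)} {g = coeff (slice g j)} (λ β → coeff-∂ 0 f (i ∷ β)) (λ β → refl) α)
               (⊛-scaleˡ ⟨ suc i ⟩ (coeff (slice f (suc i))) (coeff (slice g j)) α))
             (conv-cong a λ i j → trans
               (⊛-cong {coeff (slice f i)} {g = coeff (slice (∂ 0 g) j)} (λ β → refl) (λ β → coeff-∂ 0 g (j ∷ β)) α)
               (⊛-scaleʳ ⟨ suc j ⟩ (coeff (slice f i)) (coeff (slice g (suc j))) α)) ⟨
      coeff (∂ 0 f ⊗ g) (a ∷ α) + coeff (f ⊗ ∂ 0 g) (a ∷ α) ∎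

    -- The empty list denotes the same monomial as `0 ∷ []`, on which `raise` and the product
    -- compute by the general clause.
    from-0∷[] : ∀ f g → coeff f (0 ∷ []) ≈ coeff g (0 ∷ []) → coeff f [] ≈ coeff g []
    from-0∷[] f g e = trans (sym (trailing f [])) (trans e (trailing g []))

  ∂-* : ∀ n f g → ∂ n (f ⊗ g) ≋ (∂ n f ⊗ g) S.+ (f ⊗ ∂ n g)
  ∂-* zero    f g []      = from-0∷[] (∂ 0 (f ⊗ g)) ((∂ 0 f ⊗ g) S.+ (f ⊗ ∂ 0 g)) (∂-*-zero f g 0 [])
  ∂-* zero    f g (a ∷ α) = ∂-*-zero f g a α
  ∂-* (suc n) f g []      = from-0∷[] (∂ (suc n) (f ⊗ g)) ((∂ (suc n) f ⊗ g) S.+ (f ⊗ ∂ (suc n) g))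
    (∂-* n (slice f 0) (slice g 0) [])
  ∂-* (suc n) f g (a ∷ α) = begin
    coeff (∂ (suc n) (f ⊗ g)) (a ∷ α)
      ≈⟨ coeff-∂ (suc n) (f ⊗ g) (a ∷ α) ⟩
    ⟨ suc (exponent n α) ⟩ * conv a (λ i j → coeff (slice f i ⊗ slice g j) (raise n α))
      ≈⟨ *-distribˡ-conv ⟨ suc (exponent n α) ⟩ a _ ⟩
    conv a (λ i j → ⟨ suc (exponent n α) ⟩ * coeff (slice f i ⊗ slice g j) (raise n α))
      ≈⟨ conv-cong a (λ i j → trans (sym (coeff-∂ n (slice f i ⊗ slice g j) α)) (∂-* n (slice f i) (slice g j) α)) ⟩
    conv a (λ i j → coeff (∂ n (slice f i) ⊗ slice g j) α + coeff (slice f i ⊗ ∂ n (slice g j)) α)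
      ≈⟨ conv-+ a (λ i j → coeff (∂ n (slice f i) ⊗ slice g j) α) (λ i j → coeff (slice f i ⊗ ∂ n (slice g j)) α) ⟩
    coeff (∂ (suc n) f ⊗ g) (a ∷ α) + coeff (f ⊗ ∂ (suc n) g) (a ∷ α) ∎

  ∂-isDerivation : ∀ n → IsDerivation algebra (∂ n)
  ∂-isDerivation n = record
    { D-cong = λ {f} {g} → ∂-cong n {f} {g}
    ; D-+    = λ f g α → trans (coeff-∂ n (f S.+ g) α) (trans (distribˡ _ _ _)
                 (sym (+-cong (coeff-∂ n f α) (coeff-∂ n g α))))
    ; D-ι*   = λ c f α → trans (coeff-∂ n (const (ι c) ⊗ f) α) (trans (*-congˡ (constant-⊛ (ι c) (coeff f) (raise n α)))
                 (trans (x∙yz≈y∙xz _ _ _) (trans (*-congˡ (sym (coeff-∂ n f α))) (sym (constant-⊛ (ι c) (coeff (∂ n f)) α)))))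
    ; D-*    = ∂-* n }

  private
    raise-constant : ∀ n c α → constant c (raise n α) ≈ 0#
    raise-constant zero    c []          = refl
    raise-constant zero    c (a ∷ α)     = refl
    raise-constant (suc n) c []          = raise-constant n c []
    raise-constant (suc n) c (zero ∷ α)  = raise-constant n c α
    raise-constant (suc n) c (suc a ∷ α) = refl

  ∂-const : ∀ n c → ∂ n (const c) ≋ S.0#
  ∂-const n c α = trans (coeff-∂ n (const c) α) (trans (*-congˡ (raise-constant n c α)) (zeroʳ _))

  private
    var-raise-same : ∀ n α → ⟨ suc (exponent n α) ⟩ * coeff (var n) (raise n α) ≈ constant 1# α
    var-raise-same zero    []          = trans (*-congʳ ⟨1⟩≈1) (*-identityˡ _)
    var-raise-same zero    (zero ∷ α)  = trans (*-congʳ ⟨1⟩≈1) (*-identityˡ _)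
    var-raise-same zero    (suc a ∷ α) = zeroʳ _
    var-raise-same (suc n) []          = trans (*-congʳ (reflexive (≡.cong (⟨_⟩ ∘ suc) (≡.sym (exponent-[] n))))) (var-raise-same n [])
    var-raise-same (suc n) (zero ∷ α)  = var-raise-same n α
    var-raise-same (suc n) (suc a ∷ α) = zeroʳ _

    var-raise-other : ∀ n m α → n ≢ m → coeff (var m) (raise n α) ≈ 0#
    var-raise-other zero    zero    α           n≢m = ⊥-elim (n≢m ≡.refl)
    var-raise-other zero    (suc m) []          n≢m = refl
    var-raise-other zero    (suc m) (a ∷ α)     n≢m = refl
    var-raise-other (suc n) zero    []          n≢m = refl
    var-raise-other (suc n) zero    (zero ∷ α)  n≢m = refl
    var-raise-other (suc n) zero    (1 ∷ α)     n≢m = raise-constant n 1# α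
    var-raise-other (suc n) zero    (suc (suc a) ∷ α) n≢m = refl
    var-raise-other (suc n) (suc m) []          n≢m = var-raise-other n m [] (n≢m ∘ ≡.cong suc)
    var-raise-other (suc n) (suc m) (zero ∷ α)  n≢m = var-raise-other n m α (n≢m ∘ ≡.cong suc)
    var-raise-other (suc n) (suc m) (suc a ∷ α) n≢m = refl

  ∂-var-same : ∀ n → ∂ n (var n) ≋ S.1#
  ∂-var-same n α = trans (coeff-∂ n (var n) α) (var-raise-same n α)

  -- Applied with φ saying that a coefficient is killed by ∂/∂pₙ: this gives ∂p̃ₘ/∂pₙ = 0, as the
  -- coefficients of a variable are only 0 and 1.
  coeff-var : ∀ (φ : Carrier → Set) → φ 0# → φ 1# → ∀ n α → φ (coeff (var n) α)
  coeff-var φ φ₀ φ₁ zero    []                = φ₀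
  coeff-var φ φ₀ φ₁ (suc n) []                = φ₀
  coeff-var φ φ₀ φ₁ zero    (zero ∷ α)        = φ₀
  coeff-var φ φ₀ φ₁ zero    (1 ∷ α)           = go α
    where
    go : ∀ α → φ (constant 1# α)
    go []          = φ₁
    go (zero ∷ α)  = go α
    go (suc _ ∷ α) = φ₀
  coeff-var φ φ₀ φ₁ zero    (suc (suc _) ∷ α) = φ₀
  coeff-var φ φ₀ φ₁ (suc n) (zero ∷ α)        = coeff-var φ φ₀ φ₁ n α
  coeff-var φ φ₀ φ₁ (suc n) (suc _ ∷ α)       = φ₀

  ∂-var-other : ∀ {n m} → n ≢ m → ∂ n (var m) ≋ S.0#
  ∂-var-other {n} {m} n≢m α = trans (coeff-∂ n (var m) α) (trans (*-congˡ (var-raise-other n m α n≢m)) (zeroʳ _))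

-- The two inclusions into a tensor product

module TensorInclusions (A B : ℚ-Algebra) where

  private
    module A = ℚ-Algebra A
    module B = ℚ-Algebra B
    module T = ℚ-Algebra (TensorProduct.algebra A B)
  open TensorProduct A B using (_∼_; ⊗-cong; ⊗-zero; ⊗-distribʳ; ⊗-distribˡ; ⊗-scalar; Tensor)

  left : A.Carrier → Tensor
  left a = (a , B.1#) ∷ []

  right : B.Carrier → Tensor
  right b = (A.1# , b) ∷ []

  private
    ring-homomorphism : ∀ (R : ℚ-Algebra) (let module R = ℚ-Algebra R) (f : R.Carrier → Tensor) →
      (∀ {x y} → x R.≈ y → f x ∼ f y) → (∀ x y → f (x R.+ y) ∼ f x T.+ f y) → f R.0# ∼ T.0# →
      (∀ x y → f (x R.* y) ∼ f x T.* f y) → f R.1# ∼ T.1# → IsRingHomomorphism R.rawRing T.rawRing f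
    ring-homomorphism R f cong +-homo 0#-homo *-homo 1#-homo = record
      { isSemiringHomomorphism = record
        { isNearSemiringHomomorphism = record
          { +-isMonoidHomomorphism = record
            { isMagmaHomomorphism = record { isRelHomomorphism = record { cong = cong } ; homo = +-homo }
            ; ε-homo = 0#-homo }
          ; *-homo = *-homo }
        ; 1#-homo = 1#-homo }
      ; -‿homo = λ x → RingProperties.+-inverseʳ-unique T.ring (f x) (f (R.- x))
          (T.trans (T.sym (+-homo x (R.- x))) (T.trans (cong (R.-‿inverseʳ x)) 0#-homo)) }
      where module R = ℚ-Algebra R

  left-isHomomorphism : IsRingHomomorphism A.rawRing T.rawRing left
  left-isHomomorphism = ring-homomorphism A left (λ e → ⊗-cong e B.refl) (λ x y → ⊗-distribʳ x y B.1#) (⊗-zero B.1#)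
    (λ x y → ⊗-cong A.refl (B.sym (B.*-identityˡ B.1#))) T.refl

  right-isHomomorphism : IsRingHomomorphism B.rawRing T.rawRing right
  right-isHomomorphism = ring-homomorphism B right (λ e → ⊗-cong A.refl e) (λ x y → ⊗-distribˡ A.1# x y) right-0
    (λ x y → ⊗-cong (A.sym (A.*-identityˡ A.1#)) B.refl) T.refl
    where
    right-0 : right B.0# ∼ []
    -- The zero law of `∼` concerns the left factor only, so 0 is written as a scalar and moved
    -- across by `⊗-scalar`.
    right-0 = T.trans (⊗-cong A.refl (B.sym (B.trans (B.*-congʳ B.ι.0#-homo) (B.zeroˡ B.1#))))
      (T.trans (T.sym (⊗-scalar 0ℚ A.1# B.1#))
        (T.trans (⊗-cong (A.trans (A.*-congʳ A.ι.0#-homo) (A.zeroˡ A.1#)) B.refl) (⊗-zero B.1#)))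

  left-ι : ∀ c → left (A.ι c) ∼ T.ι c
  left-ι c = T.refl

  right-ι : ∀ c → right (B.ι c) ∼ T.ι c
  right-ι c = T.trans (⊗-cong A.refl (B.sym (B.*-identityʳ (B.ι c))))
    (T.trans (T.sym (⊗-scalar c A.1# B.1#)) (⊗-cong (A.*-identityʳ (A.ι c)) B.refl))

-- Partitions and Jacobi-Trudi determinants

part-decreasing : ∀ ν i → part ν (suc (suc i)) ℕ.≤ part ν (suc i)
part-decreasing (partition []          l)            i       = z≤n
part-decreasing (partition (a ∷ [])    l)            i       = z≤n
part-decreasing (partition (a ∷ b ∷ α) (r Linked.∷ l)) zero    = r
part-decreasing (partition (a ∷ b ∷ α) (r Linked.∷ l)) (suc i) = part-decreasing (partition (b ∷ α) l) i

part-vanishes : ∀ ν {d e} → d ℕ.≤ e → part ν (suc d) ≡ 0 → part ν (suc e) ≡ 0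
part-vanishes ν {d} {e} d≤e z = go (ℕ.≤⇒≤′ d≤e)
  where
  go : ∀ {e} → d ℕ.≤′ e → part ν (suc e) ≡ 0
  go ℕ.≤′-refl            = z
  go (ℕ.≤′-step {n} d≤′n) = ℕ.n≤0⇒n≡0 (ℕ.≤-trans (part-decreasing ν n) (ℕ.≤-reflexive (go d≤′n)))

module JacobiTrudi (A : ℚ-Algebra) where

  open ℚ-Algebra A hiding (zero)
  open Sequences A
  open FiniteSums commutativeRing
  open DeterminantProperties commutativeRing
  open RawMonoidOps +-rawMonoid using () renaming (sum to finSum)
  open SetoidReasoning setoid

  -- With the 0-based i, these are the indices of h in the first row of the paper's
  -- matrix: (i + 1) - 1 + ν_{d-(i+1)+1}.

  index : ∀ {d} → Partition → Fin d → ℕ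
  index {d} ν i = toℕ i ℕ.+ part ν (d ∸ toℕ i)

  shiftⁿ-zero : ∀ {n m} (f : ℕ → Carrier) → n ℕ.< m → shiftⁿ m f n ≈ 0#
  shiftⁿ-zero {zero}  {suc m} f _         = refl
  shiftⁿ-zero {suc n} {suc m} f (s≤s n<m) = shiftⁿ-zero {n} {m} f n<m

  shiftⁿ-diagonal : ∀ m (f : ℕ → Carrier) → shiftⁿ m f m ≈ f 0
  shiftⁿ-diagonal zero    f = refl
  shiftⁿ-diagonal (suc m) f = shiftⁿ-diagonal m f

  -- The Jacobi-Trudi determinant det(h with index νᵢ - i + j) after transposition and reversal of
  -- both index ranges: i = d - k and j = d - r.
  schur : (ℕ → Carrier) → ℕ → Partition → Carrier
  schur h d ν = Det {d} λ r k → shiftⁿ (toℕ r) h (index ν k)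

  module _ (h : ℕ → Carrier) (h₀ : h 0 ≈ 1#) where

    -- Parts are listed from the last one, so the additional zero part yields a new first column, 1
    -- followed by zeros. Removing it with the first row leaves the matrix for d, since the shift
    -- and the index both drop by one.
    schur-suc : ∀ d ν → part ν (suc d) ≡ 0 → schur h (suc d) ν ≈ schur h d ν
    schur-suc d ν z = begin
      Det {suc d} (λ r k → shiftⁿ (toℕ r) h (index ν k))
        ≈⟨ Det-transpose {suc d} (λ r k → shiftⁿ (toℕ r) h (index ν k)) ⟨
      Det {suc d} (λ k r → shiftⁿ (toℕ r) h (index ν k))
        ≈⟨ Det-first-row {d} (λ k r → shiftⁿ (toℕ r) h (index ν k))
             (trans (reflexive (≡.cong h z)) h₀) (λ r → trans (reflexive (≡.cong (shiftⁿ (suc (toℕ r)) h) z)) refl) ⟩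
      Det {d} (λ k r → shiftⁿ (toℕ r) h (index ν k))
        ≈⟨ Det-transpose {d} (λ r k → shiftⁿ (toℕ r) h (index ν k)) ⟩
      Det {d} (λ r k → shiftⁿ (toℕ r) h (index ν k)) ∎

    schur-stable : ∀ {d e} ν → d ℕ.≤ e → part ν (suc d) ≡ 0 → schur h e ν ≈ schur h d ν
    schur-stable {d} ν d≤e z = go (ℕ.≤⇒≤′ d≤e)
      where
      go : ∀ {e} → d ℕ.≤′ e → schur h e ν ≈ schur h d ν
      go ℕ.≤′-refl            = refl
      go (ℕ.≤′-step {n} d≤′n) = trans (schur-suc n ν (part-vanishes ν (ℕ.≤′⇒≤ d≤′n) z)) (go d≤′n)

    schur-independent : ∀ d e ν → part ν (suc d) ≡ 0 → part ν (suc e) ≡ 0 → schur h d ν ≈ schur h e ν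
    schur-independent d e ν zd ze with ℕ.≤-total d e
    ... | inj₁ d≤e = sym (schur-stable ν d≤e zd)
    ... | inj₂ e≤d = schur-stable ν e≤d ze

  ∑-extend : ∀ {m n} (f : ℕ → Carrier) → m ℕ.≤ n → (∀ i → m ℕ.≤ i → f i ≈ 0#) →
             ∑ {n} (f ∘ toℕ) ≈ ∑ {m} (f ∘ toℕ)
  ∑-extend {zero}  {n}     f _         e = trans (∑-0 λ i → e (toℕ i) z≤n) (sym (∑-zero _))
  ∑-extend {suc m} {suc n} f (s≤s m≤n) e = trans (∑-suc _)
    (trans (+-congˡ (∑-extend {m} {n} (f ∘ suc) m≤n λ i m≤i → e (suc i) (s≤s m≤i))) (sym (∑-suc _)))

  ∑-same-support : ∀ m n (f : ℕ → Carrier) → (∀ i → m ℕ.≤ i → f i ≈ 0#) → (∀ i → n ℕ.≤ i → f i ≈ 0#) →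
                   ∑ {m} (f ∘ toℕ) ≈ ∑ {n} (f ∘ toℕ)
  ∑-same-support m n f em en = trans
    (sym (∑-extend {m} {m ℕ.+ n} f (ℕ.m≤m+n m n) em)) (∑-extend {n} {m ℕ.+ n} f (ℕ.m≤n+m n m) en)

  conv-∑ : ∀ n (x f : ℕ → Carrier) → conv n (λ j l → x j * f l) ≈ ∑ {suc n} λ m → x (toℕ m) * shiftⁿ (toℕ m) f n
  conv-∑ zero    x f = sym (trans (∑-suc _) (trans (+-congˡ (∑-zero _)) (+-identityʳ _)))
  conv-∑ (suc n) x f = trans (+-congˡ (conv-∑ n (x ∘ suc) f)) (sym (∑-suc _))

  -- The determinant over an arbitrary algebra; for `𝐡` and `𝐡̃` it unfolds to `𝐓𝐖`, and a
  -- homomorphism carries it to the one for the image sequences.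
  TW : (hℤ h̃ℤ : ℤ → Carrier) → ℕ → Partition → Partition → Carrier
  TW hℤ h̃ℤ d ν μ = Determinant.det commutativeRing {d} λ r c →
    let i = suc (toℕ r) ; k = suc (toℕ c) in
    finSum {n = i ℕ.+ part μ (suc d ∸ i)} λ m → let j = suc (toℕ m) in
      h̃ℤ (+ i ℤ.- + j ℤ.+ + part μ (suc d ∸ i)) * hℤ (+ k ℤ.- + j ℤ.+ + part ν (suc d ∸ k))

  VanishesOnNegatives : (ℤ → Carrier) → Set
  VanishesOnNegatives fℤ = ∀ n → fℤ -[1+ n ] ≈ 0#

  module _ (fℤ : ℤ → Carrier) (negative : VanishesOnNegatives fℤ) where

    private
      f : ℕ → Carrier
      f n = fℤ (+ n)

    ⊖-shiftⁿ : ∀ n j → fℤ (n ℤ.⊖ j) ≈ shiftⁿ j f n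
    ⊖-shiftⁿ n       zero    = refl
    ⊖-shiftⁿ zero    (suc j) = negative j
    ⊖-shiftⁿ (suc n) (suc j) = trans (reflexive (≡.cong fℤ (ℤ.[1+m]⊖[1+n]≡m⊖n n j))) (⊖-shiftⁿ n j)

    index-shiftⁿ : ∀ i j q → fℤ (+ suc i ℤ.- + suc j ℤ.+ + q) ≈ shiftⁿ j f (i ℕ.+ q)
    index-shiftⁿ i j q = trans
      (reflexive (≡.cong fℤ (≡.trans (≡.cong (ℤ._+ + q) (ℤ.[1+m]⊖[1+n]≡m⊖n i j)) (ℤ.distribˡ-⊖-+-pos q i j))))
      (⊖-shiftⁿ (i ℕ.+ q) j)

  module _ (hℤ h̃ℤ : ℤ → Carrier)
           (h-negative : VanishesOnNegatives hℤ) (h̃-negative : VanishesOnNegatives h̃ℤ) where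

    private
      h h̃ : ℕ → Carrier
      h n = hℤ (+ n)
      h̃ n = h̃ℤ (+ n)

    TW-Det : ∀ d ν μ → TW hℤ h̃ℤ d ν μ ≈
             Det {d} λ r k → conv (index μ r) λ j l → shiftⁿ j h (index ν k) * h̃ l
    TW-Det d ν μ = trans (sym (Det≈det _)) (Det-cong λ r k → trans (sym (∑≈sum _))
      (trans (∑-cong λ m → trans
               (*-cong (index-shiftⁿ h̃ℤ h̃-negative (toℕ r) (toℕ m) _) (index-shiftⁿ hℤ h-negative (toℕ k) (toℕ m) _))
               (*-comm _ _))
             (sym (conv-∑ (index μ r) (λ j → shiftⁿ j h (index ν k)) h̃))))

    private
      L H : ∀ {d} → Partition → Matrix d
      L μ r m = shiftⁿ (toℕ m) h̃ (index μ r)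
      H ν m k = shiftⁿ (toℕ m) h (index ν k)

    -- The hypothesis cuts the inner index of the matrix product at d. Both factors become square,
    -- and the determinant is multiplicative.
    TW-factorisation : ∀ d ν μ →
      (∀ (r k : Fin d) m → d ℕ.≤ m → shiftⁿ m h (index ν k) * shiftⁿ m h̃ (index μ r) ≈ 0#) →
      TW hℤ h̃ℤ d ν μ ≈ schur h̃ d μ * schur h d ν
    TW-factorisation d ν μ vanish = begin
      TW hℤ h̃ℤ d ν μ
        ≈⟨ TW-Det d ν μ ⟩
      Det {d} (λ r k → conv (index μ r) λ j l → shiftⁿ j h (index ν k) * h̃ l)
        ≈⟨ Det-cong {d} (λ r k → begin
             conv (index μ r) (λ j l → shiftⁿ j h (index ν k) * h̃ l)
               ≈⟨ conv-∑ (index μ r) (λ j → shiftⁿ j h (index ν k)) h̃ ⟩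
             (∑ {suc (index μ r)} λ m → shiftⁿ (toℕ m) h (index ν k) * shiftⁿ (toℕ m) h̃ (index μ r))
               -- Neither bound need be the smaller one, but the terms vanish beyond each: past
               -- `index μ r` the index of h̃ is negative, and from d on `vanish` applies.
               ≈⟨ ∑-same-support (suc (index μ r)) d (λ m → shiftⁿ m h (index ν k) * shiftⁿ m h̃ (index μ r))
                    (λ m <m → trans (*-congˡ (shiftⁿ-zero {index μ r} {m} h̃ <m)) (zeroʳ _)) (vanish r k) ⟩
             (∑ {d} λ m → shiftⁿ (toℕ m) h (index ν k) * shiftⁿ (toℕ m) h̃ (index μ r))
               ≈⟨ ∑-cong {d} (λ m → *-comm _ _) ⟩
             (∑ {d} λ m → L μ r m * H ν m k) ∎) ⟩
      Det {d} (λ r k → ∑ {d} λ m → L μ r m * H ν m k)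
        ≈⟨ Det-* {d} (L μ) (H ν) ⟩
      Det {d} (L μ) * Det {d} (H ν)
        ≈⟨ *-congʳ (Det-transpose {d} (λ r k → L μ k r)) ⟩
      schur h̃ d μ * schur h d ν ∎

  module _ (f : ℕ → Carrier) (f₀ : f 0 ≈ 1#) where

    index-∅ : ∀ {d} (r : Fin d) → index ∅ r ≡ toℕ r
    index-∅ r = ℕ.+-identityʳ (toℕ r)

    -- For the empty partition `index ∅ r` is r itself, so the matrix is unitriangular. For the same
    -- reason its entries vanish from inner index d on, as `TW-factorisation` requires.
    schur-∅ : ∀ d → schur f d ∅ ≈ 1#
    schur-∅ d = Det-upper {d} (λ r k → shiftⁿ (toℕ r) f (index ∅ k))
      (λ r → trans (reflexive (≡.cong (shiftⁿ (toℕ r) f) (index-∅ r))) (trans (shiftⁿ-diagonal (toℕ r) f) f₀))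
      (λ r k k<r → trans (reflexive (≡.cong (shiftⁿ (toℕ r) f) (index-∅ k))) (shiftⁿ-zero {toℕ k} {toℕ r} f k<r))

    shiftⁿ-∅ : ∀ {d} (r : Fin d) m → d ℕ.≤ m → shiftⁿ m f (index ∅ r) ≈ 0#
    shiftⁿ-∅ r m d≤m = trans (reflexive (≡.cong (shiftⁿ m f) (index-∅ r)))
      (shiftⁿ-zero {toℕ r} {m} f (ℕ.<-≤-trans (toℕ<n r) d≤m))

  module _ (hℤ h̃ℤ : ℤ → Carrier)
           (h-negative : VanishesOnNegatives hℤ) (h̃-negative : VanishesOnNegatives h̃ℤ)
           (h₀ : hℤ (+ 0) ≈ 1#) (h̃₀ : h̃ℤ (+ 0) ≈ 1#) where

    TW-∅ʳ : ∀ d ν → TW hℤ h̃ℤ d ν ∅ ≈ schur (λ n → hℤ (+ n)) d ν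
    TW-∅ʳ d ν = trans
      (TW-factorisation hℤ h̃ℤ h-negative h̃-negative d ν ∅
        λ r k m d≤m → trans (*-congˡ (shiftⁿ-∅ (λ n → h̃ℤ (+ n)) h̃₀ r m d≤m)) (zeroʳ _))
      (trans (*-congʳ (schur-∅ (λ n → h̃ℤ (+ n)) h̃₀ d)) (*-identityˡ _))

    TW-∅ˡ : ∀ d μ → TW hℤ h̃ℤ d ∅ μ ≈ schur (λ n → h̃ℤ (+ n)) d μ
    TW-∅ˡ d μ = trans
      (TW-factorisation hℤ h̃ℤ h-negative h̃-negative d ∅ μ
        λ r k m d≤m → trans (*-congʳ (shiftⁿ-∅ (λ n → hℤ (+ n)) h₀ k m d≤m)) (zeroˡ _))
      (trans (*-congˡ (schur-∅ (λ n → hℤ (+ n)) h₀ d)) (*-identityʳ _))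

-- Transport along homomorphisms and the two forms of the theorem

open JacobiTrudi using (TW)

TW-homo : ∀ (A B : ℚ-Algebra) (let module A = ℚ-Algebra A) (let module B = ℚ-Algebra B)
          {f : A.Carrier → B.Carrier} → IsRingHomomorphism A.rawRing B.rawRing f →
          ∀ hℤ h̃ℤ d ν μ → f (TW A hℤ h̃ℤ d ν μ) B.≈ TW B (f ∘ hℤ) (f ∘ h̃ℤ) d ν μ
TW-homo A B {f} isHom hℤ h̃ℤ d ν μ = begin
  f (TW A hℤ h̃ℤ d ν μ)
    ≈⟨ ⟦⟧-cong (DA.Det≈det {d} _) ⟨
  f (DA.Det {d} λ r c → sumA (x r c))
    ≈⟨ Det-homo {d} (λ r c → sumA (x r c)) ⟩
  DB.Det {d} (λ r c → f (sumA (x r c)))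
    ≈⟨ DB.Det-cong {d} (λ r c → begin
         f (sumA (x r c))                 ≈⟨ ⟦⟧-cong (ΣA.∑≈sum (x r c)) ⟨
         f (ΣA.∑ (x r c))                 ≈⟨ ∑-homo (x r c) ⟩
         ΣB.∑ (λ m → f (x r c m))         ≈⟨ ΣB.∑-cong (λ m → *-homo _ _) ⟩
         ΣB.∑ (y r c)                     ≈⟨ ΣB.∑≈sum (y r c) ⟩
         sumB (y r c)                     ∎) ⟩
  DB.Det {d} (λ r c → sumB (y r c))
    ≈⟨ DB.Det≈det {d} _ ⟩
  TW B (f ∘ hℤ) (f ∘ h̃ℤ) d ν μ ∎
  where
  module A = ℚ-Algebra A
  module B = ℚ-Algebra B
  module ΣA = FiniteSums A.commutativeRing
  module ΣB = FiniteSums B.commutativeRing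
  module DA = DeterminantProperties A.commutativeRing
  module DB = DeterminantProperties B.commutativeRing
  open HomomorphismProperties A.commutativeRing B.commutativeRing isHom
  open SetoidReasoning B.setoid
  open RawMonoidOps A.+-rawMonoid using () renaming (sum to sumA)
  open RawMonoidOps B.+-rawMonoid using () renaming (sum to sumB)

  x : (r c : Fin d) → Fin (suc (toℕ r) ℕ.+ part μ (d ∸ toℕ r)) → A.Carrier
  x r c m = h̃ℤ (+ suc (toℕ r) ℤ.- + suc (toℕ m) ℤ.+ + part μ (d ∸ toℕ r)) A.*
            hℤ (+ suc (toℕ c) ℤ.- + suc (toℕ m) ℤ.+ + part ν (d ∸ toℕ c))

  y : (r c : Fin d) → Fin (suc (toℕ r) ℕ.+ part μ (d ∸ toℕ r)) → B.Carrier
  y r c m = f (h̃ℤ (+ suc (toℕ r) ℤ.- + suc (toℕ m) ℤ.+ + part μ (d ∸ toℕ r))) B.*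
            f (hℤ (+ suc (toℕ c) ℤ.- + suc (toℕ m) ℤ.+ + part ν (d ∸ toℕ c)))

-- Newton's identities are verified on symmetric functions once; this carries them into the tensor
-- product along either inclusion, and on to V along F.
IsNewton-homo : ∀ (A B : ℚ-Algebra) (let module A = ℚ-Algebra A) (let module B = ℚ-Algebra B)
                {f : A.Carrier → B.Carrier} → IsAlgebraHomomorphism A B f →
                ∀ {x h y} → (∀ n → f (x n) B.≈ y n) → IsNewton A x h → IsNewton B y (f ∘ h)
IsNewton-homo A B {f} isHom {x} {h} {y} x↦y isNewton = record
  { h-zero = B.trans (⟦⟧-cong h-zero) 1#-homo
  ; newton = λ n → begin
      B.ι (fromℕ (suc n)) B.* f (h (suc n))    ≈⟨ B.*-congʳ (preserves-ι (fromℕ (suc n))) ⟨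
      f (A.ι (fromℕ (suc n))) B.* f (h (suc n))  ≈⟨ *-homo _ _ ⟨
      f (A.ι (fromℕ (suc n)) A.* h (suc n))    ≈⟨ ⟦⟧-cong (newton n) ⟩
      f (conv A n λ i j → x i A.* h j)         ≈⟨ conv-additive A B +-homo n _ ⟩
      conv B n (λ i j → f (x i A.* h j))       ≈⟨ conv-cong B n (λ i j → B.trans (*-homo _ _) (B.*-congʳ (x↦y i))) ⟩
      conv B n (λ i j → y i B.* f (h j))       ∎ }
  where
  module A = ℚ-Algebra A
  module B = ℚ-Algebra B
  open IsAlgebraHomomorphism isHom
  open IsRingHomomorphism isRingHomomorphism
  open IsNewton isNewton
  open Sequences using (conv; conv-cong)
  open SetoidReasoning B.setoid

module DeltaTW (A : ℚ-Algebra)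
  {x x̃ : ℕ → ℚ-Algebra.Carrier A} {hℤ h̃ℤ : ℤ → ℚ-Algebra.Carrier A}
  (isNewton : IsNewton A x (hℤ ∘ +_)) (isNewton~ : IsNewton A x̃ (h̃ℤ ∘ +_))
  (h-negative : JacobiTrudi.VanishesOnNegatives A hℤ) (h̃-negative : JacobiTrudi.VanishesOnNegatives A h̃ℤ)
  {∂ : ℕ ⊎ ℕ → ℚ-Algebra.Carrier A → ℚ-Algebra.Carrier A} (isPartial : IsPartialDerivatives A [ x , x̃ ] ∂)
  where

  open ℚ-Algebra A hiding (zero)

  open Delta A (∂ ∘ inj₁) (∂ ∘ inj₂)
  open JacobiTrudi A hiding (TW)
  open IsPartialDerivatives isPartial

  private
    h h̃ : ℕ → Carrier
    h = hℤ ∘ +_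
    h̃ = h̃ℤ ∘ +_

    h₀ : h 0 ≈ 1#
    h₀ = IsNewton.h-zero isNewton

    h̃₀ : h̃ 0 ≈ 1#
    h̃₀ = IsNewton.h-zero isNewton~

    ∂-isDerivation : ∀ i → IsDerivation A (∂ i)
    ∂-isDerivation i = record { D-cong = ∂-cong i ; D-+ = ∂-+ i ; D-ι* = ∂-ι* i ; D-* = ∂-* i }

    module h = NewtonDerivatives A isNewton
    module h̃ = NewtonDerivatives A isNewton~

    open GeneratingFunctions A (∂ ∘ inj₁) (∂ ∘ inj₂) (∂-isDerivation ∘ inj₁) (∂-isDerivation ∘ inj₂) h h̃
      (λ n → h.D-h≈shift (∂-isDerivation (inj₁ n)) n (∂-same (inj₁ n)) (λ {i} n≢i → ∂-other {inj₁ n} {inj₁ i} (n≢i ∘ inj₁-injective)))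
      (λ n → h.D-h≈0 (∂-isDerivation (inj₂ n)) (λ i → ∂-other {inj₂ n} {inj₁ i} λ ()))
      (λ n → h̃.D-h≈0 (∂-isDerivation (inj₁ n)) (λ i → ∂-other {inj₁ n} {inj₂ i} λ ()))
      (λ n → h̃.D-h≈shift (∂-isDerivation (inj₂ n)) n (∂-same (inj₂ n)) (λ {i} n≢i → ∂-other {inj₂ n} {inj₂ i} (n≢i ∘ inj₂-injective)))

  Δ-cong : ∀ {f f′ g g′} → f ≈ f′ → g ≈ g′ → Δ f′ ↝ g′ → Δ f ↝ g
  Δ-cong e e′ (N , Δf) = N , λ K I N≤K N≤I →
    trans (DeltaOnEigenvectors.truncated-cong A (∂ ∘ inj₁) (∂ ∘ inj₂) (∂-isDerivation ∘ inj₁) (∂-isDerivation ∘ inj₂) K I e)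
      (trans (Δf K I N≤K N≤I) (sym e′))

  -- The three sizes are unrelated, whereas `Δ-Det` works with one d. The two sources are therefore
  -- first reduced to Jacobi-Trudi determinants, whose independence of the size moves them to `d`.
  Δ-TW : ∀ ν μ d₁ d₂ d → Admissible d₁ ν ∅ → Admissible d₂ ∅ μ → Admissible d ν μ →
         Δ TW A hℤ h̃ℤ d₁ ν ∅ * TW A hℤ h̃ℤ d₂ ∅ μ ↝ TW A hℤ h̃ℤ d ν μ
  Δ-TW ν μ d₁ d₂ d (_ , ν₁ , _) (_ , _ , μ₂) (_ , νd , μd) = Δ-cong
    (*-cong
      (trans (TW-∅ʳ hℤ h̃ℤ h-negative h̃-negative h₀ h̃₀ d₁ ν) (schur-independent h h₀ d₁ d ν ν₁ νd))
      (trans (TW-∅ˡ hℤ h̃ℤ h-negative h̃-negative h₀ h̃₀ d₂ μ) (trans (schur-independent h̃ h̃₀ d₂ d μ μ₂ μd)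
        (DeterminantProperties.Det-transpose commutativeRing {d} λ r k → shiftⁿ (toℕ k) h̃ (index μ r)))))
    (TW-Det hℤ h̃ℤ h-negative h̃-negative d ν μ)
    (Δ-Det {d} (index ν) (index μ))
    where open Sequences A using (shiftⁿ)

-- V is an iterated power series ring: `∂p` differentiates the coefficients of a series in the p̃ₖ
-- and is thus a lifted derivation, while `∂p̃` differentiates the outer series.
V-isPartial : IsPartialDerivatives V [ p , p̃ ] [ ∂p , ∂p̃ ]
V-isPartial = record
  { ∂-cong  = λ { (inj₁ n) {f} {g} → IsDerivation.D-cong (∂p-der n) {f} {g} ; (inj₂ n) {f} {g} → IsDerivation.D-cong (∂p̃-der n) {f} {g} }
  ; ∂-+     = λ { (inj₁ n) → IsDerivation.D-+ (∂p-der n) ; (inj₂ n) → IsDerivation.D-+ (∂p̃-der n) }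
  ; ∂-ι*    = λ { (inj₁ n) → IsDerivation.D-ι* (∂p-der n) ; (inj₂ n) → IsDerivation.D-ι* (∂p̃-der n) }
  ; ∂-*     = λ { (inj₁ n) → IsDerivation.D-* (∂p-der n) ; (inj₂ n) → IsDerivation.D-* (∂p̃-der n) }
  ; ∂-same  = λ { (inj₁ n) → ∂p-const n (ℚ[[p]].var n) (ℚ-Algebra.1# ℚ[[p]].algebra) (Q.∂-var-same n) ; (inj₂ n) → QQ.∂-var-same n }
  ; ∂-other = λ { {inj₁ n} {inj₁ m} n≢m α → V-0 n m (n≢m ∘ ≡.cong inj₁) α
                ; {inj₁ n} {inj₂ m} n≢m → ∂p-var n m
                ; {inj₂ n} {inj₁ m} n≢m → QQ.∂-const n (ℚ[[p]].var m)
                ; {inj₂ n} {inj₂ m} n≢m → QQ.∂-var-other (n≢m ∘ ≡.cong inj₂) } }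
  where
  module Q = PartialDerivatives ℚ-algebra
  module QQ = PartialDerivatives ℚ[[p]].algebra
  module L n = SeriesProperties.Lift ℚ[[p]].algebra (Q.∂-isDerivation n)

  ∂p-der : ∀ n → IsDerivation V (∂p n)
  ∂p-der n = record
    { D-cong = λ {f} {g} → IsDerivation.D-cong (L.lift-isDerivation n) {f} {g}
    ; D-+    = IsDerivation.D-+ (L.lift-isDerivation n)
    ; D-ι*   = IsDerivation.D-ι* (L.lift-isDerivation n)
    ; D-*    = IsDerivation.D-* (L.lift-isDerivation n) }

  ∂p̃-der : ∀ n → IsDerivation V (∂p̃ n)
  ∂p̃-der n = QQ.∂-isDerivation n

  open ℚ[[p]][[p̃]] using (const; constant-cong; constant-0)

  ∂p-const : ∀ n x y → ℚ[[p]].∂ n x ℚ[[p]].≋ y → ∂p n (const x) V.≈ const y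
  ∂p-const n x y e β γ = ≡.trans (L.lift-const n x β γ) (constant-cong {ℚ[[p]].∂ n x} {y} e β γ)

  V-0 : ∀ n m → n ≢ m → ∂p n (p m) V.≈ V.0#
  V-0 n m n≢m β γ = ≡.trans (∂p-const n (ℚ[[p]].var m) (ℚ-Algebra.0# ℚ[[p]].algebra) (Q.∂-var-other n≢m) β γ) (constant-0 β γ)

  ∂p-var : ∀ n m → ∂p n (p̃ m) V.≈ V.0#
  ∂p-var n m β = QQ.coeff-var (λ c → ℚ[[p]].∂ n c ℚ[[p]].≋ ℚ-Algebra.0# ℚ[[p]].algebra)
    (DerivationProperties.D-0 ℚ[[p]].algebra (Q.∂-isDerivation n)) (DerivationProperties.D-1 ℚ[[p]].algebra (Q.∂-isDerivation n)) m β

Λ↪X : IsAlgebraHomomorphism Λ Λ[X,Y] (TensorInclusions.left Λ Λ)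
Λ↪X = record { isRingHomomorphism = TensorInclusions.left-isHomomorphism Λ Λ ; preserves-ι = TensorInclusions.left-ι Λ Λ }

Λ↪Y : IsAlgebraHomomorphism Λ Λ[X,Y] (TensorInclusions.right Λ Λ)
Λ↪Y = record { isRingHomomorphism = TensorInclusions.right-isHomomorphism Λ Λ ; preserves-ι = TensorInclusions.right-ι Λ Λ }

newton-X : IsNewton Λ[X,Y] (𝐩 ∘ suc) (𝐡 ∘ +_)
newton-X = IsNewton-homo Λ Λ[X,Y] Λ↪X (λ n → Λ[X,Y].refl) NewtonSymmetric.isNewton

newton-Y : IsNewton Λ[X,Y] (𝐩̃ ∘ suc) (𝐡̃ ∘ +_)
newton-Y = IsNewton-homo Λ Λ[X,Y] Λ↪Y (λ n → Λ[X,Y].refl) NewtonSymmetric.isNewton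

𝐡-negative : JacobiTrudi.VanishesOnNegatives Λ[X,Y] 𝐡
𝐡-negative n = IsRingHomomorphism.0#-homo (TensorInclusions.left-isHomomorphism Λ Λ)

𝐡̃-negative : JacobiTrudi.VanishesOnNegatives Λ[X,Y] 𝐡̃
𝐡̃-negative n = IsRingHomomorphism.0#-homo (TensorInclusions.right-isHomomorphism Λ Λ)

module _ {F : Λ[X,Y].Carrier → V.Carrier} (isHom : IsAlgebraHomomorphism Λ[X,Y] V F)
         (F𝐩 : ∀ n → F (𝐩 (suc n)) V.≈ p n) (F𝐩̃ : ∀ n → F (𝐩̃ (suc n)) V.≈ p̃ n) where

  open IsAlgebraHomomorphism isHom using (isRingHomomorphism)
  open IsRingHomomorphism isRingHomomorphism using (⟦⟧-cong; 0#-homo)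

  private

    negative : ∀ fℤ → JacobiTrudi.VanishesOnNegatives Λ[X,Y] fℤ → JacobiTrudi.VanishesOnNegatives V (F ∘ fℤ)
    negative fℤ e n = V.trans {F (fℤ -[1+ n ])} {F Λ[X,Y].0#} {V.0#} (⟦⟧-cong (e n)) 0#-homo

    TWⱽ : ℕ → Partition → Partition → V.Carrier
    TWⱽ = TW V (F ∘ 𝐡) (F ∘ 𝐡̃)

    F-TW : ∀ d ν μ → F (𝐓𝐖 d ν μ) V.≈ TWⱽ d ν μ
    F-TW = TW-homo Λ[X,Y] V isRingHomomorphism 𝐡 𝐡̃

    open DeltaTW V {p} {p̃} {F ∘ 𝐡} {F ∘ 𝐡̃}
      (IsNewton-homo Λ[X,Y] V isHom {y = p} F𝐩 newton-X) (IsNewton-homo Λ[X,Y] V isHom {y = p̃} F𝐩̃ newton-Y)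
      (negative 𝐡 𝐡-negative) (negative 𝐡̃ 𝐡̃-negative) V-isPartial

  open Delta V ∂p ∂p̃

  Δ-TW-image : ∀ ν μ d₁ d₂ d → Admissible d₁ ν ∅ → Admissible d₂ ∅ μ → Admissible d ν μ →
               Δ F (𝐓𝐖 d₁ ν ∅) V.* F (𝐓𝐖 d₂ ∅ μ) ↝ F (𝐓𝐖 d ν μ)
  Δ-TW-image ν μ d₁ d₂ d ad₁ ad₂ ad = Δ-cong
    {F (𝐓𝐖 d₁ ν ∅) V.* F (𝐓𝐖 d₂ ∅ μ)} {TWⱽ d₁ ν ∅ V.* TWⱽ d₂ ∅ μ} {F (𝐓𝐖 d ν μ)} {TWⱽ d ν μ}
    (V.*-cong {F (𝐓𝐖 d₁ ν ∅)} {TWⱽ d₁ ν ∅} {F (𝐓𝐖 d₂ ∅ μ)} {TWⱽ d₂ ∅ μ} (F-TW d₁ ν ∅) (F-TW d₂ ∅ μ))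
    (F-TW d ν μ)
    (Δ-TW ν μ d₁ d₂ d ad₁ ad₂ ad)

theorem3 : (ν μ : Partition) (d₁ d₂ d : ℕ) →
    Admissible d₁ ν ∅ → Admissible d₂ ∅ μ → Admissible d ν μ →
    ( (F : Λ[X,Y].Carrier → V.Carrier) → IsAlgebraHomomorphism Λ[X,Y] V F →
    (∀ n → F (𝐩 (suc n)) V.≈ p n) → (∀ n → F (𝐩̃ (suc n)) V.≈ p̃ n) →
    let open Delta V ∂p ∂p̃
    in Δ F (𝐓𝐖 d₁ ν ∅) V.* F (𝐓𝐖 d₂ ∅ μ) ↝ F (𝐓𝐖 d ν μ) )
    ×
    ( (∂ : ℕ ⊎ ℕ → Λ[X,Y].Carrier → Λ[X,Y].Carrier) →
    IsPartialDerivatives Λ[X,Y] [ 𝐩 ∘ suc , 𝐩̃ ∘ suc ] ∂ →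
    let open Delta Λ[X,Y] (∂ ∘ inj₁) (∂ ∘ inj₂)
    in Δ 𝐓𝐖 d₁ ν ∅ Λ[X,Y].* 𝐓𝐖 d₂ ∅ μ ↝ 𝐓𝐖 d ν μ )
theorem3 ν μ d₁ d₂ d ad₁ ad₂ ad =
  (λ F isHom F𝐩 F𝐩̃ → Δ-TW-image isHom F𝐩 F𝐩̃ ν μ d₁ d₂ d ad₁ ad₂ ad) ,
  (λ ∂ isPartial → DeltaTW.Δ-TW Λ[X,Y] {hℤ = 𝐡} {𝐡̃} newton-X newton-Y 𝐡-negative 𝐡̃-negative isPartial
                     ν μ d₁ d₂ d ad₁ ad₂ ad)
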